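{- Let $\Sigma$ be an alphabet, $\mathcal F$ a searchable family of graphs over $\Sigma$, and $k\ge1$. Then, on $\mathcal F$, the graph languages accepted by deterministic $k$-head graph-walking automata with nested pebbles are exactly those definable by closed formulas of FO+DTC$^k$: for every such automaton $\mathcal A$ there is a closed FO+DTC$^k$ formula $\phi$ with $\{g\in\mathcal F\mid g\in L(\mathcal A)\}=\{g\in\mathcal F\mid g\models\phi\}$, and for every closed FO+DTC$^k$ formula $\phi$ there is such an automaton $\mathcal A$ with the same property. That is, $\mathrm{DPTWA}^k=\mathrm{FO{+}DTC}^k$ on $\mathcal F$.
   Context: Graphs: nonempty finite directed graphs, weakly connected, whose nodes and edges are labelled from a common alphabet $\Sigma$, such that no node has two outgoing edges with the same label nor two incoming edges with the same label (parallel edges and loops allowed). Logic for graphs: node variables; atomic formulas $\mathrm{lab}_\sigma(x)$, $\mathrm{edg}_\sigma(x,y)$ ($\sigma$-labelled edge from $x$ to $y$), $x=y$; closed under $\neg,\wedge,\vee,\exists,\forall$. $k$-ary transitive closure: for $\phi$ with $k$-tuples $\bar x,\bar y$ of distinct free variables (other free variables fixed), $g\models\phi^*(\bar u,\bar v)$ iff there are $k$-tuples $\bar u_0=\bar u,\dots,\bar u_n=\bar v$ ($n\ge0$) with $g\models\phi(\bar u_i,\bar u_{i+1})$ for all $i<n$; deterministic if $\phi$ is functional (for every graph, valuation of the other variables and $\bar u$, at most one $\bar v$ satisfies $\phi(\bar u,\bar v)$). FO+DTC$^k$ allows only deterministic $k$-ary transitive closure. Automata: a $k$-head graph-walking automaton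 with nested pebbles is $\mathcal A=(Q,\Sigma,X,q_0,A,I)$ with finite states, finite pebble set $X$, initial state $q_0$, accepting states $A$, and instructions $\langle p,\chi,q\rangle$ where $\chi$ is $\mathrm{inmove}_{i,\sigma}$ / $\mathrm{outmove}_{i,\sigma}$ (move head $i$ backwards along its incoming / forwards along its outgoing $\sigma$-labelled edge), $\mathrm{drop}_i(x)$ (push $(x,u[i])$ on the pebble stack if $x$ is not on it), $\mathrm{retrieve}(x)$ (pop the top pair if its pebble is $x$, regardless of head positions), or a test $\mathrm{lab}_{i,\sigma}$, $\mathrm{peb}_i(x)$, $\mathrm{inedge}_{i,\sigma}$, $\mathrm{outedge}_{i,\sigma}$ on the node under head $i$ (label is $\sigma$; pebble $x$ lies there; has an incoming / outgoing $\sigma$-edge), or its negation. Configurations are $[p,\bar u,\alpha]$; halting if no instruction applies. $\mathrm{acc}(u)$ means that from $[q_0,(u,\dots,u),\varepsilon]$ some halting $[q,\bar v,\varepsilon]$ with $q\in A$ is reachable; automata are required to satisfy, for every graph over $\Sigma$, $\mathrm{acc}(u_1)\Rightarrow\mathrm{acc}(u_2)$ for all nodes $u_1,u_2$, and $L(\mathcal A)$ is the set of graphs $g$ with $\mathrm{acc}(u)$ for all nodes $u$. $\mathcal A$ is deterministic if any two distinct instructions from the same state have $\chi_1=\neg\chi_2$ or $\chi_2=\neg\chi_1$. Searchable: a family $\mathcal F$ is searchable if there is a fixed single-head deterministic graph-walking automaton with nested pebbles (the guide) such that for every graph in $\mathcal F$ and every node of it, when started at that node in its initial state, it halts after a walk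 during which every node of the graph is visited at least once. -}

module Defs where

open import Data.Nat using (ℕ; zero; suc)
open import Data.Fin using (Fin; zero; suc)
open import Data.Bool using (Bool; true)
open import Data.Maybe using (Maybe; just)
open import Data.Vec using (Vec; []; _∷_; lookup; replicate; toList; _++_; _[_]≔_)
import Data.Vec as Vec
open import Data.List using (List; []; _∷_)
open import Data.List.Membership.Propositional using (_∈_)
open import Data.List.Relation.Unary.Any using (Any)
open import Data.List.Relation.Unary.Unique.Propositional using (Unique)
open import Data.Product using (Σ; ∃; ∃-syntax; _×_; _,_; proj₁)
open import Data.Sum using (_⊎_)
open import Data.Empty using (⊥)
open import Relation.Nullary using (¬_)
open import Relation.Binary.PropositionalEquality using (_≡_; _≢_)
open import Relation.Binary.Construct.Closure.ReflexiveTransitive using (Star)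
open import Function.Bundles using (_⇔_)

-- Graphs over the alphabet Σ = Fin s.
-- Nodes are Fin (suc m) (nonempty, finite).  Because no node has two
-- outgoing (resp. incoming) edges with the same label, the σ-labelled
-- edges are exactly a partial injective function  out _ σ : Node ⇀ Node
-- (out u σ ≡ just v  iff  there is a σ-edge from u to v).

record Graph (s : ℕ) : Set where
  field
    m     : ℕ
    nlab  : Fin (suc m) → Fin s
    out   : Fin (suc m) → Fin s → Maybe (Fin (suc m))
    inj   : ∀ u u' v σ → out u σ ≡ just v → out u' σ ≡ just v → u ≡ u'
    conn  : ∀ u v → Star (λ a b → (∃[ σ ] out a σ ≡ just b) ⊎ (∃[ σ ] out b σ ≡ just a)) u v

  Node : Set
  Node = Fin (suc m)

open Graph public

data Formula (s k : ℕ) : Set where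
  lab  : Fin s → ℕ → Formula s k
  edg  : Fin s → ℕ → ℕ → Formula s k
  eq   : ℕ → ℕ → Formula s k
  neg  : Formula s k → Formula s k
  and  : Formula s k → Formula s k → Formula s k
  or   : Formula s k → Formula s k → Formula s k
  ex   : ℕ → Formula s k → Formula s k
  all  : ℕ → Formula s k → Formula s k
  -- tc xs ys φ us vs  stands for  φ*_{xs,ys}(us, vs)
  tc   : Vec ℕ k → Vec ℕ k → Formula s k → Vec ℕ k → Vec ℕ k → Formula s k

data Free {s k : ℕ} (x : ℕ) : Formula s k → Set where
  f-lab  : ∀ {σ} → Free x (lab σ x)
  f-edg₁ : ∀ {σ y} → Free x (edg σ x y)
  f-edg₂ : ∀ {σ y} → Free x (edg σ y x)
  f-eq₁  : ∀ {y} → Free x (eq x y)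
  f-eq₂  : ∀ {y} → Free x (eq y x)
  f-neg  : ∀ {φ} → Free x φ → Free x (neg φ)
  f-and₁ : ∀ {φ ψ} → Free x φ → Free x (and φ ψ)
  f-and₂ : ∀ {φ ψ} → Free x ψ → Free x (and φ ψ)
  f-or₁  : ∀ {φ ψ} → Free x φ → Free x (or φ ψ)
  f-or₂  : ∀ {φ ψ} → Free x ψ → Free x (or φ ψ)
  f-ex   : ∀ {y φ} → x ≢ y → Free x φ → Free x (ex y φ)
  f-all  : ∀ {y φ} → x ≢ y → Free x φ → Free x (all y φ)
  f-tcφ  : ∀ {xs ys φ us vs} → ¬ (x ∈ toList xs) → ¬ (x ∈ toList ys) → Free x φ
         → Free x (tc xs ys φ us vs)
  f-tcu  : ∀ {xs ys φ us vs} → x ∈ toList us → Free x (tc xs ys φ us vs)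
  f-tcv  : ∀ {xs ys φ us vs} → x ∈ toList vs → Free x (tc xs ys φ us vs)

Closed : ∀ {s k} → Formula s k → Set
Closed φ = ∀ x → ¬ Free x φ

Val : ∀ {s} → Graph s → Set
Val g = ℕ → Node g

upd : ∀ {s} (g : Graph s) → Val g → ℕ → Node g → Val g
upd g ν x a y with Data.Nat._≟_ x y
... | Relation.Nullary.yes _ = a
... | Relation.Nullary.no _  = ν y

updVec : ∀ {s n} (g : Graph s) → Val g → Vec ℕ n → Vec (Node g) n → Val g
updVec g ν []       []       = ν
updVec g ν (x ∷ xs) (a ∷ as) = upd g (updVec g ν xs as) x a

Sat : ∀ {s k} (g : Graph s) → Formula s k → Val g → Set
Sat g (lab σ x)   ν = nlab g (ν x) ≡ σ
Sat g (edg σ x y) ν = out g (ν x) σ ≡ just (ν y)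
Sat g (eq x y)    ν = ν x ≡ ν y
Sat g (neg φ)     ν = ¬ Sat g φ ν
Sat g (and φ ψ)   ν = Sat g φ ν × Sat g ψ ν
Sat g (or φ ψ)    ν = Sat g φ ν ⊎ Sat g ψ ν
Sat g (ex x φ)    ν = ∃[ a ] Sat g φ (upd g ν x a)
Sat g (all x φ)   ν = ∀ a → Sat g φ (upd g ν x a)
Sat g (tc xs ys φ us vs) ν =
  Star (λ as bs → Sat g φ (updVec g (updVec g ν xs as) ys bs)) (Vec.map ν us) (Vec.map ν vs)

-- g ⊨ φ for closed φ (the valuation is irrelevant; nodes are nonempty)
_⊨_ : ∀ {s k} → Graph s → Formula s k → Set
g ⊨ φ = Sat g φ (λ _ → zero)

Functional : ∀ {s k} → Vec ℕ k → Vec ℕ k → Formula s k → Set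
Functional {s} {k} xs ys φ =
  ∀ (g : Graph s) (ν : Val g) (as bs bs' : Vec (Node g) k)
  → Sat g φ (updVec g (updVec g ν xs as) ys bs)
  → Sat g φ (updVec g (updVec g ν xs as) ys bs')
  → bs ≡ bs'

IsDTC : ∀ {s k} → Formula s k → Set
IsDTC (lab σ x)   = Data.Unit.⊤ where import Data.Unit
IsDTC (edg σ x y) = Data.Unit.⊤ where import Data.Unit
IsDTC (eq x y)    = Data.Unit.⊤ where import Data.Unit
IsDTC (neg φ)     = IsDTC φ
IsDTC (and φ ψ)   = IsDTC φ × IsDTC ψ
IsDTC (or φ ψ)    = IsDTC φ × IsDTC ψ
IsDTC (ex x φ)    = IsDTC φ
IsDTC (all x φ)   = IsDTC φ
IsDTC (tc xs ys φ us vs) = Unique (toList (xs ++ ys)) × Functional xs ys φ × IsDTC φ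

data Test (k nX s : ℕ) : Set where
  labT     : Fin k → Fin s → Test k nX s
  pebT     : Fin k → Fin nX → Test k nX s
  inedgeT  : Fin k → Fin s → Test k nX s
  outedgeT : Fin k → Fin s → Test k nX s

data Instr (k nX s : ℕ) : Set where
  inmove   : Fin k → Fin s → Instr k nX s
  outmove  : Fin k → Fin s → Instr k nX s
  drop     : Fin k → Fin nX → Instr k nX s
  retrieve : Fin nX → Instr k nX s
  test     : Test k nX s → Instr k nX s
  ntest    : Test k nX s → Instr k nX s

data IsNeg {k nX s : ℕ} : Instr k nX s → Instr k nX s → Set where
  isNeg : ∀ t → IsNeg (ntest t) (test t)

record Automaton (k s : ℕ) : Set where
  field
    nQ     : ℕ
    nX     : ℕ
    q₀     : Fin nQ
    accept : Fin nQ → Bool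
    instrs : List (Fin nQ × Instr k nX s × Fin nQ)

module Run {k s : ℕ} (A : Automaton k s) (g : Graph s) where
  open Automaton A

  Stack : Set
  Stack = List (Fin nX × Node g)

  record Config : Set where
    constructor ⟦_,_,_⟧
    field
      state : Fin nQ
      heads : Vec (Node g) k
      stack : Stack
  open Config public

  Holds : Test k nX s → Vec (Node g) k → Stack → Set
  Holds (labT i σ)     u α = nlab g (lookup u i) ≡ σ
  Holds (pebT i x)     u α = (x , lookup u i) ∈ α
  Holds (inedgeT i σ)  u α = ∃[ w ] out g w σ ≡ just (lookup u i)
  Holds (outedgeT i σ) u α = ∃[ v ] out g (lookup u i) σ ≡ just v

  data Exec : Instr k nX s → Vec (Node g) k → Stack → Vec (Node g) k → Stack → Set where
    ex-in   : ∀ {i σ u α w} → out g w σ ≡ just (lookup u i)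
            → Exec (inmove i σ) u α (u [ i ]≔ w) α
    ex-out  : ∀ {i σ u α v} → out g (lookup u i) σ ≡ just v
            → Exec (outmove i σ) u α (u [ i ]≔ v) α
    ex-drop : ∀ {i x u α} → ¬ Any (λ p → proj₁ p ≡ x) α
            → Exec (drop i x) u α u ((x , lookup u i) ∷ α)
    ex-ret  : ∀ {x v u α} → Exec (retrieve x) u ((x , v) ∷ α) u α
    ex-test : ∀ {t u α} → Holds t u α → Exec (test t) u α u α
    ex-ntst : ∀ {t u α} → ¬ Holds t u α → Exec (ntest t) u α u α

  data Step : Config → Config → Set where
    step : ∀ {p χ q u α u' α'} → (p , χ , q) ∈ instrs → Exec χ u α u' α'
         → Step ⟦ p , u , α ⟧ ⟦ q , u' , α' ⟧

  Halting : Config → Set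
  Halting c = ¬ (∃[ c' ] Step c c')

  init : Node g → Config
  init u = ⟦ q₀ , replicate k u , [] ⟧

  Acc : Node g → Set
  Acc u = ∃[ c ] Star Step (init u) c × Halting c
              × accept (state c) ≡ true × stack c ≡ []

  data Walk : Config → List Config → Set where
    done : ∀ {c} → Halting c → Walk c (c ∷ [])
    next : ∀ {c c' cs} → Step c c' → Walk c' cs → Walk c (c ∷ cs)

-- the standing requirement on automata: acc(u₁) ⇒ acc(u₂)
WellBehaved : ∀ {k s} → Automaton k s → Set
WellBehaved {s = s} A = ∀ (g : Graph s) (u₁ u₂ : Node g) → Run.Acc A g u₁ → Run.Acc A g u₂

Deterministic : ∀ {k s} → Automaton k s → Set
Deterministic A =
  ∀ {p χ₁ q₁ p' χ₂ q₂} → (p , χ₁ , q₁) ∈ instrs → (p' , χ₂ , q₂) ∈ instrs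
  → p ≡ p' → (χ₁ , q₁) ≢ (χ₂ , q₂) → IsNeg χ₁ χ₂ ⊎ IsNeg χ₂ χ₁
  where open Automaton A

_∈L_ : ∀ {k s} → Graph s → Automaton k s → Set
g ∈L A = ∀ (u : Node g) → Run.Acc A g u

Searchable : ∀ {s} → (Graph s → Set) → Set
Searchable {s} F =
  ∃[ G ] (Deterministic {1} {s} G × WellBehaved G ×
    (∀ (g : Graph s) → F g → ∀ (u : Node g) →
      ∃[ cs ] Run.Walk G g (Run.init G g u) cs
            × (∀ (v : Node g) → Any (λ c → lookup (Run.Config.heads c) zero ≡ v) cs)))

{-# OPTIONS --safe #-}
-- From automata to formulas.  Treating everything between the dropping of a pebble and its retrieval as a
-- single step makes the pebble stack constant, so that its pebbles can be free variables; the depth of the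
-- nesting is bounded because the pebbles on the stack are distinct.  The states are eliminated as in Kleene's
-- theorem.  The only closures that arise are of "first return to a state", which is functional by determinism.
--
-- From formulas to automata.  Quantifiers are evaluated by running the guide through the graph, with the
-- pebbles of the guide at the bottom of each nesting level, and the value of each variable is marked by a pebble.
-- For φ*(u,v) with φ functional the k heads carry the current tuple, the next one being found by exhaustive
-- search.  The computation must also halt when the orbit of u is cyclic: before moving on, the automaton drops
-- pebbles on the current and on the next tuple and follows the orbit again from u, looking for the next tuple.
-- Since acceptance must not depend on the starting node on any graph, not only those of the family, the
-- automaton first verifies, using only the guide itself, that the guide visits all nodes from everywhere.
module Submission where

open import Defs
open import Data.Nat using (ℕ; zero; suc; _+_; _≤_; _<_; z≤n; s≤s; nonZero) renaming (_≟_ to _≟ℕ_)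
open import Data.Nat.Properties using (≤-refl; ≤-trans; ≤-reflexive; <-≤-trans; m≤m+n; m≤n+m; +-assoc; +-suc;
  +-comm; +-monoʳ-≤; +-monoʳ-<; +-cancelˡ-≡; <-irrefl; n≤1+n; n<1+n; <⇒≤; +-identityʳ; <-trans; m<1+n⇒m<n∨m≡n)
open import Data.Fin using (Fin; zero; suc; toℕ; fromℕ<; splitAt; join) renaming (_≟_ to _≟F_)
open import Data.Fin.Properties using (any?; splitAt-join; injective⇒≤; toℕ<n; toℕ-injective; toℕ-fromℕ<)
open import Data.Bool using (Bool; true; false; not; if_then_else_)
open import Data.Maybe using (Maybe; just; nothing; maybe)
open import Data.Maybe.Properties using (just-injective) renaming (≡-dec to ≡-decM)
open import Data.Vec using (Vec; []; _∷_; lookup; replicate; toList; tabulate; _[_]≔_) renaming (map to mapV;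
  _++_ to _++V_; zip to zipV)
open import Data.Vec.Properties using (lookup-map; lookup∘update; lookup∘update′; tabulate∘lookup;
  lookup-replicate; toList-++) renaming (≡-dec to ≡-decV)
open import Data.List using (List; []; _∷_; length; concatMap; foldl) renaming (_++_ to _++L_;
  allFin to allFinL; lookup to lookupL; map to mapL)
open import Data.List.Properties using (∷-injective; foldl-∷ʳ; length-++) renaming (≡-dec to ≡-decL)
open import Data.List.Membership.Propositional using (_∈_; _∉_; find; lose)
open import Data.List.Membership.Propositional.Properties using (∈-allFin; ∈-lookup; ∈-concatMap⁺;
  ∈-concatMap⁻; ∈-map⁺; ∈-map⁻; ∈-++⁺ˡ; ∈-++⁺ʳ; ∈-++⁻)
open import Data.List.Relation.Unary.Any using (Any; here; there) renaming (any? to anyL?)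
open import Data.List.Relation.Unary.All using (All; []; _∷_) renaming (lookup to lookupA;
  tabulate to tabulateA)
open import Data.List.Relation.Unary.AllPairs using ([]; _∷_; AllPairs)
open import Data.List.Relation.Unary.Unique.Propositional using (Unique)
open import Data.Product.Properties using () renaming (≡-dec to ≡-dec×)
open import Data.Product using (Σ; ∃₂; ∃-syntax; _×_; _,_; proj₁; proj₂)
open import Data.Sum using (_⊎_; inj₁; inj₂; [_,_]′)
open import Data.Empty using (⊥; ⊥-elim)
open import Data.Unit using (⊤; tt)
open import Function using (_∘_; id; case_of_)
open import Function.Bundles using (_⇔_; mk⇔)
open import Relation.Nullary using (¬_; Dec; yes; no; contradiction)
open import Relation.Nullary.Decidable using (decidable-stable; map′; _×-dec_; ¬?)
open import Relation.Binary.PropositionalEquality using (_≡_; _≢_; refl; sym; trans; cong; cong₂; subst;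
  subst₂)
open import Relation.Binary.Construct.Closure.ReflexiveTransitive using (Star; ε; _◅_;
  _◅◅_) renaming (map to mapStar)
open import Data.Nat.DivMod using (_mod_; _%_; m<n⇒m%n≡m; m%n<n)
open import Data.Bool.Properties using () renaming (_≟_ to _≟B_)
import Data.List.Relation.Unary.AllPairs.Properties as AllPairsₚ
import Data.List.Relation.Unary.Unique.Propositional.Properties as Uniqueₚ

-- Two kinds of correctness statement run side by side. On an arbitrary graph the guide may fail to
-- halt, so the preliminary check is analysed by inverting completed runs (lemmas ending in `-inv`).
-- Once it has succeeded, every walk of the guide halts, all loops are total, and evaluation is
-- specified by constructing runs (`-run`, `-spec`); determinism of charts then gives inversion for
-- free. The check signals failure by blocking or diverging, never by an answer; this suffices
-- because only acceptance must be independent of the starting node. The guide cannot be copied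
-- verbatim: it stops by having no applicable instruction, and no test tells whether a pebble lies
-- elsewhere in the graph, so the simulation must know beforehand whether a `drop` or a `retrieve`
-- would block. Pebbles are numbered by nesting level, which turns freshness into arithmetic; how
-- many are needed is computed from the formula and the guide before the automaton is built. For the
-- converse, `Functional` ranges over all graphs and valuations, so every closure must be functional
-- for arbitrary positions of the pebbles, not only for those that occur in runs.

-- Finite types and the pigeonhole principle.

-- A retract of some Fin n: enough to number the control states of an automaton.
record Finite (A : Set) : Set where
  field
    size    : ℕ
    enc     : A → Fin size
    dec     : Fin size → A
    dec-enc : ∀ a → dec (enc a) ≡ a

open Finite

retract : ∀ {A B : Set} (f : A → B) (h : B → A) → (∀ a → h (f a) ≡ a) → Finite B → Finite A
retract f h hf fb = record
  { size = size fb ; enc = enc fb ∘ f ; dec = h ∘ dec fb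
  ; dec-enc = λ a → trans (cong h (dec-enc fb (f a))) (hf a) }

finFin : ∀ {n} → Finite (Fin n)
finFin = record { enc = id ; dec = id ; dec-enc = λ _ → refl }

fin⊤ : Finite ⊤
fin⊤ = retract {B = Fin 1} (λ _ → zero) (λ _ → tt) (λ _ → refl) finFin

fin⊎ : ∀ {A B} → Finite A → Finite B → Finite (A ⊎ B)
fin⊎ {A} {B} fa fb = record
  { size = size fa + size fb
  ; enc = [ (λ a → join (size fa) (size fb) (inj₁ (enc fa a))) , (λ b → join (size fa) (size fb) (inj₂ (enc fb b))) ]′
  ; dec = decode ∘ splitAt (size fa)
  ; dec-enc = λ where
      (inj₁ a) → trans (cong decode (splitAt-join (size fa) (size fb) (inj₁ (enc fa a)))) (cong inj₁ (dec-enc fa a))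
      (inj₂ b) → trans (cong decode (splitAt-join (size fa) (size fb) (inj₂ (enc fb b)))) (cong inj₂ (dec-enc fb b)) }
  where
    decode : Fin (size fa) ⊎ Fin (size fb) → A ⊎ B
    decode (inj₁ i) = inj₁ (dec fa i)
    decode (inj₂ j) = inj₂ (dec fb j)

finΣFin : ∀ n {B : Fin n → Set} → (∀ i → Finite (B i)) → Finite (Σ (Fin n) B)
finΣFin zero    fb = record { size = 0 ; enc = λ { (() , _) } ; dec = λ () ; dec-enc = λ { (() , _) } }
finΣFin (suc n) {B} fb =
  retract (λ { (zero , b) → inj₁ b ; (suc i , b) → inj₂ (i , b) })
          (λ { (inj₁ b) → zero , b ; (inj₂ (i , b)) → suc i , b })
          (λ { (zero , b) → refl ; (suc i , b) → refl })
          (fin⊎ (fb zero) (finΣFin n (fb ∘ suc)))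

finΣ : ∀ {A : Set} {B : A → Set} → Finite A → (∀ a → Finite (B a)) → Finite (Σ A B)
finΣ {A} {B} fa fb =
  retract (λ { (a , b) → enc fa a , subst B (sym (dec-enc fa a)) b })
          (λ { (i , b) → dec fa i , b })
          (λ { (a , b) → cancel (dec-enc fa a) b })
          (finΣFin (size fa) (fb ∘ dec fa))
  where
    cancel : ∀ {a a' : A} (e : a' ≡ a) (b : B a) → (a' , subst B (sym e) b) ≡ (a , b)
    cancel refl b = refl

fin× : ∀ {A B} → Finite A → Finite B → Finite (A × B)
fin× fa fb = finΣ fa (λ _ → fb)

finMaybe : ∀ {A} → Finite A → Finite (Maybe A)
finMaybe fa =
  retract (λ { nothing → inj₁ tt ; (just a) → inj₂ a })
          (λ { (inj₁ _) → nothing ; (inj₂ a) → just a })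
          (λ { nothing → refl ; (just _) → refl })
          (fin⊎ fin⊤ fa)

finBool : Finite Bool
finBool =
  retract (λ { true → inj₁ tt ; false → inj₂ tt })
          (λ { (inj₁ _) → true ; (inj₂ _) → false })
          (λ { true → refl ; false → refl })
          (fin⊎ fin⊤ fin⊤)

finVec : ∀ {A} → Finite A → ∀ n → Finite (Vec A n)
finVec fa zero    = retract (λ _ → tt) (λ _ → []) (λ { [] → refl }) fin⊤
finVec fa (suc n) =
  retract (λ { (x ∷ xs) → x , xs }) (λ { (x , xs) → x ∷ xs }) (λ { (x ∷ xs) → refl })
          (fin× fa (finVec fa n))

lookup-injective-Unique : ∀ {A : Set} {xs : List A} → Unique xs → ∀ i j → lookupL xs i ≡ lookupL xs j → i ≡ j
lookup-injective-Unique (x∉ ∷ u) zero    zero    e = refl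
lookup-injective-Unique (x∉ ∷ u) zero    (suc j) e = contradiction e (lookupA x∉ (∈-lookup j))
lookup-injective-Unique (x∉ ∷ u) (suc i) zero    e = contradiction (sym e) (lookupA x∉ (∈-lookup i))
lookup-injective-Unique (x∉ ∷ u) (suc i) (suc j) e = cong suc (lookup-injective-Unique u i j e)

-- Pigeonhole through `enc`, injective because it has a left inverse. It bounds the pebbles carried
-- by the guide, the orbits followed by a closure, and the nesting depth of pebbles.
Unique⇒length≤size : ∀ {A : Set} (fa : Finite A) {xs : List A} → Unique xs → length xs ≤ size fa
Unique⇒length≤size fa {xs} u = injective⇒≤ {f = enc fa ∘ lookupL xs} λ {i} {j} e →
  lookup-injective-Unique u i j
    (trans (sym (dec-enc fa _)) (trans (cong (dec fa) e) (dec-enc fa _)))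

vec-ext : ∀ {A : Set} {n} {xs ys : Vec A n} → (∀ i → lookup xs i ≡ lookup ys i) → xs ≡ ys
vec-ext {xs = []}     {[]}     e = refl
vec-ext {xs = x ∷ xs} {y ∷ ys} e = cong₂ _∷_ (e zero) (vec-ext (e ∘ suc))

-- Determinism of runs.

module Determinism {k s : ℕ} (A : Automaton k s) (g : Graph s) where
  open Automaton A
  open Run A g

  exec-det : ∀ {χ u α u₁ α₁ u₂ α₂} → Exec χ u α u₁ α₁ → Exec χ u α u₂ α₂ → (u₁ , α₁) ≡ (u₂ , α₂)
  exec-det (ex-in e)   (ex-in e')  with refl ← inj g _ _ _ _ e e' = refl
  exec-det (ex-out e)  (ex-out e') with refl ← trans (sym e) e' = refl
  exec-det (ex-drop _) (ex-drop _) = refl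
  exec-det ex-ret      ex-ret      = refl
  exec-det (ex-test _) (ex-test _) = refl
  exec-det (ex-ntst _) (ex-ntst _) = refl

  neg-exclusive : ∀ {χ₁ χ₂ u α u₁ α₁ u₂ α₂} → IsNeg χ₁ χ₂ → Exec χ₁ u α u₁ α₁ → ¬ Exec χ₂ u α u₂ α₂
  neg-exclusive (isNeg t) (ex-ntst ¬h) (ex-test h) = ¬h h

  _≟C_ : (c d : Config) → Dec (c ≡ d)
  ⟦ p , u , α ⟧ ≟C ⟦ q , v , β ⟧ =
    map′ (λ { (refl , refl , refl) → refl }) (λ { refl → refl , refl , refl })
         ((p ≟F q) ×-dec (≡-decV _≟F_ u v) ×-dec (≡-decL (≡-dec× _≟F_ _≟F_) α β))

  -- `Deterministic` speaks only of instructions known to differ, so the proof is by contradiction,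
  -- equality of configurations being decidable: different successors come from different
  -- instructions, and a test and its negation never both apply.
  step-det : Deterministic A → ∀ {c c₁ c₂} → Step c c₁ → Step c c₂ → c₁ ≡ c₂
  step-det det {_} {c₁} {c₂} (step m₁ x₁) (step m₂ x₂) = decidable-stable (c₁ ≟C c₂) λ ne →
    [ (λ neg → neg-exclusive neg x₁ x₂) , (λ neg → neg-exclusive neg x₂ x₁) ]′
      (det m₁ m₂ refl λ { refl → case exec-det x₁ x₂ of λ { refl → ne refl } })

  walk-det : Deterministic A → ∀ {c cs₁ cs₂} → Walk c cs₁ → Walk c cs₂ → cs₁ ≡ cs₂
  walk-det det (done _)   (done _)   = refl
  walk-det det (done h)   (next t _) = contradiction (_ , t) h
  walk-det det (next t _) (done h)   = contradiction (_ , t) h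
  walk-det det (next t w) (next t' w') with refl ← step-det det t t' = cong (_ ∷_) (walk-det det w w')

  reachable∈walk : Deterministic A → ∀ {c d cs} → Walk c cs → Star Step c d → d ∈ cs
  reachable∈walk det (done _)   ε        = here refl
  reachable∈walk det (done h)   (t ◅ _)  = contradiction (_ , t) h
  reachable∈walk det (next _ _) ε        = here refl
  reachable∈walk det (next t w) (t' ◅ r) with refl ← step-det det t t' = there (reachable∈walk det w r)

-- Valuations and the coincidence lemma.

lookup∈toList : ∀ {A : Set} {n} (xs : Vec A n) i → lookup xs i ∈ toList xs
lookup∈toList (x ∷ xs) zero    = here refl
lookup∈toList (x ∷ xs) (suc i) = there (lookup∈toList xs i)

map-ext : ∀ {A B : Set} {n} {f h : A → B} (xs : Vec A n) → (∀ {x} → x ∈ toList xs → f x ≡ h x) → mapV f xs ≡ mapV h xs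
map-ext []       e = refl
map-ext (x ∷ xs) e = cong₂ _∷_ (e (here refl)) (map-ext xs (e ∘ there))

Unique-++ˡ : ∀ {A : Set} {m n} (xs : Vec A m) {ys : Vec A n} → Unique (toList (xs ++V ys)) → Unique (toList xs)
Unique-++ˡ []       _        = []
Unique-++ˡ (x ∷ xs) (x∉ ∷ u) = tabulateA (λ m → lookupA x∉ (inject xs m)) ∷ Unique-++ˡ xs u
  where
  inject : ∀ {m z} (zs : Vec _ m) {ys : Vec _ _} → z ∈ toList zs → z ∈ toList (zs ++V ys)
  inject (z ∷ zs) (here e)  = here e
  inject (z ∷ zs) (there m) = there (inject zs m)

module Valuations {s : ℕ} (g : Graph s) where

  upd-same : ∀ {ν : Val g} x {a} → upd g ν x a x ≡ a
  upd-same x with x ≟ℕ x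
  ... | yes _ = refl
  ... | no ne = contradiction refl ne

  upd-other : ∀ {ν : Val g} {x y a} → x ≢ y → upd g ν x a y ≡ ν y
  upd-other {x = x} {y} ne with x ≟ℕ y
  ... | yes e = contradiction e ne
  ... | no _  = refl

  upd-agree : ∀ {ν ν' : Val g} {x a y} → (y ≢ x → ν y ≡ ν' y) → upd g ν x a y ≡ upd g ν' x a y
  upd-agree {x = x} {y = y} e with x ≟ℕ y
  ... | yes _ = refl
  ... | no ne = e (ne ∘ sym)

  updVec-other : ∀ {n} {ν : Val g} (xs : Vec ℕ n) {as y} → y ∉ toList xs → updVec g ν xs as y ≡ ν y
  updVec-other []       {[]}     _  = refl
  updVec-other (x ∷ xs) {a ∷ as} y∉ = trans (upd-other (y∉ ∘ here ∘ sym)) (updVec-other xs (y∉ ∘ there))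

  updVec-agree : ∀ {n} {ν ν' : Val g} (xs : Vec ℕ n) {as y} → (y ∉ toList xs → ν y ≡ ν' y)
               → updVec g ν xs as y ≡ updVec g ν' xs as y
  updVec-agree []       {[]}     e = e λ ()
  updVec-agree (x ∷ xs) {a ∷ as} e = upd-agree λ ne → updVec-agree xs λ y∉ → e λ { (here e') → ne e' ; (there m) → y∉ m }

  updVec-self : ∀ {n} {ν : Val g} (xs : Vec ℕ n) {as} → Unique (toList xs) → mapV (updVec g ν xs as) xs ≡ as
  updVec-self []       {[]}     _        = refl
  updVec-self (x ∷ xs) {a ∷ as} (x∉ ∷ u) =
    cong₂ _∷_ (upd-same x) (trans (map-ext xs (λ m → upd-other (lookupA x∉ m))) (updVec-self xs u))

  coincidence : ∀ {k} (φ : Formula s k) {ν ν' : Val g} → (∀ x → Free x φ → ν x ≡ ν' x) → Sat g φ ν → Sat g φ ν'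
  coincidence (lab σ x)   e h = trans (cong (nlab g) (sym (e x f-lab))) h
  coincidence (edg σ x y) e h = trans (cong (λ z → out g z σ) (sym (e x f-edg₁))) (trans h (cong just (e y f-edg₂)))
  coincidence (eq x y)    e h = trans (sym (e x f-eq₁)) (trans h (e y f-eq₂))
  coincidence (neg φ)     e h = h ∘ coincidence φ (λ x f → sym (e x (f-neg f)))
  coincidence (and φ ψ)   e (h , h') = coincidence φ (λ x → e x ∘ f-and₁) h , coincidence ψ (λ x → e x ∘ f-and₂) h'
  coincidence (or φ ψ)    e (inj₁ h) = inj₁ (coincidence φ (λ x → e x ∘ f-or₁) h)
  coincidence (or φ ψ)    e (inj₂ h) = inj₂ (coincidence ψ (λ x → e x ∘ f-or₂) h)
  coincidence (ex x φ)    e (a , h)  = a , coincidence φ (λ y f → upd-agree λ ne → e y (f-ex ne f)) h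
  coincidence (all x φ)   e h a      = coincidence φ (λ y f → upd-agree λ ne → e y (f-all ne f)) (h a)
  coincidence (tc xs ys φ us vs) e h =
    subst₂ (Star _) (map-ext us (λ m → e _ (f-tcu m))) (map-ext vs (λ m → e _ (f-tcv m)))
      (mapStar (coincidence φ λ y f → updVec-agree ys λ y∉ys → updVec-agree xs λ y∉xs → e y (f-tcφ y∉xs y∉ys f)) h)

-- Orbits of a functional relation.

module Orbit {A : Set} (R : A → A → Set) where
  data Path : A → A → List A → Set where
    end  : ∀ {c} → Path c c (c ∷ [])
    cons : ∀ {a b c l} → R a b → Path b c l → Path a c (a ∷ l)

  path-snoc : ∀ {a c c' l} → Path a c l → R c c' → Path a c' (l ++L c' ∷ [])
  path-snoc end        r' = cons r' end
  path-snoc (cons r p) r' = cons r (path-snoc p r')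

  path-start : ∀ {a c l} → Path a c l → a ∈ l
  path-start end        = here refl
  path-start (cons _ _) = here refl

  path-end : ∀ {a c l} → Path a c l → c ∈ l
  path-end end        = here refl
  path-end (cons _ p) = there (path-end p)

  path-star : ∀ {a c l} → Path a c l → Star R a c
  path-star end        = ε
  path-star (cons r p) = r ◅ path-star p

  module _ (functional : ∀ {a b b'} → R a b → R a b' → b ≡ b') where
    -- The induction passes to tails of the path while successors are sought in the whole list,
    -- hence the ambient `L`.
    path-closed : ∀ {a c l L} → Path a c l → (∀ {x} → x ∈ l → x ∈ L) → (∀ {y} → R c y → y ∈ L)
                → ∀ {x y} → x ∈ l → R x y → y ∈ L
    path-closed end        _ last (here refl) r = last r
    path-closed (cons r p) sub _ (here refl) r' with refl ← functional r r' = sub (there (path-start p))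
    path-closed (cons r p) sub last (there m) r' = path-closed p (sub ∘ there) last m r'

    -- This is how unreachability is established: as soon as the last tuple has no successor outside
    -- the list, the list is the entire orbit, and a goal missing from it is never reached.
    orbit⊆path : ∀ {a c l t} → Path a c l → (∀ {y} → R c y → y ∈ l) → Star R a t → t ∈ l
    orbit⊆path {l = l} p last = go (path-start p)
      where
      go : ∀ {x t} → x ∈ l → Star R x t → t ∈ l
      go m ε        = m
      go m (r ◅ st) = go (path-closed p id last m r) st

Unique-snoc : ∀ {A : Set} {l : List A} {c} → Unique l → c ∉ l → Unique (l ++L c ∷ [])
Unique-snoc {l = []}    []       c∉ = [] ∷ []
Unique-snoc {l = x ∷ l} (x∉ ∷ u) c∉ =
  tabulateA (λ m e → case ∈-++⁻ l m of λ
    { (inj₁ m') → lookupA x∉ m' e ; (inj₂ (here refl)) → c∉ (here (sym e)) })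
  ∷ Unique-snoc u (c∉ ∘ there)

open Finite

-- Charts: structured programs over automaton instructions.

-- Stacks and instructions do not depend on the transitions of an automaton, so charts are executed
-- with the instruction semantics of an automaton without transitions.
inert : ∀ (k s nX : ℕ) → Automaton k s
inert k s nX = record { nQ = 1 ; nX = nX ; q₀ = zero ; accept = λ _ → false ; instrs = [] }

module Charts {k s nX' : ℕ} (i₀ : Fin k) where

  nP : ℕ
  nP = suc nX'

  data Action (S R : Set) : Set where
    exit : R → Action S R
    doI  : Instr k nP s → S → Action S R
    br   : Test k nP s → S → S → Action S R

  -- A flow diagram with typed exits. Each state carries exactly one action, so determinism of the
  -- compiled automaton is built in.
  record Chart (R : Set) : Set₁ where
    no-eta-equality
    field
      State  : Set
      finite : Finite State
      entry  : State
      δ      : State → Action State R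
  open Chart

  -- Branching on any test with equal targets is an idle step.
  goto : ∀ {S R : Set} → S → Action S R
  goto p = br (pebT i₀ zero) p p

  ret : ∀ {R : Set} → R → Chart R
  ret r = record { State = ⊤ ; finite = fin⊤ ; entry = tt ; δ = λ _ → exit r }

  prim : Instr k nP s → Chart ⊤
  prim χ = record { State = Bool ; finite = finBool ; entry = false
                  ; δ = λ { false → doI χ true ; true → exit tt } }

  tst : Test k nP s → Chart Bool
  tst t = record { State = Maybe Bool ; finite = finMaybe finBool ; entry = nothing
                 ; δ = λ { nothing → br t (just true) (just false) ; (just b) → exit b } }

  -- One construction serves for loops and for sequencing: when piece `q` exits with `x`, `κ q x`
  -- names the piece to enter next or the final result.
  module Glue {Q R : Set} {X : Q → Set} (fin : Finite Q) (C : ∀ q → Chart (X q)) (κ : ∀ q → X q → Q ⊎ R) where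
    GState : Set
    GState = Σ Q (λ q → State (C q))

    leave : Q ⊎ R → Action GState R
    leave (inj₁ q) = goto (q , entry (C q))
    leave (inj₂ r) = exit r

    lift : ∀ q → Action (State (C q)) (X q) → Action GState R
    lift q (exit x)   = leave (κ q x)
    lift q (doI χ p)  = doI χ (q , p)
    lift q (br t p p') = br t (q , p) (q , p')

    glue : Q → Chart R
    glue q₀ = record
      { State = GState ; finite = finΣ fin (λ q → finite (C q)) ; entry = q₀ , entry (C q₀)
      ; δ = λ { (q , p) → lift q (δ (C q) p) } }

  opaque
    iter : ∀ {Q R : Set} → Finite Q → (Q → Chart (Q ⊎ R)) → Q → Chart R
    iter fin C = Glue.glue fin C (λ _ → id)

  module Bind {R R' : Set} (fin : Finite R) (C : Chart R) (D : R → Chart R') where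
    Phase : Maybe R → Set
    Phase nothing  = R
    Phase (just _) = R'

    part : ∀ q → Chart (Phase q)
    part nothing  = C
    part (just r) = D r

    hand : ∀ q → Phase q → Maybe R ⊎ R'
    hand nothing  r = inj₁ (just r)
    hand (just _) r = inj₂ r

  opaque
    bind : ∀ {R R' : Set} → Finite R → Chart R → (R → Chart R') → Chart R'
    bind fin C D = Glue.glue (finMaybe fin) (Bind.part fin C D) (Bind.hand fin C D) nothing

  infixr 4 _>>_
  _>>_ : ∀ {R : Set} → Chart ⊤ → Chart R → Chart R
  C >> D = bind fin⊤ C (λ _ → D)

  cond : ∀ {R : Set} → Chart Bool → Chart R → Chart R → Chart R
  cond C D E = bind finBool C (λ b → if b then D else E)

  module Sem (g : Graph s) where
    open Run (inert k s nP) g using (Stack; Holds; Exec; ex-in; ex-out; ex-drop; ex-ret; ex-test; ex-ntst) public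
    open Determinism (inert k s nP) g using (exec-det) public

    Heads : Set
    Heads = Vec (Node g) k

    St : Set
    St = Heads × Stack

    -- Blocked and infinite computations have no derivation. A lemma that concludes `Runs` is
    -- therefore total correctness, and one that assumes `Runs` is partial correctness.
    data Big {R : Set} (C : Chart R) : State C → St → R → St → Set where
      b-exit : ∀ {p r s} → δ C p ≡ exit r → Big C p s r s
      b-doI  : ∀ {p χ p' u α u' α' r s} → δ C p ≡ doI χ p' → Exec χ u α u' α' → Big C p' (u' , α') r s
             → Big C p (u , α) r s
      b-yes  : ∀ {p t p₁ p₂ u α r s} → δ C p ≡ br t p₁ p₂ → Holds t u α → Big C p₁ (u , α) r s
             → Big C p (u , α) r s
      b-no   : ∀ {p t p₁ p₂ u α r s} → δ C p ≡ br t p₁ p₂ → ¬ Holds t u α → Big C p₂ (u , α) r s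
             → Big C p (u , α) r s

    Runs : ∀ {R} → Chart R → St → R → St → Set
    Runs C = Big C (entry C)

    _≟P_ : (p q : Fin nP × Node g) → Dec (p ≡ q)
    (x , v) ≟P (y , w) = map′ (λ { (refl , refl) → refl }) (λ { refl → refl , refl }) ((x ≟F y) ×-dec (v ≟F w))

    holds? : ∀ t u α → Dec (Holds t u α)
    holds? (labT i σ)     u α = nlab g (lookup u i) ≟F σ
    holds? (pebT i x)     u α = anyL? ((x , lookup u i) ≟P_) α
    holds? (inedgeT i σ)  u α = any? (λ w → ≡-decM _≟F_ (out g w σ) (just (lookup u i)))
    holds? (outedgeT i σ) u α with out g (lookup u i) σ
    ... | just v  = yes (v , refl)
    ... | nothing = no λ ()

    -- A constructed run is thus the only run, so a total specification can also be used to invert a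
    -- given one.
    big-det : ∀ {R} {C : Chart R} {p s r₁ s₁ r₂ s₂} → Big C p s r₁ s₁ → Big C p s r₂ s₂ → (r₁ , s₁) ≡ (r₂ , s₂)
    big-det (b-exit e) (b-exit e') with refl ← trans (sym e) e' = refl
    big-det (b-exit e) (b-doI e' _ _) with () ← trans (sym e) e'
    big-det (b-exit e) (b-yes e' _ _) with () ← trans (sym e) e'
    big-det (b-exit e) (b-no e' _ _)  with () ← trans (sym e) e'
    big-det (b-doI e x d) (b-doI e' x' d') with refl ← trans (sym e) e' with refl ← exec-det x x' = big-det d d'
    big-det (b-doI e _ _) (b-exit e')    with () ← trans (sym e) e'
    big-det (b-doI e _ _) (b-yes e' _ _) with () ← trans (sym e) e'
    big-det (b-doI e _ _) (b-no e' _ _)  with () ← trans (sym e) e'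
    big-det (b-yes e h d) (b-yes e' h' d') with refl ← trans (sym e) e' = big-det d d'
    big-det (b-yes e h d) (b-no e' h' d')  with refl ← trans (sym e) e' = contradiction h h'
    big-det (b-yes e _ _) (b-exit e')    with () ← trans (sym e) e'
    big-det (b-yes e _ _) (b-doI e' _ _) with () ← trans (sym e) e'
    big-det (b-no e h d)  (b-no e' h' d')  with refl ← trans (sym e) e' = big-det d d'
    big-det (b-no e h d)  (b-yes e' h' d') with refl ← trans (sym e) e' = contradiction h' h
    big-det (b-no e _ _)  (b-exit e')    with () ← trans (sym e) e'
    big-det (b-no e _ _)  (b-doI e' _ _) with () ← trans (sym e) e'

    ret-run : ∀ {R : Set} {r : R} {s} → Runs (ret r) s r s
    ret-run = b-exit refl

    ret-inv : ∀ {R : Set} {r r' : R} {s s'} → Runs (ret r) s r' s' → r ≡ r' × s ≡ s'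
    ret-inv (b-exit refl) = refl , refl

    prim-run : ∀ {χ u α u' α'} → Exec χ u α u' α' → Runs (prim χ) (u , α) tt (u' , α')
    prim-run x = b-doI refl x (b-exit refl)

    prim-inv : ∀ {χ u α r u' α'} → Runs (prim χ) (u , α) r (u' , α') → Exec χ u α u' α'
    prim-inv (b-doI refl x (b-exit refl)) = x

    tst-yes : ∀ {t u α} → Holds t u α → Runs (tst t) (u , α) true (u , α)
    tst-yes h = b-yes refl h (b-exit refl)

    tst-no : ∀ {t u α} → ¬ Holds t u α → Runs (tst t) (u , α) false (u , α)
    tst-no h = b-no refl h (b-exit refl)

    tst-inv : ∀ {t u α b s'} → Runs (tst t) (u , α) b s'
            → s' ≡ (u , α) × ((b ≡ true × Holds t u α) ⊎ (b ≡ false × ¬ Holds t u α))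
    tst-inv (b-yes refl h (b-exit refl)) = refl , inj₁ (refl , h)
    tst-inv (b-no refl h (b-exit refl))  = refl , inj₂ (refl , h)

    goto-run : ∀ {R : Set} {C : Chart R} {p p' s r s'} → δ C p ≡ goto p' → Big C p' s r s' → Big C p s r s'
    goto-run {s = u , α} e d with holds? (pebT i₀ zero) u α
    ... | yes h = b-yes e h d
    ... | no ¬h = b-no e ¬h d

    module GlueSem {Q R : Set} {X : Q → Set} (fin : Finite Q) (C : ∀ q → Chart (X q)) (κ : ∀ q → X q → Q ⊎ R) where
      open Glue fin C κ

      data Trace : Q → St → R → St → Set where
        stop : ∀ {q s x r s'} → Runs (C q) s x s' → κ q x ≡ inj₂ r → Trace q s r s'
        more : ∀ {q s x s₁ q' r s'} → Runs (C q) s x s₁ → κ q x ≡ inj₁ q' → Trace q' s₁ r s' → Trace q s r s'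

      module _ (q₀ : Q) where
        private G = glue q₀

        embed : ∀ {q p s x s₁ r s'} → Big (C q) p s x s₁
              → (∀ p' → δ (C q) p' ≡ exit x → Big G (q , p') s₁ r s') → Big G (q , p) s r s'
        embed {q} (b-exit {p} e) next = next p e
        embed {q} (b-doI e x d) next = b-doI (cong (lift q) e) x (embed d next)
        embed {q} (b-yes e h d) next = b-yes (cong (lift q) e) h (embed d next)
        embed {q} (b-no e h d)  next = b-no (cong (lift q) e) h (embed d next)

        trace-big : ∀ {q s r s'} → Trace q s r s' → Big G (q , entry (C q)) s r s'
        trace-big {q} (stop d e) = embed d λ p' e' → b-exit (trans (cong (lift q) e') (cong leave e))
        trace-big {q} (more d e t) = embed d λ p' e' →
          goto-run (trans (cong (lift q) e') (cong leave e)) (trace-big t)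

        Rest : Q ⊎ R → St → R → St → Set
        Rest (inj₁ q) s r s' = Trace q s r s'
        Rest (inj₂ r') s r s' = r' ≡ r × s ≡ s'

        close : ∀ {q s x s₁ r s'} → Runs (C q) s x s₁ → Rest (κ q x) s₁ r s' → Trace q s r s'
        close {q} {x = x} d rest with κ q x in e
        close d t             | inj₁ q' = more d e t
        close d (refl , refl) | inj₂ r  = stop d e

        -- The start `p` is any inner state rather than the entry of a piece, so that the induction
        -- can follow the derivation; `Rest` is what remains once the current piece exits.
        big-trace : ∀ {q p s r s'} → Big G (q , p) s r s'
                  → ∃₂ λ x s₁ → Big (C q) p s x s₁ × Rest (κ q x) s₁ r s'
        big-trace {q} {p} d = split (δ (C q) p) refl d
          where
          split : ∀ {q p s r s'} (n : Action (State (C q)) (X q)) → δ (C q) p ≡ n → Big G (q , p) s r s'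
                → ∃₂ λ x s₁ → Big (C q) p s x s₁ × Rest (κ q x) s₁ r s'
          split {q} (exit x) e d with κ q x in e'
          split {q} (exit x) e (b-exit e'') | inj₂ r
            with refl ← trans (sym e'') (trans (cong (lift q) e) (cong leave e')) = x , _ , b-exit e , subst (λ z → Rest z _ _ _) (sym e') (refl , refl)
          split {q} (exit x) e (b-doI e'' _ _) | inj₂ r with () ← trans (sym e'') (trans (cong (lift q) e) (cong leave e'))
          split {q} (exit x) e (b-yes e'' _ _) | inj₂ r with () ← trans (sym e'') (trans (cong (lift q) e) (cong leave e'))
          split {q} (exit x) e (b-no e'' _ _)  | inj₂ r with () ← trans (sym e'') (trans (cong (lift q) e) (cong leave e'))
          split {q} (exit x) e (b-exit e'')    | inj₁ q' with () ← trans (sym e'') (trans (cong (lift q) e) (cong leave e'))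
          split {q} (exit x) e (b-doI e'' _ _) | inj₁ q' with () ← trans (sym e'') (trans (cong (lift q) e) (cong leave e'))
          split {q} (exit x) e (b-yes e'' h d) | inj₁ q'
            with refl ← trans (sym e'') (trans (cong (lift q) e) (cong leave e'))
            with x' , s₁ , d' , rest ← big-trace d = x , _ , b-exit e , subst (λ z → Rest z _ _ _) (sym e') (close d' rest)
          split {q} (exit x) e (b-no e'' h d) | inj₁ q'
            with refl ← trans (sym e'') (trans (cong (lift q) e) (cong leave e'))
            with x' , s₁ , d' , rest ← big-trace d = x , _ , b-exit e , subst (λ z → Rest z _ _ _) (sym e') (close d' rest)
          split {q} (doI χ p') e (b-doI e' y d) with refl ← trans (sym e') (cong (lift q) e)
            with x , s₁ , d' , rest ← big-trace d = x , s₁ , b-doI e y d' , rest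
          split {q} (doI χ p') e (b-exit e')    with () ← trans (sym e') (cong (lift q) e)
          split {q} (doI χ p') e (b-yes e' _ _) with () ← trans (sym e') (cong (lift q) e)
          split {q} (doI χ p') e (b-no e' _ _)  with () ← trans (sym e') (cong (lift q) e)
          split {q} (br t p₁ p₂) e (b-yes e' h d) with refl ← trans (sym e') (cong (lift q) e)
            with x , s₁ , d' , rest ← big-trace d = x , s₁ , b-yes e h d' , rest
          split {q} (br t p₁ p₂) e (b-no e' h d) with refl ← trans (sym e') (cong (lift q) e)
            with x , s₁ , d' , rest ← big-trace d = x , s₁ , b-no e h d' , rest
          split {q} (br t p₁ p₂) e (b-exit e')    with () ← trans (sym e') (cong (lift q) e)
          split {q} (br t p₁ p₂) e (b-doI e' _ _) with () ← trans (sym e') (cong (lift q) e)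

        glue-inv : ∀ {s r s'} → Runs G s r s' → Trace q₀ s r s'
        glue-inv d with x , s₁ , d' , rest ← big-trace d = close d' rest

    open GlueSem using (Trace; stop; more) public

    opaque
      unfolding iter
      iter-run : ∀ {Q R : Set} {fin : Finite Q} {C : Q → Chart (Q ⊎ R)} {q s r s'}
               → Trace fin C (λ _ → id) q s r s' → Runs (iter fin C q) s r s'
      iter-run {fin = fin} {C} = GlueSem.trace-big fin C (λ _ → id) _

      iter-inv : ∀ {Q R : Set} {fin : Finite Q} {C : Q → Chart (Q ⊎ R)} {q s r s'}
               → Runs (iter fin C q) s r s' → Trace fin C (λ _ → id) q s r s'
      iter-inv {fin = fin} {C} = GlueSem.glue-inv fin C (λ _ → id) _

    opaque
      unfolding bind
      bind-run : ∀ {R R' : Set} {fin : Finite R} {C : Chart R} {D : R → Chart R'} {s r s₁ r' s'}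
               → Runs C s r s₁ → Runs (D r) s₁ r' s' → Runs (bind fin C D) s r' s'
      bind-run {fin = fin} {C} {D} c d = GlueSem.trace-big _ (Bind.part fin C D) (Bind.hand fin C D) _ (more c refl (stop d refl))

      bind-inv : ∀ {R R' : Set} {fin : Finite R} {C : Chart R} {D : R → Chart R'} {s r' s'}
               → Runs (bind fin C D) s r' s' → ∃₂ λ r s₁ → Runs C s r s₁ × Runs (D r) s₁ r' s'
      bind-inv {fin = fin} {C} {D} d with GlueSem.glue-inv _ (Bind.part fin C D) (Bind.hand fin C D) _ d
      ... | stop c ()
      ... | more c refl (stop d' refl) = _ , _ , c , d'
      ... | more c refl (more d' () _)

open Finite

-- Compiling charts into automata.

module ToAutomaton {k s nX' : ℕ} (i₀ : Fin k) where
  open Charts {k} {s} {nX'} i₀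

  module _ (C : Chart Bool) where
    open Chart C

    num : State → Fin (size finite)
    num = enc finite

    Row : Set
    Row = List (Fin (size finite) × Instr k nP s × Fin (size finite))

    row : Fin (size finite) → Action State Bool → Row
    row i (exit _)     = []
    row i (doI χ p)    = (i , χ , num p) ∷ []
    row i (br t p₁ p₂) = (i , test t , num p₁) ∷ (i , ntest t , num p₂) ∷ []

    accepting : Action State Bool → Bool
    accepting (exit b)   = b
    accepting (doI _ _)  = false
    accepting (br _ _ _) = false

    -- A code outside the image of `enc` repeats the row of the state it decodes to, with its own
    -- number as source; such codes are never targets.
    rowOf : Fin (size finite) → Row
    rowOf i = row i (δ (dec finite i))

    automaton : Automaton k s
    automaton = record
      { nQ = size finite ; nX = nP ; q₀ = num entry
      ; accept = λ i → accepting (δ (dec finite i))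
      ; instrs = concatMap rowOf (allFinL (size finite)) }

    row-source : ∀ {i n p χ q} → (p , χ , q) ∈ row i n → p ≡ i
    row-source {n = doI _ _}  (here refl) = refl
    row-source {n = br _ _ _} (here refl) = refl
    row-source {n = br _ _ _} (there (here refl)) = refl

    ∈instrs⇒∈row : ∀ {p χ q} → (p , χ , q) ∈ Automaton.instrs automaton → (p , χ , q) ∈ rowOf p
    ∈instrs⇒∈row m with i , _ , m' ← find (∈-concatMap⁻ rowOf {xs = allFinL (size finite)} m) with refl ← row-source {n = δ (dec finite i)} m' = m'

    ∈row⇒∈instrs : ∀ {i e} → e ∈ rowOf i → e ∈ Automaton.instrs automaton
    ∈row⇒∈instrs {i} m = ∈-concatMap⁺ rowOf (lose (∈-allFin i) m)

    ∈row : ∀ {p n e} → δ p ≡ n → e ∈ row (num p) n → e ∈ Automaton.instrs automaton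
    ∈row {p} {e = e} refl m = ∈row⇒∈instrs {num p} (subst (λ p' → e ∈ row (num p) (δ p')) (sym (dec-enc finite p)) m)

    row∋ : ∀ {p χ q} → (num p , χ , q) ∈ Automaton.instrs automaton → (num p , χ , q) ∈ row (num p) (δ p)
    row∋ {p} {χ} {q} m = subst (λ p' → (num p , χ , q) ∈ row (num p) (δ p')) (dec-enc finite p) (∈instrs⇒∈row m)

    row-det : ∀ {i n p χ₁ q₁ χ₂ q₂} → (p , χ₁ , q₁) ∈ row i n → (p , χ₂ , q₂) ∈ row i n
            → (χ₁ , q₁) ≢ (χ₂ , q₂) → IsNeg χ₁ χ₂ ⊎ IsNeg χ₂ χ₁
    row-det {n = doI _ _}  (here refl)         (here refl)         ne = contradiction refl ne
    row-det {n = br _ _ _} (here refl)         (here refl)         ne = contradiction refl ne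
    row-det {n = br _ _ _} (here refl)         (there (here refl)) ne = inj₂ (isNeg _)
    row-det {n = br _ _ _} (there (here refl)) (here refl)         ne = inj₁ (isNeg _)
    row-det {n = br _ _ _} (there (here refl)) (there (here refl)) ne = contradiction refl ne

    deterministic : Deterministic automaton
    deterministic {p} m₁ m₂ refl ne = row-det {n = δ (dec finite p)} (∈instrs⇒∈row m₁) (∈instrs⇒∈row m₂) ne

    module _ (g : Graph s) where
      open Sem g
      open Run automaton g using (Step; step; ⟦_,_,_⟧; Config; Halting; Acc; Holds)
        renaming (Exec to Exec′)
      module R = Run automaton g

      out-exec : ∀ {χ u α u' α'} → Exec χ u α u' α' → Exec′ χ u α u' α'
      out-exec (ex-in e)   = R.ex-in e
      out-exec (ex-out e)  = R.ex-out e
      out-exec (ex-drop f) = R.ex-drop f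
      out-exec ex-ret      = R.ex-ret
      out-exec (ex-test {t = labT _ _} h)     = R.ex-test h
      out-exec (ex-test {t = pebT _ _} h)     = R.ex-test h
      out-exec (ex-test {t = inedgeT _ _} h)  = R.ex-test h
      out-exec (ex-test {t = outedgeT _ _} h) = R.ex-test h
      out-exec (ex-ntst {t = labT _ _} h)     = R.ex-ntst h
      out-exec (ex-ntst {t = pebT _ _} h)     = R.ex-ntst h
      out-exec (ex-ntst {t = inedgeT _ _} h)  = R.ex-ntst h
      out-exec (ex-ntst {t = outedgeT _ _} h) = R.ex-ntst h

      in-exec : ∀ {χ u α u' α'} → Exec′ χ u α u' α' → Exec χ u α u' α'
      in-exec (R.ex-in e)   = ex-in e
      in-exec (R.ex-out e)  = ex-out e
      in-exec (R.ex-drop f) = ex-drop f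
      in-exec R.ex-ret      = ex-ret
      in-exec (R.ex-test {t = labT _ _} h)     = ex-test h
      in-exec (R.ex-test {t = pebT _ _} h)     = ex-test h
      in-exec (R.ex-test {t = inedgeT _ _} h)  = ex-test h
      in-exec (R.ex-test {t = outedgeT _ _} h) = ex-test h
      in-exec (R.ex-ntst {t = labT _ _} h)     = ex-ntst h
      in-exec (R.ex-ntst {t = pebT _ _} h)     = ex-ntst h
      in-exec (R.ex-ntst {t = inedgeT _ _} h)  = ex-ntst h
      in-exec (R.ex-ntst {t = outedgeT _ _} h) = ex-ntst h

      accept-exit : ∀ {p b} → δ p ≡ exit b → accepting (δ (dec finite (num p))) ≡ b
      accept-exit {p} e = trans (cong (accepting ∘ δ) (dec-enc finite p)) (cong accepting e)

      exit-halting : ∀ {p b u α} → δ p ≡ exit b → Halting ⟦ num p , u , α ⟧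
      exit-halting {p} e (_ , step {χ = χ} {q = q} m _) with () ← subst (λ n → (num p , χ , q) ∈ row (num p) n) e (row∋ m)

      Big⇒Star : ∀ {p u α b u' α'} → Big C p (u , α) b (u' , α')
               → ∃[ q ] Star Step ⟦ num p , u , α ⟧ ⟦ num q , u' , α' ⟧ × δ q ≡ exit b
      Big⇒Star (b-exit e) = _ , ε , e
      Big⇒Star (b-doI e x d) with q , st , e' ← Big⇒Star d = q , step (∈row e (here refl)) (out-exec x) ◅ st , e'
      Big⇒Star (b-yes e h d) with q , st , e' ← Big⇒Star d = q , step (∈row e (here refl)) (out-exec (ex-test h)) ◅ st , e'
      Big⇒Star (b-no e h d)  with q , st , e' ← Big⇒Star d = q , step (∈row e (there (here refl))) (out-exec (ex-ntst h)) ◅ st , e'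

      -- The final state accepts only if its action is `exit true`, where the derivation can end;
      -- before that, each step comes from the row of the current action.
      Star⇒Big : ∀ {p u α c} → Star Step ⟦ num p , u , α ⟧ c → accepting (δ (dec finite (Config.state c))) ≡ true
               → Big C p (u , α) true (Config.heads c , Config.stack c)
      Star⇒Big {p} ε acc with δ p in e | trans (sym (cong (accepting ∘ δ) (dec-enc finite p))) acc
      ... | exit true | _ = b-exit e
      Star⇒Big {p} (step m x ◅ st) acc with δ p in e | row∋ {p} m
      ... | doI χ p'   | here refl         = b-doI e (in-exec x) (Star⇒Big st acc)
      ... | br t p₁ p₂ | here refl with ex-test h ← in-exec x = b-yes e h (Star⇒Big st acc)
      ... | br t p₁ p₂ | there (here refl) with ex-ntst h ← in-exec x = b-no e h (Star⇒Big st acc)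

      Acc⇒Runs : ∀ {u} → Acc u → ∃[ w ] Runs C (replicate k u , []) true (w , [])
      Acc⇒Runs (_ , st , _ , acc , refl) = _ , Star⇒Big st acc

      Runs⇒Acc : ∀ {u w} → Runs C (replicate k u , []) true (w , []) → Acc u
      Runs⇒Acc d with q , st , e ← Big⇒Star d = _ , st , exit-halting e , accept-exit e , refl

-- Simulating the guide and looping along its walk.

Off : ∀ {A : Set} {k} → Fin k → Vec A k → Vec A k → Set
Off i w w' = ∀ j → j ≢ i → lookup w' j ≡ lookup w j

off-update : ∀ {A : Set} {k} (i : Fin k) (w : Vec A k) v → Off i w (w [ i ]≔ v)
off-update i w v j ne = lookup∘update′ ne w v

unique-fst : ∀ {A B : Set} {β : List (A × B)} {x v w} → Unique (mapL proj₁ β) → (x , v) ∈ β → (x , w) ∈ β → v ≡ w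
unique-fst (_ ∷ _)  (here refl) (here refl) = refl
unique-fst (x∉ ∷ _) (here refl) (there m)   = contradiction refl (lookupA x∉ (∈-map⁺ proj₁ m))
unique-fst (x∉ ∷ _) (there m)   (here refl) = contradiction refl (lookupA x∉ (∈-map⁺ proj₁ m))
unique-fst (_ ∷ u)  (there m)   (there m')  = unique-fst u m m'

Any-fst⇒∈ : ∀ {A B : Set} {β : List (A × B)} {x} → Any (λ p → proj₁ p ≡ x) β → ∃[ v ] (x , v) ∈ β
Any-fst⇒∈ a with (_ , v) , m , refl ← find a = v , m

∉-names : ∀ {A B : Set} {β : List (A × B)} {x} → ¬ Any (λ p → proj₁ p ≡ x) β → All (x ≢_) (mapL proj₁ β)
∉-names f = tabulateA λ m e → case ∈-map⁻ proj₁ m of λ { (_ , m' , refl) → f (lose m' (sym e)) }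

-- Lists of bounded length over Fin m, kept in the control state to remember which pebbles of the
-- guide are on the stack.
data Trail (m : ℕ) : ℕ → Set where
  none : ∀ {n} → Trail m n
  some : ∀ {n} → Fin m → Trail m n → Trail m (suc n)

module _ {m : ℕ} where
  names : ∀ {n} → Trail m n → List (Fin m)
  names none       = []
  names (some x t) = x ∷ names t

  finTrail : ∀ n → Finite (Trail m n)
  finTrail zero    = retract (λ _ → tt) (λ _ → none) (λ { none → refl }) fin⊤
  finTrail (suc n) = retract (λ { none → nothing ; (some x t) → just (x , t) })
                             (λ { nothing → none ; (just (x , t)) → some x t })
                             (λ { none → refl ; (some x t) → refl })
                             (finMaybe (fin× finFin (finTrail n)))

  -- Inserting in front requires the old trail at a bound lower by one, so its elements are shifted
  -- one level inward. `nothing` means that the trail is full.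
  push : ∀ {n} → Fin m → Trail m n → Maybe (Trail m n)
  push {zero}  x _          = nothing
  push {suc n} x none       = just (some x none)
  push {suc n} x (some y t) = maybe (just ∘ some x) nothing (push y t)

  push-just : ∀ {n} x (t : Trail m n) → length (names t) < n
            → ∃[ t' ] push x t ≡ just t' × names t' ≡ x ∷ names t
  push-just {suc n} x none       _       = _ , refl , refl
  push-just {suc n} x (some y t) (s≤s l) with t' , e , e' ← push-just y t l rewrite e = _ , refl , cong (x ∷_) e'

  weaken : ∀ {n} → Trail m n → Trail m (suc n)
  weaken none       = none
  weaken (some x t) = some x (weaken t)

  names-weaken : ∀ {n} (t : Trail m n) → names (weaken t) ≡ names t
  names-weaken none       = refl
  names-weaken (some x t) = cong (x ∷_) (names-weaken t)

module Loops {k s nX' : ℕ} (i₀ : Fin k) (G : Automaton 1 s) (nm : ℕ → Fin (suc nX')) where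
  open Charts {k} {s} {nX'} i₀
  open Automaton G using (nQ; instrs) renaming (nX to mG; q₀ to start)

  open import Data.List.Membership.DecPropositional (_≟F_ {mG}) using (_∈?_)

  GPos : Set
  GPos = Fin nQ × Trail mG mG

  finGPos : Finite GPos
  finGPos = fin× finFin (finTrail mG)

  module _ (n : ℕ) (i : Fin k) where
    -- At level `n` the guide owns the `mG` numbers from `n` on, and the loop body uses numbers from
    -- `n + mG` on; the numbering thus follows the nesting of the stack.
    guideName : Fin mG → Fin nP
    guideName x = nm (n + toℕ x)

    guideTest : Test 1 mG s → Test k nP s
    guideTest (labT _ σ)     = labT i σ
    guideTest (pebT _ x)     = pebT i (guideName x)
    guideTest (inedgeT _ σ)  = inedgeT i σ
    guideTest (outedgeT _ σ) = outedgeT i σ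

    -- The guide may halt, or be interrupted, with pebbles on the stack; they must be removed from
    -- the top down before the level below is accessible again.
    clean : ∀ {j} → Trail mG j → Chart ⊤
    clean none       = ret tt
    clean (some x t) = prim (retrieve (guideName x)) >> clean t

    dropping : ∀ {P : Set} → Dec P → Fin mG → Maybe (Trail mG mG) → Chart (Maybe (Trail mG mG))
    dropping (no _)  x (just t) = prim (drop i (guideName x)) >> ret (just t)
    dropping _       _ _        = ret nothing

    popping : ∀ {j} → Fin mG → Trail mG j → Chart (Maybe (Trail mG j))
    popping x none = ret nothing
    popping x (some y t) with y ≟F x
    ... | yes _ = prim (retrieve (guideName x)) >> ret (just (weaken t))
    ... | no _  = ret nothing

    -- Whether a `drop` or a `retrieve` applies depends on pebbles that may lie away from the heads.
    -- The trail supplies this, so an inapplicable instruction gives `nothing` instead of blocking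
    -- the run.
    attempt : Instr 1 mG s → Trail mG mG → Chart (Maybe (Trail mG mG))
    attempt (inmove _ σ)  t = cond (tst (inedgeT i σ)) (prim (inmove i σ) >> ret (just t)) (ret nothing)
    attempt (outmove _ σ) t = cond (tst (outedgeT i σ)) (prim (outmove i σ) >> ret (just t)) (ret nothing)
    attempt (drop _ x)    t = dropping (x ∈? names t) x (push x t)
    attempt (retrieve x)  t = popping x t
    attempt (test τ)      t = cond (tst (guideTest τ)) (ret (just t)) (ret nothing)
    attempt (ntest τ)     t = cond (tst (guideTest τ)) (ret nothing) (ret (just t))

    finTrail? : Finite (Maybe (Trail mG mG))
    finTrail? = finMaybe (finTrail mG)

    -- A deterministic guide has at most one successor configuration, so trying the instructions in
    -- list order loses nothing.
    advance : GPos → List (Fin nQ × Instr 1 mG s × Fin nQ) → Chart (Maybe GPos)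
    advance (q , t) [] = ret nothing
    advance (q , t) ((p , χ , q') ∷ is) with p ≟F q
    ... | no _  = advance (q , t) is
    ... | yes _ = bind finTrail? (attempt χ t) (maybe (λ t' → ret (just (q' , t'))) (advance (q , t) is))

    module _ (body : Chart Bool) where
      finish : Trail mG mG → Bool → Chart (GPos ⊎ Bool)
      finish t b = clean t >> ret (inj₂ b)

      -- The body precedes the move, so it also runs at the starting node and at the node where the
      -- guide halts.
      round : GPos → Chart (GPos ⊎ Bool)
      round (q , t) = cond body (finish t true)
        (bind (finMaybe finGPos) (advance (q , t) instrs) (maybe (ret ∘ inj₁) (finish t false)))

      opaque
        loop : Chart Bool
        loop = iter finGPos round (start , none)

  module Spec (g : Graph s) {bound : ℕ} (nm-inj : ∀ {a b} → a < bound → b < bound → nm a ≡ nm b → a ≡ b) where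
    open Sem g
    private module RG = Run G g
    open RG using (⟦_,_,_⟧; step; done; next)

    -- `func` puts each pebble on one node only, so a successful `pebT` test identifies the node
    -- under the head.
    record Below (n : ℕ) (γ : Stack) : Set where
      field
        named : ∀ {x v} → (x , v) ∈ γ → ∃[ a ] a < n × x ≡ nm a
        func  : ∀ {x v w} → (x , v) ∈ γ → (x , w) ∈ γ → v ≡ w
    open Below public

    Below-[] : Below 0 []
    Below-[] = record { named = λ () ; func = λ () }

    fresh-nm : ∀ {n γ a v} → Below n γ → n ≤ a → a < bound → ¬ (nm a , v) ∈ γ
    fresh-nm b n≤a a<B m with a' , a'<n , e ← named b m
      with refl ← nm-inj a<B (<-≤-trans (<-≤-trans a'<n n≤a) (<⇒≤ a<B)) e = <-irrefl refl (<-≤-trans a'<n n≤a)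

    fresh-Any : ∀ {n γ a} → Below n γ → n ≤ a → a < bound → ¬ Any (λ p → proj₁ p ≡ nm a) γ
    fresh-Any b n≤a a<B x with _ , m ← Any-fst⇒∈ x = fresh-nm b n≤a a<B m

    Below-push : ∀ {n γ v} → Below n γ → n < bound → Below (suc n) ((nm n , v) ∷ γ)
    Below-push {n} b n<B = record
      { named = λ { (here refl) → n , n<1+n n , refl
                  ; (there m) → case named b m of λ { (a , a<n , e) → a , <-≤-trans a<n (n≤1+n n) , e } }
      ; func = λ { (here refl) (here refl) → refl
                 ; (here refl) (there m) → contradiction m (fresh-nm b ≤-refl n<B)
                 ; (there m) (here refl) → contradiction m (fresh-nm b ≤-refl n<B)
                 ; (there m) (there m') → func b m m' } }

    module _ (n : ℕ) (i : Fin k) {α : Stack} (wf : Below n α) (fits : n + mG ≤ bound) where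

      name<n+m : (x : Fin mG) → n + toℕ x < n + mG
      name<n+m x = +-monoʳ-< n (toℕ<n x)

      name<bound : (x : Fin mG) → n + toℕ x < bound
      name<bound x = <-≤-trans (name<n+m x) fits

      emb : RG.Stack → Stack
      emb β = mapL (λ { (x , v) → guideName n i x , v }) β ++L α

      emb⁺ : ∀ {x v β} → (x , v) ∈ β → (guideName n i x , v) ∈ emb β
      emb⁺ m = ∈-++⁺ˡ (∈-map⁺ _ m)

      emb⁻ : ∀ {x v} β → (guideName n i x , v) ∈ emb β → (x , v) ∈ β
      emb⁻ {x} β m with ∈-++⁻ (mapL _ β) m
      ... | inj₂ m' = contradiction m' (fresh-nm wf (m≤m+n n _) (name<bound x))
      ... | inj₁ m' with (y , v) , m'' , e ← ∈-map⁻ _ m'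
        with refl ← cong proj₂ e
        with refl ← toℕ-injective (+-cancelˡ-≡ n _ _ (nm-inj (name<bound x) (name<bound y) (cong proj₁ e))) = m''

      emb-extends : ∀ {p} β → p ∈ α → p ∈ emb β
      emb-extends β m = ∈-++⁺ʳ (mapL _ β) m

      Below-emb : ∀ {β} → Unique (mapL proj₁ β) → Below (n + mG) (emb β)
      Below-emb {β} u = record { named = nam ; func = fun }
        where
        nam : ∀ {x v} → (x , v) ∈ emb β → ∃[ a ] a < n + mG × x ≡ nm a
        nam m with ∈-++⁻ (mapL _ β) m
        ... | inj₂ m' with a , a<n , e ← named wf m' = a , <-≤-trans a<n (m≤m+n n mG) , e
        ... | inj₁ m' with (y , v) , m'' , refl ← ∈-map⁻ _ m' = _ , name<n+m y , refl
        fun : ∀ {x v w} → (x , v) ∈ emb β → (x , w) ∈ emb β → v ≡ w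
        fun m m' with ∈-++⁻ (mapL _ β) m
        fun m m' | inj₁ l with (y , v) , l' , refl ← ∈-map⁻ _ l = unique-fst u l' (emb⁻ β m')
        fun m m' | inj₂ r with ∈-++⁻ (mapL _ β) m'
        ... | inj₁ l with (y , v) , l' , refl ← ∈-map⁻ _ l = unique-fst u (emb⁻ β m) l'
        ... | inj₂ r' = func wf r r'

      -- Only head `i` and the pebble names are tied to the guide; the loop body may leave the other
      -- heads anywhere.
      record Sim (u : Vec (Node g) 1) (β : RG.Stack) (t : Trail mG mG) (w : Heads) : Set where
        constructor sim
        field
          same-node : lookup u zero ≡ lookup w i
          same-pebs : names t ≡ mapL proj₁ β
          distinct  : Unique (mapL proj₁ β)

      clean-run : ∀ {j} (t : Trail mG j) β {w} → names t ≡ mapL proj₁ β → Runs (clean n i t) (w , emb β) tt (w , α)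
      clean-run none []                  e = ret-run
      clean-run (some x t) ((y , v) ∷ β) e with refl , e' ← ∷-injective e = bind-run (prim-run ex-ret) (clean-run t β e')

      holds⁺ : ∀ τ {u β w} → lookup u zero ≡ lookup w i → RG.Holds τ u β → Holds (guideTest n i τ) w (emb β)
      holds⁺ (labT zero σ)     e h rewrite e = h
      holds⁺ (pebT zero x)     e h rewrite e = emb⁺ h
      holds⁺ (inedgeT zero σ)  e h rewrite e = h
      holds⁺ (outedgeT zero σ) e h rewrite e = h

      holds⁻ : ∀ τ {u β w} → lookup u zero ≡ lookup w i → Holds (guideTest n i τ) w (emb β) → RG.Holds τ u β
      holds⁻ (labT zero σ)     e h rewrite e = h
      holds⁻ (pebT zero x) {β = β} e h rewrite e = emb⁻ β h
      holds⁻ (inedgeT zero σ)  e h rewrite e = h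
      holds⁻ (outedgeT zero σ) e h rewrite e = h

      Done : Instr 1 mG s → Vec (Node g) 1 → RG.Stack → Trail mG mG → Heads → Set
      Done χ u β t w = ∃₂ λ u' β' → RG.Exec χ u β u' β' × ∃₂ λ t' w' → Sim u' β' t' w' × Off i w w'
        × Runs (attempt n i χ t) (w , emb β) (just t') (w' , emb β')

      Stuck : Instr 1 mG s → Vec (Node g) 1 → RG.Stack → Trail mG mG → Heads → Set
      Stuck χ u β t w = (∀ {u' β'} → ¬ RG.Exec χ u β u' β') × Runs (attempt n i χ t) (w , emb β) nothing (w , emb β)

      moved : ∀ {u : Vec (Node g) 1} {β t w v} → Sim u β t w → Sim (u [ zero ]≔ v) β t (w [ i ]≔ v)
      moved {u} {w = w} {v} (sim e e' d) = sim (trans (lookup∘update zero u v) (sym (lookup∘update i w v))) e' d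

      popping-spec : ∀ {j} x (t : Trail mG j) β {w} → names t ≡ mapL proj₁ β
        → (∃₂ λ v β' → β ≡ (x , v) ∷ β' × ∃[ t' ] names t' ≡ mapL proj₁ β' × Runs (popping n i x t) (w , emb β) (just t') (w , emb β'))
          ⊎ ((∀ {v β'} → β ≢ (x , v) ∷ β') × Runs (popping n i x t) (w , emb β) nothing (w , emb β))
      popping-spec x none [] e = inj₂ ((λ ()) , ret-run)
      popping-spec x (some y t) ((z , v) ∷ β) e with refl , e' ← ∷-injective e with y ≟F x
      ... | yes refl = inj₁ (v , β , refl , weaken t , trans (names-weaken t) e' , bind-run (prim-run ex-ret) ret-run)
      ... | no ne = inj₂ ((λ { refl → ne refl }) , ret-run)

      attempt-spec : ∀ χ {u β t w} → Sim u β t w → Done χ u β t w ⊎ Stuck χ u β t w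
      attempt-spec (inmove zero σ) {u} {β} {t} {w} si@(sim e _ _) with holds? (inedgeT i σ) w (emb β)
      ... | yes h@(v , e') = inj₁ (_ , _ , RG.ex-in (trans e' (cong just (sym e))) , _ , _ , moved si , off-update i w v
                             , bind-run (tst-yes h) (bind-run (prim-run (ex-in e')) ret-run))
      ... | no ¬h = inj₂ ((λ { (RG.ex-in e') → ¬h (_ , trans e' (cong just e)) }) , bind-run (tst-no ¬h) ret-run)
      attempt-spec (outmove zero σ) {u} {β} {t} {w} si@(sim e _ _) with holds? (outedgeT i σ) w (emb β)
      ... | yes h@(v , e') = inj₁ (_ , _ , RG.ex-out (trans (cong (λ z → out g z σ) e) e') , _ , _ , moved si , off-update i w v
                             , bind-run (tst-yes h) (bind-run (prim-run (ex-out e')) ret-run))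
      ... | no ¬h = inj₂ ((λ { (RG.ex-out e') → ¬h (_ , trans (cong (λ z → out g z σ) (sym e)) e') }) , bind-run (tst-no ¬h) ret-run)
      attempt-spec (drop zero x) {u} {β} {t} {w} (sim e e' d) with x ∈? names t
      ... | yes m = inj₂ ((λ { (RG.ex-drop f) → case ∈-map⁻ proj₁ (subst (x ∈_) e' m) of λ { (_ , m' , refl) → f (lose m' refl) } }) , ret-run)
      ... | no x∉ with d' ← ∉-names {β = β} (λ a → x∉ (subst (x ∈_) (sym e') (∈-map⁺ proj₁ (proj₂ (Any-fst⇒∈ a))))) ∷ d
        -- Together with `x` the names on the stack are still distinct, so there are at most `mG` of
        -- them and the trail has room.
        with t' , e₁ , e₂ ← push-just x t (subst (λ z → length z < mG) (sym e') (Unique⇒length≤size finFin d'))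
        rewrite e₁ = inj₁ (_ , _ , RG.ex-drop (λ a → x∉ (subst (x ∈_) (sym e') (∈-map⁺ proj₁ (proj₂ (Any-fst⇒∈ a)))))
                          , t' , w , sim e (trans e₂ (cong (x ∷_) e')) d' , (λ _ _ → refl)
                          , bind-run (prim-run (subst (λ z → Exec (drop i (guideName n i x)) w (emb β) w ((guideName n i x , z) ∷ emb β)) (sym e)
                                       (ex-drop λ a → x∉ (subst (x ∈_) (sym e') (∈-map⁺ proj₁ (emb⁻ β (proj₂ (Any-fst⇒∈ a)))))))) ret-run)
      attempt-spec (retrieve x) {u} {β} {t} {w} (sim e e' d) with popping-spec x t β e'
      ... | inj₂ (ne , r) = inj₂ ((λ { RG.ex-ret → ne refl }) , r)
      ... | inj₁ (v , β' , refl , t' , e'' , r) with _ ∷ d' ← d = inj₁ (_ , _ , RG.ex-ret , t' , w , sim e e'' d' , (λ _ _ → refl) , r)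
      attempt-spec (test τ) {u} {β} {t} {w} si@(sim e _ _) with holds? (guideTest n i τ) w (emb β)
      ... | yes h = inj₁ (_ , _ , RG.ex-test (holds⁻ τ e h) , _ , _ , si , (λ _ _ → refl) , bind-run (tst-yes h) ret-run)
      ... | no ¬h = inj₂ ((λ { (RG.ex-test h) → ¬h (holds⁺ τ e h) }) , bind-run (tst-no ¬h) ret-run)
      attempt-spec (ntest τ) {u} {β} {t} {w} si@(sim e _ _) with holds? (guideTest n i τ) w (emb β)
      ... | no ¬h = inj₁ (_ , _ , RG.ex-ntst (¬h ∘ holds⁺ τ e) , _ , _ , si , (λ _ _ → refl) , bind-run (tst-no ¬h) ret-run)
      ... | yes h = inj₂ ((λ { (RG.ex-ntst ¬h) → ¬h (holds⁻ τ e h) }) , bind-run (tst-yes h) ret-run)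

      advance-spec : ∀ is {q u β t w} → Sim u β t w
        → (∃₂ λ χ q' → ∃₂ λ u' β' → (q , χ , q') ∈ is × RG.Exec χ u β u' β' × ∃₂ λ t' w' → Sim u' β' t' w' × Off i w w'
             × Runs (advance n i (q , t) is) (w , emb β) (just (q' , t')) (w' , emb β'))
          ⊎ ((∀ {χ q' u' β'} → (q , χ , q') ∈ is → ¬ RG.Exec χ u β u' β')
             × Runs (advance n i (q , t) is) (w , emb β) nothing (w , emb β))
      advance-spec [] si = inj₂ ((λ ()) , ret-run)
      advance-spec ((p , χ , q') ∷ is) {q} si with p ≟F q
      advance-spec ((p , χ , q') ∷ is) {q} si | no ne with advance-spec is {q} si
      ... | inj₁ (χ' , q'' , _ , _ , m , x , rest) = inj₁ (χ' , q'' , _ , _ , there m , x , rest)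
      ... | inj₂ (f , r) = inj₂ ((λ { (here refl) → contradiction refl ne ; (there m) → f m }) , r)
      advance-spec ((p , χ , q') ∷ is) {q} si | yes refl with attempt-spec χ si
      ... | inj₁ (_ , _ , x , t' , w' , si' , off , r) =
        inj₁ (χ , q' , _ , _ , here refl , x , t' , w' , si' , off , bind-run r ret-run)
      ... | inj₂ (f , r) with advance-spec is {q} si
      ... | inj₁ (χ' , q'' , _ , _ , m , x , t' , w' , si' , off , r') =
        inj₁ (χ' , q'' , _ , _ , there m , x , t' , w' , si' , off , bind-run r r')
      ... | inj₂ (f' , r') = inj₂ ((λ { (here refl) → f ; (there m) → f' m }) , bind-run r r')

      sim-stay : ∀ {u β t w w'} → Sim u β t w → lookup w' i ≡ lookup w i → Sim u β t w'
      sim-stay (sim e e' d) l = sim (trans e (sym l)) e' d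

      sim-init : ∀ {w} → Sim (replicate 1 (lookup w i)) [] none w
      sim-init = sim refl refl []

      module _ (body : Chart Bool) where
        finish-run : ∀ {b t u β w w₁} → Sim u β t w → Runs (finish n i body t b) (w₁ , emb β) (inj₂ b) (w₁ , α)
        finish-run {t = t} {β = β} (sim _ e _) = bind-run (clean-run t β e) ret-run

        record Round (q : Fin nQ) (t : Trail mG mG) (u : Vec (Node g) 1) (β : RG.Stack) (w : Heads) : Set where
          field
            succeed : ∀ {w₁} → Runs body (w , emb β) true (w₁ , emb β)
                    → Runs (round n i body (q , t)) (w , emb β) (inj₂ true) (w₁ , α)
            fail    : ∀ {w₁} → Runs body (w , emb β) false (w₁ , emb β) → lookup w₁ i ≡ lookup w i
                    → (∃₂ λ q' u' → ∃₂ λ β' t' → ∃[ w' ] RG.Step ⟦ q , u , β ⟧ ⟦ q' , u' , β' ⟧ × Sim u' β' t' w' × Off i w₁ w'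
                         × Runs (round n i body (q , t)) (w , emb β) (inj₁ (q' , t')) (w' , emb β'))
                      ⊎ (RG.Halting ⟦ q , u , β ⟧ × Runs (round n i body (q , t)) (w , emb β) (inj₂ false) (w₁ , α))

        round-spec : ∀ {q t u β w} → Sim u β t w → Round q t u β w
        round-spec {w = w} si = record
          { succeed = λ r → bind-run r (finish-run si)
          ; fail = λ {w₁} r l → case advance-spec instrs (sim-stay {w = w} {w₁} si l) of λ
              { (inj₁ (χ , q' , _ , _ , m , x , t' , w' , si' , off , r')) →
                  inj₁ (q' , _ , _ , t' , w' , step m x , si' , off , bind-run r (bind-run r' ret-run))
              ; (inj₂ (f , r')) →
                  inj₂ ((λ { (_ , step m x) → f m x }) , bind-run r (bind-run r' (finish-run si))) } }

        -- Rule for total correctness: a halting walk of the guide bounds the loop. `I` has to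
        -- survive any move of head `i`, `N` is what a failure of the body reveals about the current
        -- node, and a complete failure collects `N` along the entire walk.
        module Total (det : Deterministic G) (I : Heads → Set) (N : Node g → Set) (Post : Heads → Set)
          (I-off : ∀ {w w'} → I w → Off i w w' → I w')
          (body-spec : ∀ w γ → I w → Below (n + mG) γ → (∀ {p} → p ∈ α → p ∈ γ)
             → (∃[ w' ] Runs body (w , γ) true (w' , γ) × Post w')
               ⊎ (∃[ w' ] Runs body (w , γ) false (w' , γ) × lookup w' i ≡ lookup w i × I w' × N (lookup w i))) where

          open Determinism G g using (step-det)

          Answer : (Bool → St → Set) → List RG.Config → Set
          Answer result cs = (∃[ w' ] result true (w' , α) × Post w')
            ⊎ (∃[ w' ] result false (w' , α) × All (λ c → N (lookup (RG.Config.heads c) zero)) cs)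

          walk-spec : ∀ {c cs} → RG.Walk c cs → ∀ {q u β t w} → c ≡ ⟦ q , u , β ⟧ → Sim u β t w → I w
                    → Answer (Trace finGPos (round n i body) (λ _ → id) (q , t) (w , emb β)) cs
          walk-spec walk {t = t} {w} refl si iw
            with body-spec w _ iw (Below-emb (Sim.distinct si)) (emb-extends _)
          ... | inj₁ (w₁ , r , post) = inj₁ (w₁ , stop (Round.succeed (round-spec si) r) refl , post)
          walk-spec (done h) refl si iw | inj₂ (w₁ , r , l , iw₁ , nv) with Round.fail (round-spec si) r l
          ... | inj₁ (_ , _ , _ , _ , _ , st , _) = contradiction (_ , st) h
          ... | inj₂ (_ , r') = inj₂ (w₁ , stop r' refl , subst N (sym (Sim.same-node si)) nv ∷ [])
          walk-spec (next st walk) refl si iw | inj₂ (w₁ , r , l , iw₁ , nv) with Round.fail (round-spec si) r l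
          ... | inj₂ (h , _) = contradiction (_ , st) h
          ... | inj₁ (_ , _ , _ , _ , w₂ , st' , si' , off , r')
            with walk-spec walk (step-det det st st') si' (I-off iw₁ off)
          ... | inj₁ (w₃ , tr , post) = inj₁ (w₃ , more r' refl tr , post)
          ... | inj₂ (w₃ , tr , nos)  = inj₂ (w₃ , more r' refl tr , subst N (sym (Sim.same-node si)) nv ∷ nos)

          opaque
            unfolding loop
            loop-spec : ∀ {w cs} → RG.Walk (RG.init (lookup w i)) cs → I w → Answer (Runs (loop n i body) (w , α)) cs
            loop-spec walk iw with walk-spec walk refl sim-init iw
            ... | inj₁ (w' , tr , post) = inj₁ (w' , iter-run tr , post)
            ... | inj₂ (w' , tr , nos)  = inj₂ (w' , iter-run tr , nos)

        -- Rule for partial correctness, for graphs on which the guide may diverge. No walk is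
        -- assumed: the answer `false` itself certifies that the guide halted and yields its walk.
        module Partial (N : Node g → Set) (T : Set)
          (body-inv : ∀ {w γ b w' γ'} → Below (n + mG) γ → (∀ {p} → p ∈ α → p ∈ γ) → Runs body (w , γ) b (w' , γ')
             → γ' ≡ γ × lookup w' i ≡ lookup w i × (b ≡ true → T) × (b ≡ false → N (lookup w i))) where

          record Visited (c : RG.Config) (b : Bool) (s' : St) : Set where
            field
              restored  : proj₂ s' ≡ α
              last      : RG.Config
              reachable : Star RG.Step c last
              at-last   : lookup (RG.Config.heads last) zero ≡ lookup (proj₁ s') i
              if-true   : b ≡ true → T
              if-false  : b ≡ false → ∃[ cs ] RG.Walk c cs × All (λ c → N (lookup (RG.Config.heads c) zero)) cs

          -- Only the run of the body is inverted. The rest of the round is identified by `big-det`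
          -- with the run constructed in `Round`, so the simulated instructions need no inversion of
          -- their own.
          trace-inv : ∀ {q t u β w b s'} → Sim u β t w
                    → Trace finGPos (round n i body) (λ _ → id) (q , t) (w , emb β) b s' → Visited ⟦ q , u , β ⟧ b s'

          trace-inv si (stop r e) with bind-inv r
          ... | true , (w₁ , γ₁) , rb , _
            with refl , l , t , _ ← body-inv (Below-emb (Sim.distinct si)) (emb-extends _) rb
            with refl ← big-det r (Round.succeed (round-spec si) rb) | refl ← e = record
              { restored = refl ; last = _ ; reachable = ε ; at-last = trans (Sim.same-node si) (sym l)
              ; if-true = t ; if-false = λ () }
          ... | false , (w₁ , γ₁) , rb , _
            with refl , l , _ , f ← body-inv (Below-emb (Sim.distinct si)) (emb-extends _) rb
            with Round.fail (round-spec si) rb l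
          ... | inj₁ (_ , _ , _ , _ , _ , _ , _ , _ , r') with refl ← big-det r r' | () ← e
          ... | inj₂ (h , r') with refl ← big-det r r' | refl ← e = record
              { restored = refl ; last = _ ; reachable = ε ; at-last = trans (Sim.same-node si) (sym l)
              ; if-true = λ () ; if-false = λ _ → _ , done h , subst N (sym (Sim.same-node si)) (f refl) ∷ [] }
          trace-inv si (more r e tr) with bind-inv r
          ... | true , (w₁ , γ₁) , rb , _
            with refl , l , t , _ ← body-inv (Below-emb (Sim.distinct si)) (emb-extends _) rb
            with refl ← big-det r (Round.succeed (round-spec si) rb) | () ← e
          ... | false , (w₁ , γ₁) , rb , _
            with refl , l , _ , f ← body-inv (Below-emb (Sim.distinct si)) (emb-extends _) rb
            with Round.fail (round-spec si) rb l
          ... | inj₂ (h , r') with refl ← big-det r r' | () ← e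
          ... | inj₁ (_ , _ , _ , _ , _ , st , si' , _ , r') with refl ← big-det r r' | refl ← e = record
              { restored = V.restored ; last = V.last ; reachable = st ◅ V.reachable ; at-last = V.at-last
              ; if-true = V.if-true
              ; if-false = λ b → case V.if-false b of λ
                  { (cs , walk , nos) → _ , next st walk , subst N (sym (Sim.same-node si)) (f refl) ∷ nos } }
            where module V = Visited (trace-inv si' tr)

          opaque
            unfolding loop
            loop-inv : ∀ {w b s'} → Runs (loop n i body) (w , α) b s' → Visited (RG.init (lookup w i)) b s'
            loop-inv r = trace-inv sim-init (iter-inv r)

-- Checking that the guide visits every node.

VisitsAll : ∀ {s} (G : Automaton 1 s) (g : Graph s) → Node g → Set
VisitsAll G g v = ∃[ cs ] Run.Walk G g (Run.init G g v) cs
  × (∀ u → Any (λ c → lookup (Run.Config.heads c) zero ≡ u) cs)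

-- Three nested runs of the guide: one that picks the nodes to inspect, one started at the inspected
-- node, which carries an extra pebble, and the searches made from a neighbour, which carries
-- another.
checkSize : ∀ {s} → Automaton 1 s → ℕ
checkSize G = mG + (suc mG + suc mG)
  where open Automaton G renaming (nX to mG)

module Search {k s nX' : ℕ} (i₀ : Fin k) (G : Automaton 1 s) (nm : ℕ → Fin (suc nX')) where
  open Charts {k} {s} {nX'} i₀ public
  open Loops {k} {s} {nX'} i₀ G nm public
  open Automaton G using () renaming (nX to mG) public

  -- The final test turns a failed search into a blocked run.
  seek : ℕ → Fin k → Fin nP → Chart ⊤
  seek n i x = bind finBool (loop n i (tst (pebT i x))) (λ _ → prim (test (pebT i x)))

  data Dir : Set where
    fwd bwd : Fin s → Dir

  flip : Dir → Dir
  flip (fwd σ) = bwd σ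
  flip (bwd σ) = fwd σ

  canMove : Dir → Test k nP s
  canMove (fwd σ) = outedgeT i₀ σ
  canMove (bwd σ) = inedgeT i₀ σ

  move : Dir → Instr k nP s
  move (fwd σ) = outmove i₀ σ
  move (bwd σ) = inmove i₀ σ

  dirs : List Dir
  dirs = mapL fwd (allFinL s) ++L mapL bwd (allFinL s)

  ∈dirs : ∀ d → d ∈ dirs
  ∈dirs (fwd σ) = ∈-++⁺ˡ (∈-map⁺ fwd (∈-allFin σ))
  ∈dirs (bwd σ) = ∈-++⁺ʳ (mapL fwd (allFinL s)) (∈-map⁺ bwd (∈-allFin σ))

  -- The neighbour is marked, a first search goes to the node marked `x`, and a second one returns
  -- from there to the neighbour. Success of the second says exactly that the guide started at the
  -- node marked `x` reaches the neighbour; one step back then restores the head.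
  probe : ℕ → Fin nP → Dir → Chart ⊤
  probe n x d = cond (tst (canMove d))
    (prim (move d) >> prim (drop i₀ (nm n)) >> seek (suc n) i₀ x >> seek (suc n) i₀ (nm n)
      >> prim (retrieve (nm n)) >> prim (move (flip d)))
    (ret tt)

  probeAll : ℕ → Fin nP → List Dir → Chart ⊤
  probeAll n x []       = ret tt
  probeAll n x (d ∷ ds) = probe n x d >> probeAll n x ds

  -- The constant `false` makes the loop follow the guide to its end; a neighbour that cannot be
  -- found makes the run block or diverge.
  around : ℕ → Fin nP → Chart Bool
  around n x = probeAll n x dirs >> ret false

  inspect : ℕ → Chart Bool
  inspect n = prim (drop i₀ (nm n))
    >> bind finBool (loop (suc n) i₀ (around (suc n + mG) (nm n)))
         (λ _ → seek (suc n) i₀ (nm n) >> prim (retrieve (nm n)) >> ret false)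

  -- Succeeds exactly on the graphs on which the guide, started anywhere, halts and visits all nodes:
  -- from each node u reached by the guide, the set of nodes visited by the guide started at u is
  -- verified to be closed under adjacency, hence to be everything.
  check : ℕ → Chart Bool
  check n = loop n i₀ (inspect (n + mG))

  module SearchSpec (det : Deterministic G) (g : Graph s) {bound : ℕ}
    (nm-inj : ∀ {a b} → a < bound → b < bound → nm a ≡ nm b → a ≡ b) where
    open Sem g public
    open Spec g nm-inj public
    module RG = Run G g

    at : RG.Config → Node g
    at c = lookup (RG.Config.heads c) zero

    Full : Node g → Set
    Full = VisitsAll G g

    Reach : Node g → Node g → Set
    Reach v u = ∃[ c ] Star RG.Step (RG.init v) c × at c ≡ u

    Adj : Dir → Node g → Node g → Set
    Adj (fwd σ) v u = out g v σ ≡ just u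
    Adj (bwd σ) v u = out g u σ ≡ just v

    Adj-flip : ∀ d {v u} → Adj d v u → Adj (flip d) u v
    Adj-flip (fwd σ) e = e
    Adj-flip (bwd σ) e = e

    Adj-det : ∀ d {v u u'} → Adj d v u → Adj d v u' → u ≡ u'
    Adj-det (fwd σ) e e' = just-injective (trans (sym e) e')
    Adj-det (bwd σ) e e' = inj g _ _ _ σ e e'

    move-inv : ∀ d {w γ w' γ'} → Exec (move d) w γ w' γ' → γ' ≡ γ × Adj d (lookup w i₀) (lookup w' i₀)
    move-inv (fwd σ) {w} (ex-out e) = refl , trans e (cong just (sym (lookup∘update i₀ w _)))
    move-inv (bwd σ) {w} (ex-in e)  = refl , trans (cong (λ z → out g z σ) (lookup∘update i₀ w _)) e

    move-run : ∀ d {w γ v} → Adj d (lookup w i₀) v → Exec (move d) w γ (w [ i₀ ]≔ v) γ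
    move-run (fwd σ) e = ex-out e
    move-run (bwd σ) e = ex-in e

    canMove⁺ : ∀ d {w γ v} → Adj d (lookup w i₀) v → Holds (canMove d) w γ
    canMove⁺ (fwd σ) e = _ , e
    canMove⁺ (bwd σ) e = _ , e

    canMove⁻ : ∀ d {w γ} → Holds (canMove d) w γ → ∃[ v ] Adj d (lookup w i₀) v
    canMove⁻ (fwd σ) h = h
    canMove⁻ (bwd σ) h = h

    module _ {n : ℕ} {α : Stack} (wf : Below n α) (fits : n + mG ≤ bound) where

      seek-run : (∀ v → Full v) → ∀ {i x a} → (x , a) ∈ α → ∀ w
        → ∃[ w' ] Runs (seek n i x) (w , α) tt (w' , α) × lookup w' i ≡ a × Off i w w'
      seek-run full {i} {x} {a} xa w with cs , walk , all-visited ← full (lookup w i)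
        with Total.loop-spec n i wf fits (tst (pebT i x)) det (Off i w) (_≢ a) (λ w' → lookup w' i ≡ a × Off i w w')
               (λ off off' j ne → trans (off' j ne) (off j ne)) body walk (λ _ _ → refl)
        where
        body : ∀ w₁ γ → Off i w w₁ → Below (n + mG) γ → (∀ {p} → p ∈ α → p ∈ γ)
          → (∃[ w' ] Runs (tst (pebT i x)) (w₁ , γ) true (w' , γ) × lookup w' i ≡ a × Off i w w')
            ⊎ (∃[ w' ] Runs (tst (pebT i x)) (w₁ , γ) false (w' , γ) × lookup w' i ≡ lookup w₁ i × Off i w w' × lookup w₁ i ≢ a)
        body w₁ γ off b α⊆γ with holds? (pebT i x) w₁ γ
        ... | yes h = inj₁ (w₁ , tst-yes h , func b h (α⊆γ xa) , off)
        ... | no ¬h = inj₂ (w₁ , tst-no ¬h , refl , off , λ { refl → ¬h (α⊆γ xa) })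
      ... | inj₁ (w' , r , refl , off) = w' , bind-run r (prim-run (ex-test xa)) , refl , off
      ... | inj₂ (_ , _ , nos) with c , m , e ← find (all-visited a) = contradiction e (lookupA nos m)

      seek-inv : ∀ {i x w w' γ} → Runs (seek n i x) (w , α) tt (w' , γ)
        → γ ≡ α × (x , lookup w' i) ∈ α × Reach (lookup w i) (lookup w' i)
      seek-inv {i} {x} r with b , (w₁ , α₁) , r₁ , r₂ ← bind-inv r
        with ex-test h ← prim-inv r₂
        with v ← Partial.loop-inv n i wf fits (tst (pebT i x)) (λ _ → ⊤) ⊤
                   (λ _ _ r → case tst-inv r of λ { (refl , _) → refl , refl , _ , _ }) r₁
        with refl ← Partial.Visited.restored v = refl , h , _ , Partial.Visited.reachable v , Partial.Visited.at-last v

    module _ {n : ℕ} {γ : Stack} {x : Fin nP} {a : Node g} (wf : Below n γ) (fits : suc n + mG ≤ bound) (xa : (x , a) ∈ γ) where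

      n<bound : n < bound
      n<bound = ≤-trans (m≤m+n (suc n) mG) fits

      wf⁺ : ∀ {v} → Below (suc n) ((nm n , v) ∷ γ)
      wf⁺ = Below-push wf n<bound

      drop-run : ∀ {i w} → Runs (prim (drop i (nm n))) (w , γ) tt (w , (nm n , lookup w i) ∷ γ)
      drop-run = prim-run (ex-drop (fresh-Any wf ≤-refl n<bound))

      probe-inv : ∀ {d w w' γ'} → Runs (probe n x d) (w , γ) tt (w' , γ')
        → γ' ≡ γ × lookup w' i₀ ≡ lookup w i₀ × (∀ {y} → Adj d (lookup w i₀) y → Reach a y)
      probe-inv {d} {w} r with bind-inv r
      ... | b , s₁ , r₁ , r₂ with tst-inv r₁
      ... | refl , inj₂ (refl , ¬h) with refl , refl ← ret-inv r₂ = refl , refl , λ adj → contradiction (canMove⁺ d adj) ¬h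
      ... | refl , inj₁ (refl , h)
        with _ , (w₁ , _) , m₁ , r₃ ← bind-inv r₂
        with refl , adj ← move-inv d (prim-inv m₁)
        with _ , _ , m₂ , r₄ ← bind-inv r₃
        with ex-drop _ ← prim-inv m₂
        with _ , (w₂ , _) , m₃ , r₅ ← bind-inv r₄
        with refl , on₂ , _ ← seek-inv wf⁺ fits m₃
        with _ , (w₃ , _) , m₄ , r₆ ← bind-inv r₅
        with refl , on₃ , reach ← seek-inv wf⁺ fits m₄
        with _ , _ , m₅ , m₆ ← bind-inv r₆
        with ex-ret ← prim-inv m₅
        with refl , adj' ← move-inv (flip d) (prim-inv m₆)
        with e₂ ← func wf⁺ on₂ (there xa) | e₃ ← func wf⁺ on₃ (here refl) =
          refl , Adj-det (flip d) adj' (subst (λ z → Adj (flip d) z _) (sym e₃) (Adj-flip d adj))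
        , λ adj″ → subst₂ Reach e₂ (trans e₃ (Adj-det d adj adj″)) reach

      probe-run : (∀ v → Full v) → ∀ d w → ∃[ w' ] Runs (probe n x d) (w , γ) tt (w' , γ) × lookup w' i₀ ≡ lookup w i₀
      probe-run full d w with holds? (canMove d) w γ
      ... | no ¬h = w , bind-run (tst-no ¬h) ret-run , refl
      ... | yes h with y , adj ← canMove⁻ d h
        with w₂ , r₂ , _ ← seek-run wf⁺ fits full {i₀} (there xa) (w [ i₀ ]≔ y)
        with w₃ , r₃ , e₃ , _ ← seek-run (wf⁺ {lookup (w [ i₀ ]≔ y) i₀}) fits full {i₀} (here refl) w₂ =
          _ , bind-run (tst-yes h) (bind-run (prim-run (move-run d adj)) (bind-run drop-run (bind-run r₂ (bind-run r₃
                (bind-run (prim-run ex-ret) (prim-run (move-run (flip d)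
                  (subst (λ z → Adj (flip d) z _) (sym (trans e₃ (lookup∘update i₀ w y))) (Adj-flip d adj)))))))))
            , lookup∘update i₀ w₃ _

      probeAll-inv : ∀ ds {w w' γ'} → Runs (probeAll n x ds) (w , γ) tt (w' , γ')
        → γ' ≡ γ × lookup w' i₀ ≡ lookup w i₀ × (∀ {d y} → d ∈ ds → Adj d (lookup w i₀) y → Reach a y)
      probeAll-inv [] r with refl , refl ← ret-inv r = refl , refl , λ ()
      probeAll-inv (d ∷ ds) r with _ , _ , r₁ , r₂ ← bind-inv r
        with refl , e , f ← probe-inv {d} r₁
        with refl , e' , f' ← probeAll-inv ds r₂ =
          refl , trans e' e , λ { (here refl) → f ; (there m) adj → f' m (subst (λ z → Adj _ z _) (sym e) adj) }

      probeAll-run : (∀ v → Full v) → ∀ ds w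
        → ∃[ w' ] Runs (probeAll n x ds) (w , γ) tt (w' , γ) × lookup w' i₀ ≡ lookup w i₀
      probeAll-run full [] w = w , ret-run , refl
      probeAll-run full (d ∷ ds) w with w₁ , r₁ , e₁ ← probe-run full d w
        with w₂ , r₂ , e₂ ← probeAll-run full ds w₁ = w₂ , bind-run r₁ r₂ , trans e₂ e₁

      around-inv : ∀ {w b w' γ'} → Runs (around n x) (w , γ) b (w' , γ')
        → γ' ≡ γ × lookup w' i₀ ≡ lookup w i₀ × b ≡ false × (∀ d y → Adj d (lookup w i₀) y → Reach a y)
      around-inv r with _ , _ , r₁ , r₂ ← bind-inv r
        with refl , e , f ← probeAll-inv dirs r₁
        with refl , refl ← ret-inv r₂ = refl , e , refl , λ d y → f (∈dirs d)

      around-run : (∀ v → Full v) → ∀ w → ∃[ w' ] Runs (around n x) (w , γ) false (w' , γ) × lookup w' i₀ ≡ lookup w i₀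
      around-run full w with w₁ , r₁ , e₁ ← probeAll-run full dirs w = w₁ , bind-run r₁ ret-run , e₁

    open Determinism G g using (reachable∈walk)

    -- By determinism whatever the guide reaches from `v` occurs in its halting walk. The visited
    -- set then contains `v` and is closed under edges in both directions, so weak connectedness
    -- makes it everything.
    closed⇒Full : ∀ {v cs} → RG.Walk (RG.init v) cs → All (λ c → ∀ d y → Adj d (at c) y → Reach v y) cs → Full v
    closed⇒Full {v} {cs} walk closed = cs , walk , λ u → spread (lose (reachable∈walk det walk ε) refl) (conn g v u)
      where
      Seen : Node g → Set
      Seen u = Any (λ c → at c ≡ u) cs
      cross : ∀ {u d y} → Seen u → Adj d u y → Seen y
      cross {d = d} seen adj with c , m , refl ← find seen with c' , st , e ← lookupA closed m d _ adj =
        lose (reachable∈walk det walk st) e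
      spread : ∀ {u y} → Seen u → Star (λ a b → (∃[ σ ] out g a σ ≡ just b) ⊎ (∃[ σ ] out g b σ ≡ just a)) u y → Seen y
      spread seen ε = seen
      spread seen (inj₁ (σ , e) ◅ st) = spread (cross {d = fwd σ} seen e) st
      spread seen (inj₂ (σ , e) ◅ st) = spread (cross {d = bwd σ} seen e) st

    module _ {n : ℕ} {γ : Stack} (wf : Below n γ) (fits : (suc n + mG) + suc mG ≤ bound) where
      private
        fits₁ : suc n + mG ≤ bound
        fits₁ = ≤-trans (m≤m+n _ _) fits
        fits₂ : suc (suc n + mG) + mG ≤ bound
        fits₂ = ≤-trans (≤-reflexive (sym (+-suc (suc n + mG) mG))) fits
        wf₁ : ∀ {v} → Below (suc n) ((nm n , v) ∷ γ)
        wf₁ = Below-push wf (≤-trans (m≤m+n (suc n) mG) fits₁)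

      inspect-inv : ∀ {w b w' γ'} → Runs (inspect n) (w , γ) b (w' , γ')
        → γ' ≡ γ × lookup w' i₀ ≡ lookup w i₀ × b ≡ false × Full (lookup w i₀)
      inspect-inv {w} r with _ , _ , m₁ , r₁ ← bind-inv r
        with ex-drop _ ← prim-inv m₁
        with b , s₂ , m₂ , r₂ ← bind-inv r₁
        -- `⊥` as the meaning of success records that `around` never answers `true`, so the loop
        -- ended with `false` and supplies a complete walk.
        with v ← Partial.loop-inv (suc n) i₀ wf₁ fits₁ (around (suc n + mG) (nm n))
                   (λ v → ∀ d y → Adj d v y → Reach (lookup w i₀) y) ⊥
                   (λ wf' α⊆ r → case around-inv wf' fits₂ (α⊆ (here refl)) r of λ
                      { (e , e' , refl , f) → e , e' , (λ ()) , λ _ → f }) m₂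
        with refl ← Partial.Visited.restored v
        with _ , (w₃ , _) , m₃ , r₃ ← bind-inv r₂
        with refl , on , _ ← seek-inv wf₁ fits₁ m₃
        with _ , _ , m₄ , r₄ ← bind-inv r₃
        with ex-ret ← prim-inv m₄
        with refl , refl ← ret-inv r₄ = refl , func wf₁ on (here refl) , refl , full b (Partial.Visited.if-true v) (Partial.Visited.if-false v)
        where
        full : ∀ b → (b ≡ true → ⊥)
             → (b ≡ false → ∃[ cs ] RG.Walk (RG.init (lookup w i₀)) cs × All (λ c → ∀ d y → Adj d (at c) y → Reach (lookup w i₀) y) cs)
             → Full (lookup w i₀)
        full true  f _ = ⊥-elim (f refl)
        full false _ f with cs , walk , closed ← f refl = closed⇒Full walk closed

      inspect-run : (∀ v → Full v) → ∀ w → ∃[ w' ] Runs (inspect n) (w , γ) false (w' , γ) × lookup w' i₀ ≡ lookup w i₀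
      inspect-run full w with cs , walk , _ ← full (lookup w i₀)
        with Total.loop-spec (suc n) i₀ {α = (nm n , lookup w i₀) ∷ γ} wf₁ fits₁ (around (suc n + mG) (nm n)) det (λ _ → ⊤) (λ _ → ⊤) (λ _ → ⊥) (λ _ _ → tt)
               (λ w' γ' _ wf' α⊆ → case around-run wf' fits₂ (α⊆ (here refl)) full w' of λ
                  { (w″ , r , e) → inj₂ (w″ , r , e , tt , tt) }) {w} walk tt
      ... | inj₁ (_ , _ , ())
      ... | inj₂ (w₁ , r₁ , _) with w₂ , r₂ , e₂ , _ ← seek-run wf₁ fits₁ full {i₀} (here refl) w₁ =
        w₂ , bind-run (prim-run (ex-drop (fresh-Any wf ≤-refl (≤-trans (m≤m+n (suc n) mG) fits₁))))
               (bind-run r₁ (bind-run r₂ (bind-run (prim-run ex-ret) ret-run))) , e₂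

    module _ {n : ℕ} {α : Stack} (wf : Below n α) (fits : n + checkSize G ≤ bound) where
      private
        fits₁ : (suc (n + mG) + mG) + suc mG ≤ bound
        fits₁ = ≤-trans (≤-reflexive regroup) fits
          where
          regroup : (suc (n + mG) + mG) + suc mG ≡ n + (mG + (suc mG + suc mG))
          regroup = trans (cong (_+ suc mG) (sym (+-suc (n + mG) mG)))
                          (trans (+-assoc (n + mG) (suc mG) (suc mG)) (+-assoc n mG (suc mG + suc mG)))
        fits₀ : n + mG ≤ bound
        fits₀ = ≤-trans (+-monoʳ-≤ n (m≤m+n mG _)) fits

      -- The starting node of the outer walk is among the inspected ones, hence full. By determinism
      -- its full walk is the outer walk, so every node was inspected.
      check-inv : ∀ {w b w' α'} → Runs (check n) (w , α) b (w' , α') → α' ≡ α × b ≡ false × (∀ v → Full v)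
      check-inv {w} {b} {w'} {α'} r = V.restored , verdict b V.if-true V.if-false
        where
        visited : Partial.Visited n i₀ wf fits₀ (inspect (n + mG)) Full ⊥ _ (RG.init (lookup w i₀)) b (w' , α')
        visited = Partial.loop-inv n i₀ wf fits₀ (inspect (n + mG)) Full ⊥
          (λ wf' _ r → case inspect-inv wf' fits₁ r of λ { (e , e' , refl , f) → e , e' , (λ ()) , λ _ → f }) r
        module V = Partial.Visited visited
        verdict : ∀ b → (b ≡ true → ⊥) → (b ≡ false → ∃[ cs ] RG.Walk (RG.init (lookup w i₀)) cs × All (λ c → Full (at c)) cs)
                → b ≡ false × (∀ v → Full v)
        verdict true  f _ = ⊥-elim (f refl)
        verdict false _ f with cs , walk , fulls ← f refl
          with cs' , walk' , seen ← lookupA fulls (reachable∈walk det walk ε)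
          with refl ← Determinism.walk-det G g det walk walk' =
            refl , λ v → case find (seen v) of λ { (c , m , refl) → lookupA fulls m }

      check-run : (∀ v → Full v) → ∀ w → ∃[ w' ] Runs (check n) (w , α) false (w' , α)
      check-run full w with cs , walk , _ ← full (lookup w i₀)
        with Total.loop-spec n i₀ wf fits₀ (inspect (n + mG)) det (λ _ → ⊤) (λ _ → ⊤) (λ _ → ⊥) (λ _ _ → tt)
               (λ w' γ' _ wf' _ → case inspect-run wf' fits₁ full w' of λ { (w″ , r , e) → inj₂ (w″ , r , e , tt , tt) }) walk tt
      ... | inj₁ (_ , _ , ())
      ... | inj₂ (w₁ , r₁ , _) = w₁ , r₁

-- Evaluating formulas by nested searches.

module EvalSize (k : ℕ) {s : ℕ} (G : Automaton 1 s) where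
  open Automaton G using () renaming (nX to mG)

  -- The `mG` at zero guarantees room, whatever `c` is, for the search that returns the innermost
  -- head to its marker. Sums stand where maxima would be enough.
  huntSize : ℕ → ℕ → ℕ
  huntSize zero    c = mG + c
  huntSize (suc j) c = mG + suc (huntSize j c)

  followSize : ℕ → ℕ
  followSize c = k + huntSize k c

  evalSize : Formula s k → ℕ
  evalSize (lab σ x)   = mG
  evalSize (edg σ x y) = mG
  evalSize (eq x y)    = mG
  evalSize (neg φ)     = evalSize φ
  evalSize (and φ ψ)   = evalSize φ + evalSize ψ
  evalSize (or φ ψ)    = evalSize φ + evalSize ψ
  evalSize (ex x φ)    = huntSize 1 (evalSize φ)
  evalSize (all x φ)   = huntSize 1 (evalSize φ)
  -- `k` pebbles mark the current tuple and `k` the next one; above these, heads are placed (`mG`)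
  -- and steps of the orbit are computed.
  evalSize (tc xs ys φ us vs) = k + (k + (mG + followSize (evalSize φ)))

module Evaluation {k s nX' : ℕ} (i₀ : Fin k) (G : Automaton 1 s) (nm : ℕ → Fin (suc nX')) where
  open Search {k} {s} {nX'} i₀ G nm public
  open EvalSize k G public

  -- The pebble marking the value of each variable.
  Env : Set
  Env = ℕ → Fin nP

  bindE : Env → ℕ → Fin nP → Env
  bindE e x p y with x ≟ℕ y
  ... | yes _ = p
  ... | no _  = e y

  Slots : Set
  Slots = List (Fin k × ℕ)

  -- The order is reversed so that assigning along the list reproduces `updVec`, which writes its
  -- first variable last.
  slots : ∀ {j} → (Fin j → Fin k) → Vec ℕ j → Slots
  slots h []       = []
  slots h (x ∷ xs) = slots (h ∘ suc) xs ++L (h zero , x) ∷ []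

  -- Since `C` may move every head, head `i` must return to its marker before the guide can go on;
  -- on success it therefore rests on the witness.
  existsNode : ℕ → Fin k → Chart Bool → Chart Bool
  existsNode n i C = loop n i
    (prim (drop i (nm (n + mG))) >> bind finBool C
      (λ b → seek (suc (n + mG)) i (nm (n + mG)) >> prim (retrieve (nm (n + mG))) >> ret b))

  -- Success delivers the tuple itself: each level, once the inner ones are finished, puts its own
  -- head on its witness and leaves the other heads alone.
  hunt : ℕ → Env → Slots → (ℕ → Env → Chart Bool) → Chart Bool
  hunt n e []             cont = cont n e
  hunt n e ((i , x) ∷ is) cont =
    existsNode n i (hunt (suc (n + mG)) (bindE e x (nm (n + mG))) is cont)

  pin : ∀ {R : Set} → Finite R → ℕ → Env → Slots → (ℕ → Env → Chart R) → Chart R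
  pin fin n e []             body = body n e
  pin fin n e ((i , x) ∷ is) body = prim (drop i (nm n)) >>
    bind fin (pin fin (suc n) (bindE e x (nm n)) is body) (λ r → prim (retrieve (nm n)) >> ret r)

  gather : ℕ → Env → Vec ℕ k → List (Fin k) → Chart ⊤
  gather n e us []       = ret tt
  gather n e us (i ∷ is) = seek n i (e (lookup us i)) >> gather n e us is

  onPebbles : Env → Vec ℕ k → List (Fin k) → Chart Bool
  onPebbles e us []       = ret true
  onPebbles e us (i ∷ is) = cond (tst (pebT i (e (lookup us i)))) (onPebbles e us is) (ret false)

  module Closure (xs ys us vs : Vec ℕ k) (cont : ℕ → Env → Chart Bool) where
    follow : ℕ → Env → Chart Bool
    follow n e = pin finBool n e (slots id xs) λ n' e' → hunt n' e' (slots id ys) cont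

    fin⊤⊎Bool : Finite (⊤ ⊎ Bool)
    fin⊤⊎Bool = fin⊎ fin⊤ finBool

    -- The answer is true if the orbit meets the tuple marked by new before the one marked by old.
    rescan : ℕ → Env → Env → Env → Chart Bool
    rescan n e old new = iter fin⊤ (λ _ →
      cond (onPebbles new xs (allFinL k)) (ret (inj₂ true))
        (cond (onPebbles old xs (allFinL k)) (ret (inj₂ false))
          (bind finBool (follow n e) (λ _ → ret (inj₁ tt))))) tt

    -- A successor that already occurs on the orbit of us is detected by following the orbit once more.
    extend : ℕ → Env → Chart (⊤ ⊎ Bool)
    extend n e = pin fin⊤⊎Bool n e (slots id xs) λ n₁ old →
      cond (follow n₁ e)
        (pin fin⊤⊎Bool n₁ e (slots id xs) λ n₂ new → gather n₂ e us (allFinL k) >>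
          cond (rescan n₂ e old new) (ret (inj₂ false)) (gather n₂ new xs (allFinL k) >> ret (inj₁ tt)))
        (ret (inj₂ false))

    round′ : ℕ → Env → Chart (⊤ ⊎ Bool)
    round′ n e = cond (onPebbles e vs (allFinL k)) (ret (inj₂ true)) (extend n e)

    closure : ℕ → Env → Chart Bool
    closure n e = gather n e us (allFinL k) >> iter fin⊤ (λ _ → round′ n e) tt

  negate : Chart Bool → Chart Bool
  negate C = bind finBool C (ret ∘ not)

  eval : Formula s k → ℕ → Env → Chart Bool
  eval (lab σ x)   n e = seek n i₀ (e x) >> tst (labT i₀ σ)
  eval (edg σ x y) n e = seek n i₀ (e x) >> cond (tst (outedgeT i₀ σ)) (prim (outmove i₀ σ) >> tst (pebT i₀ (e y))) (ret false)
  eval (eq x y)    n e = seek n i₀ (e x) >> tst (pebT i₀ (e y))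
  eval (neg φ)     n e = negate (eval φ n e)
  eval (and φ ψ)   n e = cond (eval φ n e) (eval ψ n e) (ret false)
  eval (or φ ψ)    n e = cond (eval φ n e) (ret true) (eval ψ n e)
  eval (ex x φ)    n e = hunt n e ((i₀ , x) ∷ []) (eval φ)
  eval (all x φ)   n e = negate (hunt n e ((i₀ , x) ∷ []) (λ n' e' → negate (eval φ n' e')))
  eval (tc xs ys φ us vs) n e = Closure.closure xs ys us vs (eval φ) n e

  module EvalSpec (det : Deterministic G) (g : Graph s) (full : ∀ v → VisitsAll G g v)
    {bound : ℕ} (nm-inj : ∀ {a b} → a < bound → b < bound → nm a ≡ nm b → a ≡ b) where
    open SearchSpec det g nm-inj public
    open Valuations g

    Rep : Val g → Env → Stack → Set
    Rep ν e γ = ∀ x → (e x , ν x) ∈ γ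

    Rep-bind : ∀ {ν e γ p a} x → Rep ν e γ → Rep (upd g ν x a) (bindE e x p) ((p , a) ∷ γ)
    Rep-bind x rep y with x ≟ℕ y
    ... | yes _ = here refl
    ... | no _  = there (rep y)

    Rep-mono : ∀ {ν e γ γ'} → (∀ {p} → p ∈ γ → p ∈ γ') → Rep ν e γ → Rep ν e γ'
    Rep-mono sub rep x = sub (rep x)

    assign : Val g → Slots → Heads → Val g
    assign ν is w = foldl (λ ν' ix → upd g ν' (proj₂ ix) (lookup w (proj₁ ix))) ν is

    assign-slots : ∀ {j} (h : Fin j → Fin k) (xs : Vec ℕ j) {ν} w
      → assign ν (slots h xs) w ≡ updVec g ν xs (tabulate (lookup w ∘ h))
    assign-slots h []       w = refl
    assign-slots h (x ∷ xs) {ν} w = trans (foldl-∷ʳ _ ν (h zero , x) (slots (h ∘ suc) xs))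
      (cong (λ ν' → upd g ν' x (lookup w (h zero))) (assign-slots (h ∘ suc) xs w))

    assign-all : ∀ (xs : Vec ℕ k) {ν} w → assign ν (slots id xs) w ≡ updVec g ν xs w
    assign-all xs {ν} w = trans (assign-slots id xs w) (cong (updVec g ν xs) (tabulate∘lookup w))

    length-slots : ∀ {j} (h : Fin j → Fin k) (xs : Vec ℕ j) → length (slots h xs) ≡ j
    length-slots h []       = refl
    length-slots h (x ∷ xs) = trans (length-++ (slots (h ∘ suc) xs)) (trans (+-comm _ 1) (cong suc (length-slots (h ∘ suc) xs)))

    Apart : Slots → Set
    Apart = AllPairs (λ p q → proj₁ p ≢ proj₁ q)

    slots-heads : ∀ {j} (h : Fin j → Fin k) (xs : Vec ℕ j) → All (λ p → ∃[ i ] proj₁ p ≡ h i) (slots h xs)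
    slots-heads h []       = []
    slots-heads h (x ∷ xs) = tabulateA λ m → case ∈-++⁻ (slots (h ∘ suc) xs) m of λ
      { (inj₁ m') → case lookupA (slots-heads (h ∘ suc) xs) m' of λ { (i , e) → suc i , e }
      ; (inj₂ (here refl)) → zero , refl }

    slots-apart : ∀ {j} (h : Fin j → Fin k) (xs : Vec ℕ j) → (∀ {a b} → h a ≡ h b → a ≡ b) → Apart (slots h xs)
    slots-apart h []       inj = []
    slots-apart h (x ∷ xs) inj = AllPairsₚ.++⁺
      (slots-apart (h ∘ suc) xs (λ e → case inj e of λ { refl → refl })) ([] ∷ [])
      (tabulateA λ m → (λ e → case lookupA (slots-heads (h ∘ suc) xs) m of λ
        { (i , e') → case inj (trans (sym e') e) of λ () }) ∷ [])

    assign-off : ∀ is {i ν} w w' → All (λ p → i ≢ proj₁ p) is → Off i w w' → assign ν is w' ≡ assign ν is w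
    assign-off []             w w' []         off = refl
    assign-off ((j , x) ∷ is) {ν = ν} w w' (ne ∷ nes) off =
      trans (cong (λ z → assign (upd g ν x z) is w') (off j (ne ∘ sym))) (assign-off is w w' nes off)

    -- Only `Yes` sees the final heads: on success they may hold the tuple found.
    Decide : Chart Bool → Heads → Stack → (Heads → Set) → Set → Set
    Decide C w γ Yes No = (∃[ w' ] Runs C (w , γ) true (w' , γ) × Yes w') ⊎ (∃[ w' ] Runs C (w , γ) false (w' , γ) × No)

    fits-left : ∀ n a b → n + (a + b) ≤ bound → n + a ≤ bound
    fits-left n a b = ≤-trans (+-monoʳ-≤ n (m≤m+n a b))

    fits-right : ∀ n a b → n + (a + b) ≤ bound → n + b ≤ bound
    fits-right n a b = ≤-trans (+-monoʳ-≤ n (m≤n+m b a))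

    module _ {n : ℕ} {γ : Stack} (wf : Below n γ) (fits : n + mG ≤ bound) where
      still : ∀ (ν : Val g) (us : Vec ℕ k) {i is} (w w₁ : Heads) → (∀ j → j ∈ (i ∷ is) ⊎ lookup w j ≡ ν (lookup us j)) → lookup w₁ i ≡ ν (lookup us i)
        → Off i w w₁ → ∀ j → j ∈ is ⊎ lookup w₁ j ≡ ν (lookup us j)
      still ν us {i} w w₁ placed e off j with j ≟F i
      ... | yes refl = inj₂ e
      ... | no ne with placed j
      ... | inj₁ (here e')  = contradiction e' ne
      ... | inj₁ (there m) = inj₁ m
      ... | inj₂ e'        = inj₂ (trans (off j ne) e')

      gather-run : ∀ {ν e} us → Rep ν e γ → ∀ is w → (∀ i → i ∈ is ⊎ lookup w i ≡ ν (lookup us i))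
        → ∃[ w' ] Runs (gather n e us is) (w , γ) tt (w' , γ) × (∀ i → lookup w' i ≡ ν (lookup us i))
      gather-run us rep [] w placed = w , ret-run , λ i → case placed i of λ { (inj₂ e) → e }
      gather-run {ν} us rep (i ∷ is) w placed
        with w₁ , r₁ , e₁ , off ← seek-run wf fits full {i} (rep (lookup us i)) w
        with w₂ , r₂ , e₂ ← gather-run us rep is w₁ (still ν us w w₁ placed e₁ off) = w₂ , bind-run r₁ r₂ , e₂

      gather-all : ∀ {ν e} us → Rep ν e γ → ∀ w → Runs (gather n e us (allFinL k)) (w , γ) tt (mapV ν us , γ)
      gather-all {ν} us rep w with w' , r , e ← gather-run us rep (allFinL k) w (inj₁ ∘ ∈-allFin)
        with refl ← vec-ext {xs = w'} {mapV ν us} (λ i → trans (e i) (sym (lookup-map i ν us))) = r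

    onPebbles-run : ∀ {n γ ν e} → Below n γ → ∀ us → Rep ν e γ → ∀ is w
      → (Runs (onPebbles e us is) (w , γ) true (w , γ) × (∀ i → i ∈ is → lookup w i ≡ ν (lookup us i)))
        ⊎ (Runs (onPebbles e us is) (w , γ) false (w , γ) × (∃[ i ] lookup w i ≢ ν (lookup us i)))
    onPebbles-run wf us rep [] w = inj₁ (ret-run , λ _ ())
    onPebbles-run {γ = γ} {e = e} wf us rep (i ∷ is) w with holds? (pebT i (e (lookup us i))) w γ
    ... | no ¬h = inj₂ (bind-run (tst-no ¬h) ret-run , i , λ e' → ¬h (subst (λ z → (e (lookup us i) , z) ∈ γ) (sym e') (rep (lookup us i))))
    ... | yes h with onPebbles-run wf us rep is w
    ... | inj₂ (r , ne) = inj₂ (bind-run (tst-yes h) r , ne)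
    ... | inj₁ (r , f)  = inj₁ (bind-run (tst-yes h) r , λ { _ (here refl) → func wf h (rep _) ; j (there m) → f j m })

    onPebbles-all : ∀ {n γ ν e} → Below n γ → ∀ us → Rep ν e γ → ∀ w
      → (Runs (onPebbles e us (allFinL k)) (w , γ) true (w , γ) × w ≡ mapV ν us)
        ⊎ (Runs (onPebbles e us (allFinL k)) (w , γ) false (w , γ) × w ≢ mapV ν us)
    onPebbles-all {ν = ν} wf us rep w with onPebbles-run wf us rep (allFinL k) w
    ... | inj₁ (r , f) = inj₁ (r , vec-ext (λ i → trans (f i (∈-allFin i)) (sym (lookup-map i ν us))))
    ... | inj₂ (r , i , ne) = inj₂ (r , λ { refl → ne (lookup-map i ν us) })

    pin-run : ∀ {R : Set} {fin : Finite R} {body : ℕ → Env → Chart R} {c} is {n e γ ν w} {Q : R → Heads → Set}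
      → Below n γ → Rep ν e γ → n + (length is + c) ≤ bound
      → (∀ {n' e' γ'} → Below n' γ' → (∀ {p} → p ∈ γ → p ∈ γ') → Rep (assign ν is w) e' γ' → n' + c ≤ bound
           → ∃₂ λ r w' → Runs (body n' e') (w , γ') r (w' , γ') × Q r w')
      → ∃₂ λ r w' → Runs (pin fin n e is body) (w , γ) r (w' , γ) × Q r w'
    pin-run [] wf rep fits go = go wf id rep fits
    pin-run {c = c} ((i , x) ∷ is) {n} wf rep fits go
      with fits' ← ≤-trans (≤-reflexive (sym (+-suc n (length is + c)))) fits
      with n<b ← ≤-trans (m≤m+n (suc n) _) fits'
      with r , w' , run , q ← pin-run is (Below-push wf n<b) (Rep-bind x rep) fits'
             (λ wf' sub rep' fits″ → go wf' (sub ∘ there) rep' fits″) =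
        r , w' , bind-run (prim-run (ex-drop (fresh-Any wf ≤-refl n<b)))
                   (bind-run run (bind-run (prim-run ex-ret) ret-run)) , q

    module _ {cont : ℕ → Env → Chart Bool} {c : ℕ} {P N : Val g → Set}
      (cont-spec : ∀ {n e γ ν} → Below n γ → Rep ν e γ → n + c ≤ bound → ∀ w → Decide (cont n e) w γ (λ _ → P ν) (N ν)) where

      -- A failed loop knows, for each visited node, that `N` holds of every tuple with head `i`
      -- there; as the walk visits all nodes, all tuples are covered. After a success the closing
      -- search moves only head `i`, which no inner slot uses, so the inner witnesses stay in place.
      hunt-spec : ∀ is {n e γ ν} → Apart is → Below n γ → Rep ν e γ → n + huntSize (length is) c ≤ bound → ∀ w
        → Decide (hunt n e is cont) w γ (λ w' → P (assign ν is w')) (∀ v → N (assign ν is v))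
      hunt-spec [] {n} _ wf rep fits w with cont-spec wf rep (fits-right n mG c fits) w
      ... | inj₁ yes′ = inj₁ yes′
      ... | inj₂ (w' , r , ¬p) = inj₂ (w' , r , λ _ → ¬p)
      hunt-spec ((i , x) ∷ is) {n} {e} {γ} {ν} (apart ∷ aparts) wf rep fits w
        with cs , walk , all-visited ← full (lookup w i)
        with Total.loop-spec n i wf (fits-left n mG _ fits) _ det (λ _ → ⊤)
               (λ v → ∀ w₁ → lookup w₁ i ≡ v → N (assign ν ((i , x) ∷ is) w₁))
               (λ w₁ → P (assign ν ((i , x) ∷ is) w₁)) (λ _ _ → tt) trial walk tt
        where
        fits′ : suc (n + mG) + huntSize (length is) c ≤ bound
        fits′ = ≤-trans (≤-reflexive (trans (sym (+-suc (n + mG) _)) (+-assoc n mG _))) fits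
        seekFits : suc (n + mG) + mG ≤ bound
        seekFits = ≤-trans (+-monoʳ-≤ (suc (n + mG)) (atLeast (length is))) fits′
          where
          atLeast : ∀ j → mG ≤ huntSize j c
          atLeast zero    = m≤m+n mG c
          atLeast (suc j) = m≤m+n mG _
        n<b : n + mG < bound
        n<b = ≤-trans (m≤m+n _ _) fits′
        trial : ∀ w₁ γ₁ → ⊤ → Below (n + mG) γ₁ → (∀ {p} → p ∈ γ → p ∈ γ₁) → _
        trial w₁ γ₁ _ wf₁ sub
          with hunt-spec is aparts (Below-push {v = lookup w₁ i} wf₁ n<b) (Rep-bind x (Rep-mono sub rep)) fits′ w₁
        ... | inj₁ (w₂ , r₂ , p) with w₃ , r₃ , e₃ , off ← seek-run (Below-push wf₁ n<b) seekFits full {i} (here refl) w₂ =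
          inj₁ (w₃ , bind-run (prim-run (ex-drop (fresh-Any wf₁ ≤-refl n<b))) (bind-run r₂ (bind-run r₃ (bind-run (prim-run ex-ret) ret-run)))
               , subst P (sym (trans (cong (λ z → assign (upd g ν x z) is w₃) e₃) (assign-off is w₂ w₃ apart off))) p)
        ... | inj₂ (w₂ , r₂ , ¬p) with w₃ , r₃ , e₃ , off ← seek-run (Below-push wf₁ n<b) seekFits full {i} (here refl) w₂ =
          inj₂ (w₃ , bind-run (prim-run (ex-drop (fresh-Any wf₁ ≤-refl n<b))) (bind-run r₂ (bind-run r₃ (bind-run (prim-run ex-ret) ret-run)))
               , e₃ , tt , λ v e → subst (λ z → N (assign (upd g ν x z) is v)) (sym e) (¬p v))
      ... | inj₁ yes′ = inj₁ yes′
      ... | inj₂ (w' , r , nos) = inj₂ (w' , r , λ v → case find (all-visited (lookup v i)) of λ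
              { (c , m , e') → lookupA nos m v (sym e') })

-- Correctness of the evaluation.

module Correctness {k s nX' : ℕ} (i₀ : Fin k) (G : Automaton 1 s) (nm : ℕ → Fin (suc nX'))
  (det : Deterministic G) (g : Graph s) (full : ∀ v → VisitsAll G g v)
  {bound : ℕ} (nm-inj : ∀ {a b} → a < bound → b < bound → nm a ≡ nm b → a ≡ b) where
  open Evaluation {k} {s} {nX'} i₀ G nm
  open EvalSpec det g full nm-inj
  open Valuations g

  Decides : (ℕ → Env → Chart Bool) → ℕ → (Val g → Set) → Set
  Decides cont c P = ∀ {n e γ ν} → Below n γ → Rep ν e γ → n + c ≤ bound → ∀ w → Decide (cont n e) w γ (λ _ → P ν) (¬ P ν)

  module _ (xs ys us vs : Vec ℕ k) {cont : ℕ → Env → Chart Bool} {c : ℕ} {P : Val g → Set} (cont-spec : Decides cont c P)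
    (distinct : Unique (toList xs)) (ν : Val g) where
    open Closure xs ys us vs cont

    Next : Heads → Heads → Set
    Next as bs = P (updVec g (updVec g ν xs as) ys bs)

    module _ (functional : ∀ {a b b'} → Next a b → Next a b' → b ≡ b') where
      open Orbit Next

      follow-spec : ∀ {n e γ} → Below n γ → Rep ν e γ → n + followSize c ≤ bound → ∀ w
        → Decide (follow n e) w γ (Next w) (∀ b → ¬ Next w b)
      follow-spec {n} {e} {γ} wf rep fits w
        with pin-run {fin = finBool} {body = λ n' e' → hunt n' e' (slots id ys) cont} {c = huntSize k c} (slots id xs) {w = w}
               {Q = λ r w' → (r ≡ true × Next w w') ⊎ (r ≡ false × ∀ b → ¬ Next w b)} wf rep
               (subst (λ j → n + (j + huntSize k c) ≤ bound) (sym (length-slots id xs)) fits) go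
        where
        through : ∀ v → assign (assign ν (slots id xs) w) (slots id ys) v ≡ updVec g (updVec g ν xs w) ys v
        through v = trans (assign-all ys v) (cong (λ ν' → updVec g ν' ys v) (assign-all xs w))
        go : ∀ {n' e' γ'} → Below n' γ' → (∀ {p} → p ∈ γ → p ∈ γ') → Rep (assign ν (slots id xs) w) e' γ' → n' + huntSize k c ≤ bound
           → ∃₂ λ r w' → Runs (hunt n' e' (slots id ys) cont) (w , γ') r (w' , γ')
                × ((r ≡ true × Next w w') ⊎ (r ≡ false × ∀ b → ¬ Next w b))
        go {n'} wf' _ rep' fits'
          with hunt-spec cont-spec (slots id ys) (slots-apart id ys id) wf' rep'
                 (subst (λ j → n' + huntSize j c ≤ bound) (sym (length-slots id ys)) fits') w
        ... | inj₁ (w' , r , p)  = true , w' , r , inj₁ (refl , subst P (through w') p)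
        ... | inj₂ (w' , r , ¬p) = false , w' , r , inj₂ (refl , λ b p → ¬p b (subst P (sym (through b)) p))
      ... | _ , w' , r , inj₁ (refl , p)  = inj₁ (w' , r , p)
      ... | _ , w' , r , inj₂ (refl , ¬p) = inj₂ (w' , r , ¬p)

      -- The path shows that the orbit arrives at the old tuple, and its length bounds the loop. As
      -- `l` has no repetition, the old tuple occurs only at its end, so stopping there scans
      -- exactly `l`.
      rescan-spec : ∀ {n e old new γ νₒ νₙ} → Below n γ → Rep ν e γ → Rep νₒ old γ → Rep νₙ new γ → n + followSize c ≤ bound
        → ∀ {d l} → Path d (mapV νₒ xs) l → Unique l
        → Decide (rescan n e old new) d γ (λ _ → mapV νₙ xs ∈ l) (mapV νₙ xs ∉ l)
      rescan-spec {n} {e} {old} {new} {γ} {νₒ} {νₙ} wf rep repₒ repₙ fits path unique = wrap (scan path unique)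
        where
        stage : Chart (⊤ ⊎ Bool)
        stage = cond (onPebbles new xs (allFinL k)) (ret (inj₂ true))
          (cond (onPebbles old xs (allFinL k)) (ret (inj₂ false)) (bind finBool (follow n e) (λ _ → ret (inj₁ tt))))
        Trace′ : Heads → Bool → Heads → Set
        Trace′ d b w' = Trace fin⊤ (λ _ → stage) (λ _ → id) tt (d , γ) b (w' , γ)
        wrap : ∀ {d l} → (∃[ w' ] Trace′ d true w' × mapV νₙ xs ∈ l) ⊎ (∃[ w' ] Trace′ d false w' × mapV νₙ xs ∉ l)
             → Decide (rescan n e old new) d γ (λ _ → mapV νₙ xs ∈ l) (mapV νₙ xs ∉ l)
        wrap (inj₁ (w' , t , p)) = inj₁ (w' , iter-run t , p)
        wrap (inj₂ (w' , t , p)) = inj₂ (w' , iter-run t , p)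
        scan : ∀ {d l} → Path d (mapV νₒ xs) l → Unique l
             → (∃[ w' ] Trace′ d true w' × mapV νₙ xs ∈ l) ⊎ (∃[ w' ] Trace′ d false w' × mapV νₙ xs ∉ l)
        -- Testing the new tuple first matters when the current tuple is its own successor: both
        -- marks coincide, and the answer has to be `true`.
        scan {d} p u with onPebbles-all wf xs repₙ d
        ... | inj₁ (r , refl) = inj₁ (d , stop (bind-run r ret-run) refl , path-start p)
        ... | inj₂ (r , ≢new) with onPebbles-all wf xs repₒ d
        scan end u | inj₂ (r , ≢new) | inj₁ (r' , _) =
          inj₂ (_ , stop (bind-run r (bind-run r' ret-run)) refl , λ { (here e) → ≢new (sym e) })
        scan (cons _ p) (x∉ ∷ _) | inj₂ _ | inj₁ (_ , e') = contradiction e' (lookupA x∉ (path-end p))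
        scan end u | inj₂ _ | inj₂ (_ , ≢old) = contradiction refl ≢old
        scan {d} (cons q p) (x∉ ∷ u) | inj₂ (r , ≢new) | inj₂ (r' , _) with follow-spec wf rep fits d
        ... | inj₂ (_ , _ , none′) = contradiction q (none′ _)
        ... | inj₁ (w' , r″ , q') with refl ← functional q q' with scan p u
        ... | inj₁ (w″ , t , m) = inj₁ (w″ , more (bind-run r (bind-run r' (bind-run r″ ret-run))) refl t , there m)
        ... | inj₂ (w″ , t , ∉l) = inj₂ (w″ , more (bind-run r (bind-run r' (bind-run r″ ret-run))) refl t
                                        , λ { (here e) → ≢new (sym e) ; (there m) → ∉l m })

      module _ {n e γ} (wf : Below n γ) (rep : Rep ν e γ) (fits : n + (k + (k + (mG + followSize c))) ≤ bound) where

        -- `inj₂ false` covers a tuple without successor as well as a successor already in `l`; in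
        -- both cases `l` is the whole orbit.
        Extended : Heads → List Heads → ⊤ ⊎ Bool → Heads → Set
        Extended cur l r w' = (r ≡ inj₁ tt × Next cur w' × w' ∉ l) ⊎ (r ≡ inj₂ false × (∀ {y} → Next cur y → y ∈ l))

        marked : ∀ {w} → mapV (assign ν (slots id xs) w) xs ≡ w
        marked {w} = trans (cong (λ ν' → mapV ν' xs) (assign-all xs w)) (updVec-self xs distinct)

        extend-spec : ∀ {cur l} → Path (mapV ν us) cur l → Unique l
          → ∃₂ λ r w' → Runs (extend n e) (cur , γ) r (w' , γ) × Extended cur l r w'
        extend-spec {cur} {l} path unique =
          pin-run (slots id xs) wf rep (subst (λ j → n + (j + (k + (mG + followSize c))) ≤ bound) (sym (length-slots id xs)) fits) outer
          where
          outer : ∀ {n₁ old γ₁} → Below n₁ γ₁ → (∀ {p} → p ∈ γ → p ∈ γ₁) → Rep (assign ν (slots id xs) cur) old γ₁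
            → n₁ + (k + (mG + followSize c)) ≤ bound → ∃₂ λ r w' → Runs _ (cur , γ₁) r (w' , γ₁) × Extended cur l r w'
          outer {n₁} {old} {γ₁} wf₁ sub₁ rep₁ fits₁
            with follow-spec wf₁ (Rep-mono sub₁ rep) (fits-right n₁ mG _ (≤-trans (+-monoʳ-≤ n₁ (m≤n+m _ k)) fits₁)) cur
          ... | inj₂ (w' , r , none′) = inj₂ false , w' , bind-run r ret-run , inj₂ (refl , λ q → contradiction q (none′ _))
          ... | inj₁ (nxt , r , q)
            with pin-run (slots id xs) {w = nxt} {Q = Extended cur l} wf₁ (Rep-mono sub₁ rep)
                   (subst (λ j → n₁ + (j + (mG + followSize c)) ≤ bound) (sym (length-slots id xs)) fits₁) inner
            where
            inner : ∀ {n₂ new γ₂} → Below n₂ γ₂ → (∀ {p} → p ∈ γ₁ → p ∈ γ₂) → Rep (assign ν (slots id xs) nxt) new γ₂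
              → n₂ + (mG + followSize c) ≤ bound → ∃₂ λ r w' → Runs _ (nxt , γ₂) r (w' , γ₂) × Extended cur l r w'
            inner {n₂} wf₂ sub₂ rep₂ fits₂
              with r₁ ← gather-all wf₂ (fits-left n₂ mG _ fits₂) us (Rep-mono (sub₂ ∘ sub₁) rep) nxt
              with rescan-spec wf₂ (Rep-mono (sub₂ ∘ sub₁) rep) (Rep-mono sub₂ rep₁) rep₂ (fits-right n₂ mG _ fits₂)
                     (subst (λ z → Path (mapV ν us) z l) (sym marked) path) unique
            ... | inj₁ (w' , r , m) = inj₂ false , w' , bind-run r₁ (bind-run r ret-run)
                , inj₂ (refl , λ q' → subst (_∈ l) (trans marked (functional q q')) m)
            ... | inj₂ (w' , r , ∉l) = inj₁ tt , nxt
                , bind-run r₁ (bind-run r (bind-run (subst (λ z → Runs (gather n₂ _ xs (allFinL k)) (w' , _) tt (z , _)) marked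
                    (gather-all wf₂ (fits-left n₂ mG _ fits₂) xs rep₂ w')) ret-run))
                , inj₁ (refl , q , subst (_∉ l) marked ∉l)
          ... | r₂ , w₂ , run₂ , ext = r₂ , w₂ , bind-run r run₂ , ext

        finHeads : Finite Heads
        finHeads = finVec finFin k

        Reached : Set
        Reached = Star Next (mapV ν us) (mapV ν vs)

        Trace″ : Heads → Bool → Heads → Set
        Trace″ d b w' = Trace fin⊤ (λ _ → round′ n e) (λ _ → id) tt (d , γ) b (w' , γ)

        -- The tuples met so far never repeat, so their number is at most the number of all tuples;
        -- `fuel` measures the difference and exists only in the proof. `missed` remembers that no
        -- earlier tuple was the goal, which refutes reachability when the orbit is exhausted.
        close : ∀ fuel {cur l} → Finite.size finHeads ≤ length l + fuel → Path (mapV ν us) cur l → Unique l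
          → (∀ {x} → x ∈ l → x ≢ cur → x ≢ mapV ν vs)
          → (∃[ w' ] Trace″ cur true w' × Reached) ⊎ (∃[ w' ] Trace″ cur false w' × ¬ Reached)
        close fuel {cur} {l} enough path unique missed with onPebbles-all wf vs rep cur
        ... | inj₁ (r , refl) = inj₁ (cur , stop (bind-run r ret-run) refl , path-star path)
        ... | inj₂ (r , ≢goal) with extend-spec path unique
        ... | _ , w' , r' , inj₂ (refl , last) =
          inj₂ (w' , stop (bind-run r r') refl , λ st → missed′ (orbit⊆path functional path last st) refl)
          where
          missed′ : ∀ {x} → x ∈ l → x ≢ mapV ν vs
          missed′ {x} m with ≡-decV _≟F_ x cur
          ... | yes refl = ≢goal
          ... | no ne    = missed m ne
        ... | _ , nxt , r' , inj₁ (refl , q , ∉l) with fuel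
        ... | zero = contradiction (Unique⇒length≤size finHeads (Unique-snoc unique ∉l))
                       (λ le → <-irrefl refl (≤-trans (≤-reflexive (trans (+-comm 1 _) (sym (length-++ l)))) (≤-trans le (≤-trans enough (≤-reflexive (+-identityʳ _))))))
        ... | suc fuel'
          with close fuel' (≤-trans enough (≤-reflexive (trans (sym (+-assoc (length l) 1 fuel')) (cong (_+ fuel') (sym (length-++ l))))))
                 (path-snoc path q) (Unique-snoc unique ∉l) missed″
          where
          missed″ : ∀ {x} → x ∈ l ++L nxt ∷ [] → x ≢ nxt → x ≢ mapV ν vs
          missed″ {x} m ne with ∈-++⁻ l m
          ... | inj₂ (here e) = contradiction e ne
          ... | inj₁ m' with ≡-decV _≟F_ x cur
          ... | yes refl = ≢goal
          ... | no ne′   = missed m' ne′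
        ... | inj₁ (w' , t , p)  = inj₁ (w' , more (bind-run r r') refl t , p)
        ... | inj₂ (w' , t , ¬p) = inj₂ (w' , more (bind-run r r') refl t , ¬p)

        closure-spec : ∀ w → Decide (closure n e) w γ (λ _ → Reached) (¬ Reached)
        closure-spec w
          with r ← gather-all wf (≤-trans (+-monoʳ-≤ n (≤-trans (m≤m+n mG _) (≤-trans (m≤n+m _ k) (m≤n+m _ k)))) fits) us rep w
          with close (Finite.size finHeads) (m≤n+m _ 1) end ([] ∷ []) (λ { (here e') ne → contradiction e' ne })
        ... | inj₁ (w' , t , p)  = inj₁ (w' , bind-run r (iter-run t) , p)
        ... | inj₂ (w' , t , ¬p) = inj₂ (w' , bind-run r (iter-run t) , ¬p)

  negate-spec : ∀ {C w γ} {P N : Set} → Decide C w γ (λ _ → P) N → Decide (negate C) w γ (λ _ → N) P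
  negate-spec (inj₁ (w' , r , p)) = inj₂ (w' , bind-run r ret-run , p)
  negate-spec (inj₂ (w' , r , n)) = inj₁ (w' , bind-run r ret-run , n)

  eval-spec : ∀ φ → IsDTC φ → Decides (eval φ) (evalSize φ) (Sat g φ)
  eval-spec (lab σ x) _ wf rep fits w with w₁ , r , on , _ ← seek-run wf fits full {i₀} (rep x) w
    with nlab g (lookup w₁ i₀) ≟F σ
  ... | yes h = inj₁ (w₁ , bind-run r (tst-yes h) , trans (cong (nlab g) (sym on)) h)
  ... | no ¬h = inj₂ (w₁ , bind-run r (tst-no ¬h) , ¬h ∘ trans (cong (nlab g) on))
  eval-spec (edg σ x y) _ {e = e} {γ} {ν} wf rep fits w with w₁ , r , on , _ ← seek-run wf fits full {i₀} (rep x) w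
    with holds? (outedgeT i₀ σ) w₁ γ
  ... | no ¬h = inj₂ (w₁ , bind-run r (bind-run (tst-no ¬h) ret-run)
                     , λ h → ¬h (_ , trans (cong (λ z → out g z σ) on) h))
  ... | yes h@(v , edge) with holds? (pebT i₀ (e y)) (w₁ [ i₀ ]≔ v) γ
  ... | yes h' = inj₁ (_ , bind-run r (bind-run (tst-yes h) (bind-run (prim-run (ex-out edge)) (tst-yes h')))
                      , trans (cong (λ z → out g z σ) (sym on)) (trans edge (cong just
                          (trans (sym (lookup∘update i₀ w₁ v)) (func wf h' (rep y))))))
  ... | no ¬h' = inj₂ (_ , bind-run r (bind-run (tst-yes h) (bind-run (prim-run (ex-out edge)) (tst-no ¬h')))
                      , λ sat → ¬h' (subst (λ z → (e y , z) ∈ γ)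
                          (trans (just-injective (trans (sym sat) (trans (cong (λ z → out g z σ) (sym on)) edge))) (sym (lookup∘update i₀ w₁ v))) (rep y)))
  eval-spec (eq x y) _ {e = e} {γ} {ν} wf rep fits w with w₁ , r , on , _ ← seek-run wf fits full {i₀} (rep x) w
    with holds? (pebT i₀ (e y)) w₁ γ
  ... | yes h = inj₁ (w₁ , bind-run r (tst-yes h) , trans (sym on) (func wf h (rep y)))
  ... | no ¬h = inj₂ (w₁ , bind-run r (tst-no ¬h) , λ sat → ¬h (subst (λ z → (e y , z) ∈ γ) (trans (sym sat) (sym on)) (rep y)))
  eval-spec (neg φ) d wf rep fits w with negate-spec (eval-spec φ d wf rep fits w)
  ... | inj₁ yes′ = inj₁ yes′
  ... | inj₂ (w' , r , p) = inj₂ (w' , r , λ ¬p → ¬p p)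
  eval-spec (and φ ψ) (d , d') {n} wf rep fits w with eval-spec φ d wf rep (fits-left n _ _ fits) w
  ... | inj₂ (w₁ , r , ¬p) = inj₂ (w₁ , bind-run r ret-run , ¬p ∘ proj₁)
  ... | inj₁ (w₁ , r , p) with eval-spec ψ d' wf rep (fits-right n (evalSize φ) _ fits) w₁
  ... | inj₁ (w₂ , r' , p')  = inj₁ (w₂ , bind-run r r' , p , p')
  ... | inj₂ (w₂ , r' , ¬p') = inj₂ (w₂ , bind-run r r' , ¬p' ∘ proj₂)
  eval-spec (or φ ψ) (d , d') {n} wf rep fits w with eval-spec φ d wf rep (fits-left n _ _ fits) w
  ... | inj₁ (w₁ , r , p) = inj₁ (w₁ , bind-run r ret-run , inj₁ p)
  ... | inj₂ (w₁ , r , ¬p) with eval-spec ψ d' wf rep (fits-right n (evalSize φ) _ fits) w₁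
  ... | inj₁ (w₂ , r' , p')  = inj₁ (w₂ , bind-run r r' , inj₂ p')
  ... | inj₂ (w₂ , r' , ¬p') = inj₂ (w₂ , bind-run r r' , [ ¬p , ¬p' ]′)
  eval-spec (ex x φ) d wf rep fits w with hunt-spec (eval-spec φ d) ((i₀ , x) ∷ []) ([] ∷ []) wf rep fits w
  ... | inj₁ (w' , r , p)  = inj₁ (w' , r , _ , p)
  -- Failure speaks of head tuples, so the node `a` is presented as head `i₀` of a constant tuple.
  ... | inj₂ (w' , r , ¬p) = inj₂ (w' , r , λ { (a , p) → ¬p (replicate k a)
          (subst (λ z → Sat g φ (upd g _ x z)) (sym (lookup-replicate i₀ a)) p) })
  eval-spec (all x φ) d {ν = ν} wf rep fits w
    -- The failure side of `hunt-spec` is an arbitrary predicate, so a failed hunt for a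
    -- counterexample gives `Sat g φ` itself at each node rather than its double negation.
    with hunt-spec (λ wf rep fits w → negate-spec (eval-spec φ d wf rep fits w)) ((i₀ , x) ∷ []) ([] ∷ []) wf rep fits w
  ... | inj₁ (w' , r , ¬p) = inj₂ (w' , bind-run r ret-run , λ f → ¬p (f _))
  ... | inj₂ (w' , r , p)  = inj₁ (w' , bind-run r ret-run , λ a →
          subst (λ z → Sat g φ (upd g ν x z)) (lookup-replicate i₀ a) (p (replicate k a)))
  eval-spec (tc xs ys φ us vs) (unique , functional , d) {ν = ν} wf rep fits w =
    closure-spec xs ys us vs (eval-spec φ d) (Unique-++ˡ xs unique) ν (functional g ν _ _ _) wf rep fits w

-- The automaton of a formula.

module Program {s k nX' : ℕ} (i₀ : Fin k) (G : Automaton 1 s) (det : Deterministic G) (nm : ℕ → Fin (suc nX'))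
  {bound : ℕ} (nm-inj : ∀ {a b} → a < bound → b < bound → nm a ≡ nm b → a ≡ b)
  (φ : Formula s k) (dtc : IsDTC φ) (closed : Closed φ) (fits : 1 + (checkSize G + EvalSize.evalSize k G φ) ≤ bound) where

  open Evaluation {k} {s} {nX'} i₀ G nm

  -- All variables are initially marked by the pebble on the starting node, which is harmless
  -- because the formula is closed.
  program : Chart Bool
  program = prim (drop i₀ (nm 0)) >> bind finBool (check 1) (λ _ →
    bind finBool (eval φ 1 (λ _ → nm 0)) (λ b → prim (retrieve (nm 0)) >> ret b))

  module A = ToAutomaton {k} {s} {nX'} i₀

  module _ (g : Graph s) where
    open SearchSpec det g nm-inj

    wf : ∀ {v} → Below 1 ((nm 0 , v) ∷ [])
    wf = Below-push Below-[] (≤-trans (s≤s z≤n) fits)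

    checkFits : 1 + checkSize G ≤ bound
    checkFits = ≤-trans (s≤s (m≤m+n (checkSize G) _)) fits

    evaluate : (∀ v → VisitsAll G g v) → ∀ u w →
      (∃[ w' ] Runs (eval φ 1 (λ _ → nm 0)) (w , (nm 0 , u) ∷ []) true (w' , (nm 0 , u) ∷ []) × Sat g φ (λ _ → u))
      ⊎ (∃[ w' ] Runs (eval φ 1 (λ _ → nm 0)) (w , (nm 0 , u) ∷ []) false (w' , (nm 0 , u) ∷ []) × ¬ Sat g φ (λ _ → u))
    evaluate full u w = Correctness.eval-spec i₀ G nm det g full nm-inj φ dtc wf (λ _ → here refl) (≤-trans (s≤s (m≤n+m _ (checkSize G))) fits) w

    -- Inverting the check proves the guide full. Evaluation is then total, and `big-det` rules out
    -- that the given run answered `true` while the specified one answers `false`.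
    program-sound : ∀ {w w'} → Runs program (w , []) true (w' , []) → (∀ v → VisitsAll G g v) × Sat g φ (λ _ → lookup w i₀)
    program-sound {w} r
      with _ , _ , r₁ , r₂ ← bind-inv r
      with ex-drop _ ← prim-inv r₁
      with _ , _ , r₃ , r₄ ← bind-inv r₂
      with refl , _ , full ← check-inv wf checkFits r₃
      with b , s₁ , r₅ , r₆ ← bind-inv r₄
      with _ , _ , _ , r₇ ← bind-inv r₆
      with refl , _ ← ret-inv r₇
      with evaluate full (lookup w i₀) _
    ... | inj₁ (_ , _ , sat) = full , sat
    ... | inj₂ (_ , r₅' , _) with () ← big-det r₅ r₅'

    program-complete : (∀ v → VisitsAll G g v) → ∀ w → Sat g φ (λ _ → lookup w i₀) → ∃[ w' ] Runs program (w , []) true (w' , [])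
    program-complete full w sat
      with w₁ , r₁ ← check-run {α = (nm 0 , lookup w i₀) ∷ []} wf checkFits full w
      with evaluate full (lookup w i₀) w₁
    ... | inj₂ (_ , _ , ¬sat) = contradiction sat ¬sat
    ... | inj₁ (w₂ , r₂ , _) =
      w₂ , bind-run (prim-run (ex-drop λ ())) (bind-run r₁ (bind-run r₂ (bind-run (prim-run ex-ret) ret-run)))

    sat-anywhere : ∀ {u v} → Sat g φ (λ _ → u) → Sat g φ (λ _ → v)
    sat-anywhere = Valuations.coincidence g φ (λ x f → contradiction f (closed x))

    -- The conclusion does not mention `u`. Together with `acc⇐` this gives `WellBehaved` on every
    -- graph, inside the family or not.
    acc⇒ : ∀ {u} → Run.Acc (A.automaton program) g u → (∀ v → VisitsAll G g v) × g ⊨ φ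
    acc⇒ acc with w' , r ← A.Acc⇒Runs program g acc with full , sat ← program-sound r = full , sat-anywhere sat

    acc⇐ : (∀ v → VisitsAll G g v) → g ⊨ φ → ∀ u → Run.Acc (A.automaton program) g u
    acc⇐ full sat u with w' , r ← program-complete full (replicate k u) (sat-anywhere sat) = A.Runs⇒Acc program g r

  compile : (F : Graph s → Set) → (∀ g → F g → ∀ v → VisitsAll G g v)
    → Σ (Automaton k s) (λ A → Deterministic A × WellBehaved A × (∀ (g : Graph s) → F g → (g ∈L A ⇔ g ⊨ φ)))
  compile F searches = A.automaton program , A.deterministic program
    , (λ g u₁ u₂ acc → case acc⇒ g acc of λ { (full , sat) → acc⇐ g full sat u₂ })
    , λ g Fg → mk⇔ (λ acc → proj₂ (acc⇒ g (acc zero))) (acc⇐ g (searches g Fg))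

toℕ-mod : ∀ a n → toℕ (a mod (suc n)) ≡ a % suc n
toℕ-mod a n = toℕ-fromℕ< (m%n<n a (suc n))

-- Reduction modulo the number of pebbles is a total naming by natural numbers; injectivity is only
-- required below the bound.
mod-injective : ∀ {n a b} → a < n → b < n → a mod (suc n) ≡ b mod (suc n) → a ≡ b
mod-injective {n} a< b< e = trans (sym (index a<)) (trans (cong toℕ e) (index b<))
  where
  index : ∀ {c} → c < n → toℕ (c mod (suc n)) ≡ c
  index {c} c< = trans (toℕ-mod c n) (m<n⇒m%n≡m (≤-trans c< (n≤1+n n)))

fromFormula : ∀ {s k} → Fin k → (F : Graph s → Set) → Searchable F → (φ : Formula s k) → IsDTC φ → Closed φ
  → Σ (Automaton k s) (λ A → Deterministic A × WellBehaved A × (∀ (g : Graph s) → F g → (g ∈L A ⇔ g ⊨ φ)))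
fromFormula {k = k} i₀ F (G , det , _ , searches) φ dtc closed = withPebbles _ ≤-refl
  where
  withPebbles : ∀ n → 1 + (checkSize G + EvalSize.evalSize k G φ) ≤ n → _
  withPebbles n fits =
    Program.compile {nX' = n} i₀ G det (λ a → a mod (suc n)) {n} mod-injective φ dtc closed fits F searches

-- Fresh blocks of variables.

-- The block from `b` to `n + b - 1` in descending order: adding one variable in front matches one
-- use of `def-ex`, which binds the variable equal to the current bound.
fresh : ℕ → ∀ n → Vec ℕ n
fresh b zero    = []
fresh b (suc n) = (n + b) ∷ fresh b n

fresh≥ : ∀ {b x} n → x ∈ toList (fresh b n) → b ≤ x
fresh≥ {b} (suc n) (here refl) = m≤n+m b n
fresh≥     (suc n) (there m)   = fresh≥ n m

fresh< : ∀ {b x} n → x ∈ toList (fresh b n) → x < n + b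
fresh< (suc n) (here refl) = n<1+n _
fresh< (suc n) (there m)   = <-trans (fresh< n m) (n<1+n _)

below∉fresh : ∀ {b x} n → x < b → x ∉ toList (fresh b n)
below∉fresh n x<b m = <-irrefl refl (<-≤-trans x<b (fresh≥ n m))

∉fresh⇒below : ∀ {b x} n → x < n + b → x ∉ toList (fresh b n) → x < b
∉fresh⇒below zero    x< _ = x<
∉fresh⇒below (suc n) x< x∉ with m<1+n⇒m<n∨m≡n x<
... | inj₁ x<′ = ∉fresh⇒below n x<′ (x∉ ∘ there)
... | inj₂ e   = contradiction (here e) x∉

fresh-unique : ∀ b n → Unique (toList (fresh b n))
fresh-unique b zero    = []
fresh-unique b (suc n) = tabulateA (λ m e → <-irrefl (sym e) (fresh< n m)) ∷ fresh-unique b n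

Bounded : ∀ {n} → ℕ → Vec ℕ n → Set
Bounded b xs = ∀ {x} → x ∈ toList xs → x < b

Bounded-mono : ∀ {n b b'} (xs : Vec ℕ n) → b ≤ b' → Bounded b xs → Bounded b' xs
Bounded-mono xs le bd m = <-≤-trans (bd m) le

module _ {s : ℕ} (g : Graph s) where
  open Valuations g

  fresh-keeps : ∀ {b n j as ν} (xs : Vec ℕ j) → Bounded b xs → mapV (updVec g ν (fresh b n) as) xs ≡ mapV ν xs
  fresh-keeps {b} {n} xs bd = map-ext xs λ m → updVec-other (fresh b n) (below∉fresh n (bd m))

  fresh-self : ∀ b n {as ν} → mapV (updVec g ν (fresh b n) as) (fresh b n) ≡ as
  fresh-self b n = updVec-self (fresh b n) (fresh-unique b n)

-- Definable predicates and relations.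

module Definability {s k : ℕ} where

  Pred : Set₁
  Pred = (g : Graph s) → Val g → Set

  record Def (b : ℕ) (P : Pred) : Set where
    field
      φ     : Formula s k
      dtc   : IsDTC φ
      below : ∀ x → Free x φ → x < b
      to    : ∀ g ν → Sat g φ ν → P g ν
      from  : ∀ g ν → P g ν → Sat g φ ν
  open Def public

  def-map : ∀ {b} {P Q : Pred} → (∀ g ν → P g ν → Q g ν) → (∀ g ν → Q g ν → P g ν) → Def b P → Def b Q
  def-map f h D = record { φ = φ D ; dtc = dtc D ; below = below D
    ; to = λ g ν → f g ν ∘ to D g ν ; from = λ g ν → from D g ν ∘ h g ν }

  def-lab : ∀ {b} σ {x} → x < b → Def b (λ g ν → nlab g (ν x) ≡ σ)
  def-lab σ {x} x<b = record { φ = lab σ x ; dtc = tt ; below = λ { _ f-lab → x<b } ; to = λ _ _ → id ; from = λ _ _ → id }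

  def-edg : ∀ {b} σ {x y} → x < b → y < b → Def b (λ g ν → out g (ν x) σ ≡ just (ν y))
  def-edg σ {x} {y} x<b y<b = record { φ = edg σ x y ; dtc = tt ; below = λ { _ f-edg₁ → x<b ; _ f-edg₂ → y<b }
    ; to = λ _ _ → id ; from = λ _ _ → id }

  def-eq : ∀ {b x y} → x < b → y < b → Def b (λ g ν → ν x ≡ ν y)
  def-eq {x = x} {y} x<b y<b = record { φ = eq x y ; dtc = tt ; below = λ { _ f-eq₁ → x<b ; _ f-eq₂ → y<b }
    ; to = λ _ _ → id ; from = λ _ _ → id }

  def-neg : ∀ {b P} → Def b P → Def b (λ g ν → ¬ P g ν)
  def-neg D = record { φ = neg (φ D) ; dtc = dtc D ; below = λ { x (f-neg f) → below D x f }
    ; to = λ g ν ¬p → ¬p ∘ from D g ν ; from = λ g ν ¬p → ¬p ∘ to D g ν }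

  def-and : ∀ {b P Q} → Def b P → Def b Q → Def b (λ g ν → P g ν × Q g ν)
  def-and D E = record { φ = and (φ D) (φ E) ; dtc = dtc D , dtc E
    ; below = λ { x (f-and₁ f) → below D x f ; x (f-and₂ f) → below E x f }
    ; to = λ { g ν (p , q) → to D g ν p , to E g ν q } ; from = λ { g ν (p , q) → from D g ν p , from E g ν q } }

  def-or : ∀ {b P Q} → Def b P → Def b Q → Def b (λ g ν → P g ν ⊎ Q g ν)
  def-or D E = record { φ = or (φ D) (φ E) ; dtc = dtc D , dtc E
    ; below = λ { x (f-or₁ f) → below D x f ; x (f-or₂ f) → below E x f }
    ; to = λ { g ν (inj₁ p) → inj₁ (to D g ν p) ; g ν (inj₂ q) → inj₂ (to E g ν q) }
    ; from = λ { g ν (inj₁ p) → inj₁ (from D g ν p) ; g ν (inj₂ q) → inj₂ (from E g ν q) } }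

  drop-bound : ∀ {x b} → x < suc b → x ≢ b → x < b
  drop-bound x< ne with m<1+n⇒m<n∨m≡n x<
  ... | inj₁ x<b = x<b
  ... | inj₂ e   = contradiction e ne

  def-ex : ∀ {b P} → Def (suc b) P → Def b (λ g ν → ∃[ a ] P g (upd g ν b a))
  def-ex {b} D = record { φ = ex b (φ D) ; dtc = dtc D ; below = λ { x (f-ex ne f) → drop-bound (below D x f) ne }
    ; to = λ { g ν (a , p) → a , to D g _ p } ; from = λ { g ν (a , p) → a , from D g _ p } }

  def-all : ∀ {b P} → Def (suc b) P → Def b (λ g ν → ∀ a → P g (upd g ν b a))
  def-all {b} D = record { φ = all b (φ D) ; dtc = dtc D ; below = λ { x (f-all ne f) → drop-bound (below D x f) ne }
    ; to = λ g ν p a → to D g _ (p a) ; from = λ g ν p a → from D g _ (p a) }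

  -- The formula must have no free variable, since `b` may be 0.
  def-true : ∀ {b} {P : Pred} → (∀ g ν → P g ν) → Def b P
  def-true p = record { φ = all 0 (eq 0 0) ; dtc = tt
    ; below = λ { x (f-all ne f-eq₁) → contradiction refl ne ; x (f-all ne f-eq₂) → contradiction refl ne }
    ; to = λ g ν _ → p g ν ; from = λ _ _ _ _ → refl }

  def-false : ∀ {b} {P : Pred} → (∀ g ν → ¬ P g ν) → Def b P
  def-false ¬p = def-map (λ g ν f → ⊥-elim (f tt)) (λ g ν p → ⊥-elim (¬p g ν p)) (def-neg (def-true {P = λ _ _ → ⊤} (λ _ _ → tt)))

  -- `A` concerns the automaton alone and is decided while the formula is being built. Handing its
  -- proof to `D` lets impossible cases be closed by contradiction.
  def-guard : ∀ {b} {A : Set} {P : Pred} → Dec A → (A → Def b P) → Def b (λ g ν → A × P g ν)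
  def-guard (yes a) D = def-map (λ _ _ p → a , p) (λ _ _ → proj₂) (D a)
  def-guard (no ¬a) D = def-false λ _ _ → ¬a ∘ proj₁

  def-Any : ∀ {b} {A : Set} {P : A → Pred} (as : List A) → (∀ a → Def b (P a)) → Def b (λ g ν → Any (λ a → P a g ν) as)
  def-Any []       D = def-false λ _ _ ()
  def-Any (a ∷ as) D = def-map (λ { _ _ (inj₁ p) → here p ; _ _ (inj₂ q) → there q })
    (λ { _ _ (here p) → inj₁ p ; _ _ (there q) → inj₂ q }) (def-or (D a) (def-Any as D))

  def-∃Fin : ∀ {b n} {P : Fin n → Pred} → (∀ i → Def b (P i)) → Def b (λ g ν → ∃[ i ] P i g ν)
  def-∃Fin {n = zero}  D = def-false λ { _ _ (() , _) }
  def-∃Fin {n = suc n} D = def-map (λ { _ _ (inj₁ p) → zero , p ; _ _ (inj₂ (i , q)) → suc i , q })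
    (λ { _ _ (zero , p) → inj₁ p ; _ _ (suc i , q) → inj₂ (i , q) }) (def-or (D zero) (def-∃Fin (D ∘ suc)))

  def-∀Fin : ∀ {b n} {P : Fin n → Pred} → (∀ i → Def b (P i)) → Def b (λ g ν → ∀ i → P i g ν)
  def-∀Fin {n = zero}  D = def-true λ _ _ ()
  def-∀Fin {n = suc n} D = def-map (λ { _ _ (p , q) zero → p ; _ _ (p , q) (suc i) → q i })
    (λ _ _ p → p zero , p ∘ suc) (def-and (D zero) (def-∀Fin (D ∘ suc)))

  def-exVec : ∀ {b P} n → Def (n + b) P → Def b (λ g ν → ∃[ as ] P g (updVec g ν (fresh b n) as))
  def-exVec zero    D = def-map (λ _ _ p → [] , p) (λ { _ _ ([] , p) → p }) D
  def-exVec (suc n) D = def-map (λ { _ _ (as , a , p) → a ∷ as , p }) (λ { _ _ (a ∷ as , p) → as , a , p })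
    (def-exVec n (def-ex D))

  -- Relations between two head tuples; the `d` parameters will be the nodes of the pebbles on the
  -- stack.
  Rel : ℕ → Set₁
  Rel d = (g : Graph s) → Vec (Node g) k → Vec (Node g) k → Vec (Node g) d → Set

  -- Asking for a formula at all variable tuples and all bounds replaces substitution: a relation is
  -- instantiated anew under each binder.
  record DefRel {d : ℕ} (R : Rel d) : Set where
    constructor defrel
    field
      inst : ∀ {b} (xs ys : Vec ℕ k) (zs : Vec ℕ d) → Bounded b xs → Bounded b ys → Bounded b zs
        → Def b (λ g ν → R g (mapV ν xs) (mapV ν ys) (mapV ν zs))
  open DefRel public

  rel-map : ∀ {d} {R S : Rel d} → (∀ {g u v z} → R g u v z → S g u v z) → (∀ {g u v z} → S g u v z → R g u v z)
    → DefRel R → DefRel S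
  rel-map f h D = defrel λ xs ys zs bx by bz → def-map (λ _ _ → f) (λ _ _ → h) (inst D xs ys zs bx by bz)

  rel-false : ∀ {d} {R : Rel d} → (∀ {g u v z} → ¬ R g u v z) → DefRel R
  rel-false f = defrel λ xs ys zs bx by bz → def-false λ _ _ → f

  rel-or : ∀ {d} {R S : Rel d} → DefRel R → DefRel S → DefRel (λ g u v z → R g u v z ⊎ S g u v z)
  rel-or D E = defrel λ xs ys zs bx by bz → def-or (inst D xs ys zs bx by bz) (inst E xs ys zs bx by bz)

  rel-and : ∀ {d} {R S : Rel d} → DefRel R → DefRel S → DefRel (λ g u v z → R g u v z × S g u v z)
  rel-and D E = defrel λ xs ys zs bx by bz → def-and (inst D xs ys zs bx by bz) (inst E xs ys zs bx by bz)

  rel-neg : ∀ {d} {R : Rel d} → DefRel R → DefRel (λ g u v z → ¬ R g u v z)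
  rel-neg D = defrel λ xs ys zs bx by bz → def-neg (inst D xs ys zs bx by bz)

  rel-guard : ∀ {d} {A : Set} {R : Rel d} → Dec A → (A → DefRel R) → DefRel (λ g u v z → A × R g u v z)
  rel-guard a? D = defrel λ xs ys zs bx by bz → def-guard a? λ a → inst (D a) xs ys zs bx by bz

  rel-Any : ∀ {d} {A : Set} {R : A → Rel d} (as : List A) → (∀ a → DefRel (R a)) → DefRel (λ g u v z → Any (λ a → R a g u v z) as)
  rel-Any as D = defrel λ xs ys zs bx by bz → def-Any as λ a → inst (D a) xs ys zs bx by bz

  rel-comp : ∀ {d} {R S : Rel d} → DefRel R → DefRel S → DefRel (λ g u v z → ∃[ w ] R g u w z × S g w v z)
  rel-comp {R = R} {S} D E .inst {b} xs ys zs bx by bz = def-map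
    (λ { g ν (as , r , s) → as , subst (λ f → f) (left g ν as) r , subst (λ f → f) (right g ν as) s })
    (λ { g ν (as , r , s) → as , subst (λ f → f) (sym (left g ν as)) r , subst (λ f → f) (sym (right g ν as)) s })
    (def-exVec k (def-and (inst D xs ms zs (wide xs bx) (fresh< k) (wide zs bz)) (inst E ms ys zs (fresh< k) (wide ys by) (wide zs bz))))
    where
    ms : Vec ℕ k
    ms = fresh b k
    wide : ∀ {j} (ws : Vec ℕ j) → Bounded b ws → Bounded (k + b) ws
    wide ws = Bounded-mono ws (m≤n+m b k)
    left : ∀ g ν as → let ν' = updVec g ν ms as in R g (mapV ν' xs) (mapV ν' ms) (mapV ν' zs) ≡ R g (mapV ν xs) as (mapV ν zs)
    left g ν as rewrite fresh-keeps g {b} {k} {as = as} {ν} xs bx | fresh-self g b k {as} {ν} | fresh-keeps g {b} {k} {as = as} {ν} zs bz = refl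
    right : ∀ g ν as → let ν' = updVec g ν ms as in S g (mapV ν' ms) (mapV ν' ys) (mapV ν' zs) ≡ S g as (mapV ν ys) (mapV ν zs)
    right g ν as rewrite fresh-keeps g {b} {k} {as = as} {ν} ys by | fresh-self g b k {as} {ν} | fresh-keeps g {b} {k} {as = as} {ν} zs bz = refl

  -- To yield `Functional`, the hypothesis has to hold for every graph and every parameter tuple
  -- `z`. Both bound blocks are fresh for `zs`, whose variables remain free in the closure.
  rel-star : ∀ {d} {R : Rel d} → (∀ {g u v v' z} → R g u v z → R g u v' z → v ≡ v') → DefRel R
    → DefRel (λ g u v z → Star (λ a c → R g a c z) u v)
  rel-star {R = R} functional D .inst {b} xs ys zs bx by bz = record
    { φ = tc ms ms' (φ E) xs ys
    ; dtc = distinct , (λ g ν as bs bs' p p' → functional (unpack g ν as bs p) (unpack g ν as bs' p')) , dtc E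
    ; below = λ { x (f-tcφ x∉ms x∉ms' f) → ∉fresh⇒below k (∉fresh⇒below k (below E x f) x∉ms') x∉ms
                ; x (f-tcu m) → bx m ; x (f-tcv m) → by m }
    ; to   = λ g ν → mapStar (unpack g ν _ _)
    ; from = λ g ν → mapStar (pack g ν _ _) }
    where
    ms ms' : Vec ℕ k
    ms  = fresh b k
    ms' = fresh (k + b) k
    wide : Bounded (k + (k + b)) zs
    wide = Bounded-mono zs (≤-trans (m≤n+m b k) (m≤n+m (k + b) k)) bz
    E : Def (k + (k + b)) (λ g ν → R g (mapV ν ms) (mapV ν ms') (mapV ν zs))
    E = inst D ms ms' zs (λ m → <-≤-trans (fresh< k m) (m≤n+m (k + b) k)) (fresh< k) wide
    distinct : Unique (toList (ms ++V ms'))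
    distinct = subst Unique (sym (toList-++ ms ms')) (Uniqueₚ.++⁺ (fresh-unique b k) (fresh-unique (k + b) k)
      λ { (m , m') → <-irrefl refl (<-≤-trans (fresh< k m) (fresh≥ k m')) })
    values : ∀ g ν as bs → let ν' = updVec g (updVec g ν ms as) ms' bs in
      R g (mapV ν' ms) (mapV ν' ms') (mapV ν' zs) ≡ R g as bs (mapV ν zs)
    values g ν as bs
      rewrite fresh-keeps g {k + b} {k} {as = bs} {updVec g ν ms as} ms (fresh< k)
            | fresh-self g b k {as} {ν}
            | fresh-self g (k + b) k {bs} {updVec g ν ms as}
            | fresh-keeps g {k + b} {k} {as = bs} {updVec g ν ms as} zs (Bounded-mono zs (m≤n+m b k) bz)
            | fresh-keeps g {b} {k} {as = as} {ν} zs bz = refl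
    unpack : ∀ g ν as bs → Sat g (φ E) (updVec g (updVec g ν ms as) ms' bs) → R g as bs (mapV ν zs)
    unpack g ν as bs p = subst (λ f → f) (values g ν as bs) (to E g _ p)
    pack : ∀ g ν as bs → R g as bs (mapV ν zs) → Sat g (φ E) (updVec g (updVec g ν ms as) ms' bs)
    pack g ν as bs r = from E g _ (subst (λ f → f) (sym (values g ν as bs)) r)

  rel-id : ∀ {d} → DefRel {d} (λ g u v z → u ≡ v)
  rel-id = defrel λ xs ys zs bx by bz → def-map
    (λ g ν e → vec-ext λ i → trans (lookup-map i ν xs) (trans (e i) (sym (lookup-map i ν ys))))
    (λ g ν e i → trans (sym (lookup-map i ν xs)) (trans (cong (λ w → lookup w i) e) (lookup-map i ν ys)))
    (def-∀Fin λ i → def-eq (bx (lookup∈toList xs i)) (by (lookup∈toList ys i)))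

  -- Elimination of states.

  -- Kleene's elimination of states.  A return to the state being eliminated is functional because the
  -- first return of a deterministic computation is unique, so only deterministic closures are needed.
  module Kleene {d n : ℕ} (W : Fin n → Fin n → Rel d) (defW : ∀ p q → DefRel (W p q))
    (det : ∀ {p q q' g u v v' z} → W p q g u v z → W p q' g u v' z → (q , v) ≡ (q' , v')) where

    data Path (j : ℕ) (g : Graph s) (z : Vec (Node g) d) : Fin n → Vec (Node g) k → Fin n → Vec (Node g) k → Set where
      one  : ∀ {p u q v} → W p q g u v z → Path j g z p u q v
      cons : ∀ {p u r w q v} → W p r g u w z → toℕ r < j → Path j g z r w q v → Path j g z p u q v

    -- Intermediate states are below `j` and end states are not, so both paths stop where the
    -- deterministic computation first meets a state not below `j`.
    path-det : ∀ {j g z p u q v q' v'} → Path j g z p u q v → Path j g z p u q' v' → ¬ toℕ q < j → ¬ toℕ q' < j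
      → (q , v) ≡ (q' , v')
    path-det (one a)      (one b)        _  _   = det a b
    path-det (one a)      (cons b lt _)  ¬q _   with refl ← det a b = contradiction lt ¬q
    path-det (cons a lt _) (one b)       _  ¬q' with refl ← det a b = contradiction lt ¬q'
    path-det (cons a _ p) (cons b _ p')  ¬q ¬q' with refl ← det a b = path-det p p' ¬q ¬q'

    path-mono : ∀ {j g z p u q v} → Path j g z p u q v → Path (suc j) g z p u q v
    path-mono (one a)       = one a
    path-mono (cons a lt p) = cons a (≤-trans lt (n≤1+n _)) (path-mono p)

    path-append : ∀ {j g z p u r w q v} → Path j g z p u r w → toℕ r < j → Path j g z r w q v → Path j g z p u q v
    path-append (one a)       lt p' = cons a lt p'
    path-append (cons a l p)  lt p' = cons a l (path-append p lt p')

    module _ {j : ℕ} (r : Fin n) (r≡j : toℕ r ≡ j) where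
      Through : Fin n → Fin n → Rel d
      Through p q g u v z = Path j g z p u q v
        ⊎ (∃[ w ] Path j g z p u r w × (∃[ w' ] Star (λ a c → Path j g z r a r c) w w' × Path j g z r w' q v))

      r<1+j : toℕ r < suc j
      r<1+j = ≤-reflexive (cong suc r≡j)

      loops : ∀ {g z w w' q v} → Star (λ a c → Path j g z r a r c) w w' → Path (suc j) g z r w' q v → Path (suc j) g z r w q v
      loops ε        p = p
      loops (l ◅ ls) p = path-append (path-mono l) r<1+j (loops ls p)

      through⁻ : ∀ {p q g u v z} → Through p q g u v z → Path (suc j) g z p u q v
      through⁻ (inj₁ p) = path-mono p
      through⁻ (inj₂ (_ , p , _ , ls , p')) = path-append (path-mono p) r<1+j (loops ls (path-mono p'))

      through⁺ : ∀ {p q g u v z} → Path (suc j) g z p u q v → Through p q g u v z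
      through⁺ (one a) = inj₁ (one a)
      through⁺ (cons a lt p) with m<1+n⇒m<n∨m≡n lt | through⁺ p
      ... | inj₁ lt' | inj₁ p' = inj₁ (cons a lt' p')
      ... | inj₁ lt' | inj₂ (w , p' , rest) = inj₂ (w , cons a lt' p' , rest)
      ... | inj₂ e | t with refl ← toℕ-injective (trans e (sym r≡j)) with t
      ... | inj₁ p' = inj₂ (_ , one a , _ , ε , p')
      ... | inj₂ (w , p' , w' , ls , p″) = inj₂ (_ , one a , w' , p' ◅ ls , p″)

    def-path : ∀ j → j ≤ n → ∀ p q → DefRel (λ g u v z → Path j g z p u q v)
    def-path zero _ p q = rel-map one (λ { (one a) → a ; (cons _ () _) }) (defW p q)
    def-path (suc j) j<n p q = rel-map (through⁻ r r≡j) (through⁺ r r≡j)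
      (rel-or (IH p q) (rel-comp (IH p r) (rel-comp (rel-star return-functional (IH r r)) (IH r q))))
      where
      r : Fin n
      r = fromℕ< j<n
      r≡j : toℕ r ≡ j
      r≡j = toℕ-fromℕ< j<n
      IH : ∀ p q → DefRel (λ g u v z → Path j g z p u q v)
      IH = def-path j (<⇒≤ j<n)
      return-functional : ∀ {g u v v' z} → Path j g z r u r v → Path j g z r u r v' → v ≡ v'
      return-functional a b with refl ← path-det a b (<-irrefl r≡j) (<-irrefl r≡j) = refl

    Reach : Fin n → Fin n → Rel d
    Reach p q g u v z = ((p ≡ q) × (u ≡ v)) ⊎ Path n g z p u q v

    def-reach : ∀ p q → DefRel (Reach p q)
    def-reach p q = rel-or (rel-guard (p ≟F q) (λ _ → rel-id)) (def-path n ≤-refl p q)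

-- The formula of an automaton.

∈-replicate : ∀ {A : Set} {x y : A} n → x ∈ toList (replicate n y) → x ≡ y
∈-replicate (suc n) (here e)  = e
∈-replicate (suc n) (there m) = ∈-replicate n m

map-replicate : ∀ {A B : Set} (f : A → B) x n → mapV f (replicate n x) ≡ replicate n (f x)
map-replicate f x zero    = refl
map-replicate f x (suc n) = cong (f x ∷_) (map-replicate f x n)

module FromAutomaton {k s : ℕ} (A : Automaton k s) (det : Deterministic A) where
  open Automaton A
  open Definability {s} {k}

  Row : Set
  Row = Instr k nX s × Fin nQ

  isDrop? : ∀ i x q (e : Row) → Dec (e ≡ (drop i x , q))
  isDrop? i x q (drop i' x' , q') = map′ (λ { (refl , refl , refl) → refl }) (λ { refl → refl , refl , refl })
    ((i' ≟F i) ×-dec ((x' ≟F x) ×-dec (q' ≟F q)))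
  isDrop? i x q (inmove _ _ , q')  = no λ ()
  isDrop? i x q (outmove _ _ , q') = no λ ()
  isDrop? i x q (retrieve _ , q')  = no λ ()
  isDrop? i x q (test _ , q')      = no λ ()
  isDrop? i x q (ntest _ , q')     = no λ ()

  isRetrieve? : ∀ x q (e : Row) → Dec (e ≡ (retrieve x , q))
  isRetrieve? x q (retrieve x' , q') = map′ (λ { (refl , refl) → refl }) (λ { refl → refl , refl }) ((x' ≟F x) ×-dec (q' ≟F q))
  isRetrieve? x q (inmove _ _ , q')  = no λ ()
  isRetrieve? x q (outmove _ _ , q') = no λ ()
  isRetrieve? x q (drop _ _ , q')    = no λ ()
  isRetrieve? x q (test _ , q')      = no λ ()
  isRetrieve? x q (ntest _ , q')     = no λ ()

  -- A different instruction from the same state would have to form with this one a test and its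
  -- negation, and a `drop` is neither.
  drop-only : ∀ {p i x q} {e : Row} → (p , drop i x , q) ∈ instrs → (p , e) ∈ instrs → e ≡ (drop i x , q)
  drop-only {i = i} {x} {q} {e} m m' = decidable-stable (isDrop? i x q e) λ ne →
    case det m' m refl ne of λ { (inj₁ ()) ; (inj₂ ()) }

  retrieve-only : ∀ {p x q} {e : Row} → (p , retrieve x , q) ∈ instrs → (p , e) ∈ instrs → e ≡ (retrieve x , q)
  retrieve-only {x = x} {q} {e} m m' = decidable-stable (isRetrieve? x q e) λ ne →
    case det m' m refl ne of λ { (inj₁ ()) ; (inj₂ ()) }

  module Hops (g : Graph s) where
    open Run A g

    -- `local` admits only instructions that leave the stack as it is, which excludes `drop` and
    -- `retrieve`; these occur only as the two ends of a `nest`.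
    data Hop (α : Stack) : Fin nQ → Vec (Node g) k → Fin nQ → Vec (Node g) k → Set
    data Hop* (α : Stack) : Fin nQ → Vec (Node g) k → Fin nQ → Vec (Node g) k → Set

    data Hop α where
      local : ∀ {p χ u q v} → (p , χ , q) ∈ instrs → Exec χ u α v α → Hop α p u q v
      nest  : ∀ {p i x p' u q' v q} → (p , drop i x , p') ∈ instrs → ¬ Any (λ e → proj₁ e ≡ x) α
            → Hop* ((x , lookup u i) ∷ α) p' u q' v → (q' , retrieve x , q) ∈ instrs → Hop α p u q v

    data Hop* α where
      []  : ∀ {p u} → Hop* α p u p u
      _∷_ : ∀ {p u r w q v} → Hop α p u r w → Hop* α r w q v → Hop* α p u q v

    hop-sound : ∀ {α p u q v} → Hop α p u q v → Star Step ⟦ p , u , α ⟧ ⟦ q , v , α ⟧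
    hop*-sound : ∀ {α p u q v} → Hop* α p u q v → Star Step ⟦ p , u , α ⟧ ⟦ q , v , α ⟧
    hop-sound (local m x) = step m x ◅ ε
    hop-sound (nest m fr ms m') = step m (ex-drop fr) ◅ (hop*-sound ms ◅◅ (step m' ex-ret ◅ ε))
    hop*-sound []       = ε
    hop*-sound (m ∷ ms) = hop-sound m ◅◅ hop*-sound ms

    -- Computations that empty the stack α, cut at the moments when its pebbles are retrieved.
    Unwind : Stack → Fin nQ → Vec (Node g) k → Fin nQ → Vec (Node g) k → Set
    Unwind [] p u q v = Hop* [] p u q v
    Unwind ((x , a) ∷ α) p u q v = ∃₂ λ r w → ∃[ r' ] Hop* ((x , a) ∷ α) p u r w × (r , retrieve x , r') ∈ instrs × Unwind α r' w q v

    prepend : ∀ {α p u r w q v} → Hop α p u r w → Unwind α r w q v → Unwind α p u q v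
    prepend {[]}    m ms                       = m ∷ ms
    prepend {_ ∷ _} m (_ , _ , _ , ms , rest) = _ , _ , _ , m ∷ ms , rest

    -- The stack is arbitrary for the sake of the induction. After a `drop`, the induction
    -- hypothesis already cuts the run at the retrieval of the new pebble, and the part before the
    -- cut becomes a `nest`.
    unwind : ∀ {p u α q v} → Star Step ⟦ p , u , α ⟧ ⟦ q , v , [] ⟧ → Unwind α p u q v
    unwind ε = []
    unwind (step m x@(ex-in _)   ◅ st) = prepend (local m x) (unwind st)
    unwind (step m x@(ex-out _)  ◅ st) = prepend (local m x) (unwind st)
    unwind (step m x@(ex-test _) ◅ st) = prepend (local m x) (unwind st)
    unwind (step m x@(ex-ntst _) ◅ st) = prepend (local m x) (unwind st)
    unwind (step m (ex-drop fr)  ◅ st) with _ , _ , _ , ms , m' , rest ← unwind st = prepend (nest m fr ms m') rest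
    unwind (step m ex-ret        ◅ st) = _ , _ , _ , [] , m , unwind st

    retrieve-final : ∀ {p x q' α u r w} → (p , retrieve x , q') ∈ instrs → ¬ Hop α p u r w
    retrieve-final m (local m' x) with refl ← retrieve-only m m' with () ← x
    retrieve-final m (nest m' _ _ _) with () ← retrieve-only m m'

    -- The two statements are mutual: a `nest` is determined because the hops above its pebble end
    -- in the first state with a `retrieve`, which no hop can leave.
    hop-det : ∀ {α p u q v q' v'} → Hop α p u q v → Hop α p u q' v' → (q , v) ≡ (q' , v')
    hop*-det : ∀ {α p u q v x r q' v' x' r'} → Hop* α p u q v → (q , retrieve x , r) ∈ instrs
      → Hop* α p u q' v' → (q' , retrieve x' , r') ∈ instrs → (q , v) ≡ (q' , v')
    hop-det (local m x) (local m' x')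
      with refl ← Determinism.step-det A g det (step m x) (step m' x') = refl
    hop-det (local m x) (nest m' _ _ _) with refl ← drop-only m' m with () ← x
    hop-det (nest m _ _ _) (local m' x) with refl ← drop-only m m' with () ← x
    hop-det (nest m _ ms r) (nest m' _ ms' r')
      with refl ← drop-only m m' with refl ← hop*-det ms r ms' r' with refl ← retrieve-only r r' = refl
    hop*-det []       _ []         _  = refl
    hop*-det []       r (m' ∷ _)   _  = contradiction m' (retrieve-final r)
    hop*-det (m ∷ _)  _ []         r' = contradiction m (retrieve-final r')
    hop*-det (m ∷ ms) r (m' ∷ ms') r' with refl ← hop-det m m' = hop*-det ms r ms' r'

  module M = Hops
  open Run A using (Exec; Holds; Stack; Step; Acc; Halting; ⟦_,_,_⟧; step)

  stackOf : ∀ {d} (g : Graph s) → Vec (Fin nX) d → Vec (Node g) d → Stack g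
  stackOf g l z = toList (zipV l z)

  HopRel Hop*Rel : ∀ {d} → Vec (Fin nX) d → Fin nQ → Fin nQ → Rel d
  HopRel  l p q g u v z = M.Hop g (stackOf g l z) p u q v
  Hop*Rel l p q g u v z = M.Hop* g (stackOf g l z) p u q v

  stackOf-names⁺ : ∀ {d} (g : Graph s) (l : Vec (Fin nX) d) {z x} → Any (λ e → proj₁ e ≡ x) (stackOf g l z) → x ∈ toList l
  stackOf-names⁺ g []      {[]}    ()
  stackOf-names⁺ g (y ∷ l) {_ ∷ _} (here e)  = here (sym e)
  stackOf-names⁺ g (y ∷ l) {_ ∷ _} (there m) = there (stackOf-names⁺ g l m)

  stackOf-names⁻ : ∀ {d} (g : Graph s) (l : Vec (Fin nX) d) {z x} → x ∈ toList l → Any (λ e → proj₁ e ≡ x) (stackOf g l z)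
  stackOf-names⁻ g []      {[]}    ()
  stackOf-names⁻ g (y ∷ l) {_ ∷ _} (here e)  = here (sym e)
  stackOf-names⁻ g (y ∷ l) {_ ∷ _} (there m) = there (stackOf-names⁻ g l m)

  def-pebble : ∀ {d b} (l : Vec (Fin nX) d) x {y} (zs : Vec ℕ d) → y < b → Bounded b zs
    → Def b (λ g ν → (x , ν y) ∈ stackOf g l (mapV ν zs))
  def-pebble []      x []       y<b bz = def-false λ _ _ ()
  def-pebble (x' ∷ l) x (z ∷ zs) y<b bz = def-map
    (λ { g ν (inj₁ (refl , e)) → here (cong (x ,_) e) ; g ν (inj₂ m) → there m })
    (λ { g ν (here e) → inj₁ (cong proj₁ e , cong proj₂ e) ; g ν (there m) → inj₂ m })
    (def-or (def-guard (x ≟F x') (λ _ → def-eq y<b (bz (here refl)))) (def-pebble l x zs y<b (bz ∘ there)))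

  def-holds : ∀ {d b} (l : Vec (Fin nX) d) t (xs : Vec ℕ k) (zs : Vec ℕ d) → Bounded b xs → Bounded b zs
    → Def b (λ g ν → Holds g t (mapV ν xs) (stackOf g l (mapV ν zs)))
  def-holds l (labT i σ) xs zs bx bz = def-map
    (λ g ν e → trans (cong (nlab g) (lookup-map i ν xs)) e) (λ g ν e → trans (cong (nlab g) (sym (lookup-map i ν xs))) e)
    (def-lab σ (bx (lookup∈toList xs i)))
  def-holds l (pebT i x) xs zs bx bz = def-map
    (λ g ν → subst (λ a → (x , a) ∈ _) (sym (lookup-map i ν xs))) (λ g ν → subst (λ a → (x , a) ∈ _) (lookup-map i ν xs))
    (def-pebble l x zs (bx (lookup∈toList xs i)) bz)
  def-holds {b = b} l (inedgeT i σ) xs zs bx bz = def-map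
    (λ { g ν (w , e) → w , trans (edge g ν w) (trans e (cong just (node g ν w))) })
    (λ { g ν (w , e) → w , trans (sym (edge g ν w)) (trans e (cong just (sym (node g ν w)))) })
    (def-ex (def-edg σ (n<1+n b) (<-≤-trans (bx (lookup∈toList xs i)) (n≤1+n b))))
    where
    edge : ∀ g ν w → out g w σ ≡ out g (upd g ν b w b) σ
    edge g ν w = cong (λ a → out g a σ) (sym (Valuations.upd-same g b))
    node : ∀ g ν w → upd g ν b w (lookup xs i) ≡ lookup (mapV ν xs) i
    node g ν w = trans (Valuations.upd-other g {ν} {b} {lookup xs i} {w} (λ { refl → <-irrefl refl (bx (lookup∈toList xs i)) })) (sym (lookup-map i ν xs))
  def-holds {b = b} l (outedgeT i σ) xs zs bx bz = def-map
    (λ { g ν (w , e) → w , trans (edge g ν w) (trans e (cong just (Valuations.upd-same g b))) })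
    (λ { g ν (w , e) → w , trans (sym (edge g ν w)) (trans e (cong just (sym (Valuations.upd-same g b)))) })
    (def-ex (def-edg σ (<-≤-trans (bx (lookup∈toList xs i)) (n≤1+n b)) (n<1+n b)))
    where
    edge : ∀ g ν w → out g (lookup (mapV ν xs) i) σ ≡ out g (upd g ν b w (lookup xs i)) σ
    edge g ν w = cong (λ a → out g a σ) (trans (lookup-map i ν xs)
      (sym (Valuations.upd-other g {ν} {b} {lookup xs i} {w} (λ { refl → <-irrefl refl (bx (lookup∈toList xs i)) }))))

  rel-holds : ∀ {d} (l : Vec (Fin nX) d) t → DefRel (λ g u v z → Holds g t u (stackOf g l z))
  rel-holds l t .inst xs ys zs bx by bz = def-holds l t xs zs bx bz

  rel-edge : ∀ {d} (i : Fin k) σ → DefRel {d} (λ g u v z → out g (lookup u i) σ ≡ just (lookup v i))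
  rel-edge i σ .inst xs ys zs bx by bz = def-map
    (λ g ν e → trans (cong (λ a → out g a σ) (lookup-map i ν xs)) (trans e (cong just (sym (lookup-map i ν ys)))))
    (λ g ν e → trans (cong (λ a → out g a σ) (sym (lookup-map i ν xs))) (trans e (cong just (lookup-map i ν ys))))
    (def-edg σ (bx (lookup∈toList xs i)) (by (lookup∈toList ys i)))

  rel-edgeᵒ : ∀ {d} (i : Fin k) σ → DefRel {d} (λ g u v z → out g (lookup v i) σ ≡ just (lookup u i))
  rel-edgeᵒ i σ .inst xs ys zs bx by bz = inst (rel-edge i σ) ys xs zs by bx bz

  rel-off : ∀ {d} (i : Fin k) → DefRel {d} (λ g u v z → ∀ j → j ≢ i → lookup v j ≡ lookup u j)
  rel-off i .inst xs ys zs bx by bz = def-∀Fin λ j → agree j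
    where
    agree : ∀ j → Def _ (λ g ν → j ≢ i → lookup (mapV ν ys) j ≡ lookup (mapV ν xs) j)
    agree j with j ≟F i
    ... | yes e = def-true λ _ _ ne → contradiction e ne
    ... | no ne = def-map
      (λ g ν e _ → trans (lookup-map j ν ys) (trans e (sym (lookup-map j ν xs))))
      (λ g ν f → trans (sym (lookup-map j ν ys)) (trans (f ne) (lookup-map j ν xs)))
      (def-eq (by (lookup∈toList ys j)) (bx (lookup∈toList xs j)))

  off⇒update : ∀ {g : Graph s} {u v : Vec (Node g) k} i → (∀ j → j ≢ i → lookup v j ≡ lookup u j) → u [ i ]≔ lookup v i ≡ v
  off⇒update {u = u} {v} i off = vec-ext pointwise
    where
    pointwise : ∀ j → lookup (u [ i ]≔ lookup v i) j ≡ lookup v j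
    pointwise j with j ≟F i
    ... | yes refl = lookup∘update i u _
    ... | no ne    = trans (lookup∘update′ ne u _) (sym (off j ne))

  no-drop : ∀ g {i x u v α} → ¬ Exec g (drop i x) u α v α
  no-drop g ()

  no-retrieve : ∀ g {x u v α} → ¬ Exec g (retrieve x) u α v α
  no-retrieve g ()

  rel-exec : ∀ {d} (l : Vec (Fin nX) d) χ → DefRel (λ g u v z → Exec g χ u (stackOf g l z) v (stackOf g l z))
  rel-exec l (inmove i σ) = rel-map
    (λ {g} {u} {v} {z} → λ { (e , off) → subst (λ w → Exec g (inmove i σ) u (stackOf g l z) w (stackOf g l z)) (off⇒update {g} i off) (Run.ex-in e) })
    (λ {g} {u} → λ { (Run.ex-in e) → trans (cong (λ a → out g a σ) (lookup∘update i u _)) e , λ j ne → lookup∘update′ ne u _ })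
    (rel-and (rel-edgeᵒ i σ) (rel-off i))
  rel-exec l (outmove i σ) = rel-map
    (λ {g} {u} {v} {z} → λ { (e , off) → subst (λ w → Exec g (outmove i σ) u (stackOf g l z) w (stackOf g l z)) (off⇒update {g} i off) (Run.ex-out e) })
    (λ {g} {u} → λ { (Run.ex-out e) → trans e (cong just (sym (lookup∘update i u _))) , λ j ne → lookup∘update′ ne u _ })
    (rel-and (rel-edge i σ) (rel-off i))
  rel-exec l (drop i x)   = rel-false λ {g} → no-drop g
  rel-exec l (retrieve x) = rel-false λ {g} → no-retrieve g
  rel-exec l (test t)  = rel-map (λ { (h , refl) → Run.ex-test h }) (λ { (Run.ex-test h) → h , refl }) (rel-and (rel-holds l t) rel-id)
  rel-exec l (ntest t) = rel-map (λ { (h , refl) → Run.ex-ntst h }) (λ { (Run.ex-ntst h) → h , refl })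
    (rel-and (rel-neg (rel-holds l t)) rel-id)

  -- Hops sorted by their first instruction, so that their definability reduces to a finite
  -- disjunction over `instrs`.
  ViaLocal ViaNest : ∀ {d} → Vec (Fin nX) d → Fin nQ → Fin nQ → Fin nQ × Instr k nX s × Fin nQ → Rel d
  ViaLocal l p q (p' , χ , q') g u v z = p' ≡ p × q' ≡ q × Exec g χ u (stackOf g l z) v (stackOf g l z)
  ViaNest l p q (p' , drop i x , p″) g u v z = p' ≡ p × x ∉ toList l
    × Any (λ e → proj₂ e ≡ (retrieve x , q) × Hop*Rel (x ∷ l) p″ (proj₁ e) g u v (lookup u i ∷ z)) instrs
  ViaNest l p q (p' , χ , p″) g u v z = ⊥

  via⇒hop : ∀ {d} {l : Vec (Fin nX) d} {p q g u v z} → Any (λ e → ViaLocal l p q e g u v z ⊎ ViaNest l p q e g u v z) instrs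
    → HopRel l p q g u v z
  via⇒hop {l = l} {g = g} a with find a
  ... | _ , m , inj₁ (refl , refl , x) = M.local m x
  ... | (_ , drop i x , _) , m , inj₂ (refl , x∉ , b) with _ , m' , refl , ms ← find b =
    M.nest m (x∉ ∘ stackOf-names⁺ g l) ms m'

  hop⇒via : ∀ {d} {l : Vec (Fin nX) d} {p q g u v z} → HopRel l p q g u v z
    → Any (λ e → ViaLocal l p q e g u v z ⊎ ViaNest l p q e g u v z) instrs
  hop⇒via (M.local m x) = lose m (inj₁ (refl , refl , x))
  hop⇒via {l = l} {g = g} (M.nest m fr ms m') = lose m (inj₂ (refl , fr ∘ stackOf-names⁻ g l , lose m' (refl , ms)))

  -- The recursion is on a bound f for the number of pebbles that are not on the stack.
  rel-hop  : ∀ f {d} (l : Vec (Fin nX) d) → Unique (toList l) → nX ≤ f + d → ∀ p q → DefRel (HopRel l p q)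
  rel-hop* : ∀ f {d} (l : Vec (Fin nX) d) → Unique (toList l) → nX ≤ f + d → ∀ p q → DefRel (Hop*Rel l p q)

  rel-hop f {d} l u enough p q = rel-map via⇒hop hop⇒via (rel-Any instrs λ e → rel-or (viaLocal e) (viaNest f enough e))
    where
    viaLocal : ∀ e → DefRel (ViaLocal l p q e)
    viaLocal (p' , χ , q') = rel-guard (p' ≟F p) λ _ → rel-guard (q' ≟F q) λ _ → rel-exec l χ
    open import Data.List.Membership.DecPropositional (_≟F_ {nX}) using (_∈?_)
    length-toList : ∀ {n} (xs : Vec (Fin nX) n) → length (toList xs) ≡ n
    length-toList []       = refl
    length-toList (_ ∷ xs) = cong suc (length-toList xs)
    viaNest : ∀ f → nX ≤ f + d → ∀ e → DefRel (ViaNest l p q e)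
    viaNest f enough (p' , inmove _ _ , p″)  = rel-false λ ()
    viaNest f enough (p' , outmove _ _ , p″) = rel-false λ ()
    viaNest f enough (p' , retrieve _ , p″)  = rel-false λ ()
    viaNest f enough (p' , test _ , p″)      = rel-false λ ()
    viaNest f enough (p' , ntest _ , p″)     = rel-false λ ()
    -- With `f = 0` the stack already holds all pebbles: a further name would give more than `nX`
    -- distinct ones.
    viaNest zero enough (p' , drop i x , p″) = rel-guard (p' ≟F p) λ _ → rel-guard (¬? (x ∈? toList l)) λ x∉ →
      contradiction (≤-trans (Unique⇒length≤size finFin (tabulateA (λ m e → x∉ (subst (_∈ toList l) (sym e) m)) ∷ u)) enough)
        λ le → <-irrefl (length-toList l) le
    viaNest (suc f) enough (p' , drop i x , p″) = rel-guard (p' ≟F p) λ _ → rel-guard (¬? (x ∈? toList l)) λ x∉ →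
      rel-Any instrs λ e → rel-guard (isRetrieve? x q (proj₂ e)) λ _ → above x∉ (proj₁ e)
      where
      -- The new pebble lies where head `i` stands at the drop, so the variable of that head is
      -- passed as the new parameter and nothing has to be quantified.
      above : x ∉ toList l → ∀ q' → DefRel (λ g u v z → Hop*Rel (x ∷ l) p″ q' g u v (lookup u i ∷ z))
      above x∉ q' .inst xs ys zs bx by bz = def-map
        (λ g ν → subst (λ a → Hop*Rel (x ∷ l) p″ q' g _ _ (a ∷ _)) (sym (lookup-map i ν xs)))
        (λ g ν → subst (λ a → Hop*Rel (x ∷ l) p″ q' g _ _ (a ∷ _)) (lookup-map i ν xs))
        (inst (rel-hop* f (x ∷ l) (tabulateA (λ m e → x∉ (subst (_∈ toList l) (sym e) m)) ∷ u)
                (≤-trans enough (≤-reflexive (sym (+-suc f d)))) p″ q')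
          xs ys (lookup xs i ∷ zs) bx by λ { (here refl) → bx (lookup∈toList xs i) ; (there m) → bz m })

  rel-hop* f l u enough p q = rel-map reach⇒ ⇒reach (def-reach p q)
    where
    open Kleene (HopRel l) (rel-hop f l u enough) (λ {_} {_} {_} {g} → M.hop-det g)
    path⇒ : ∀ {j g z p u q v} → Path j g z p u q v → Hop*Rel l p q g u v z
    path⇒ (one m)      = m M.∷ M.[]
    path⇒ (cons m _ p) = m M.∷ path⇒ p
    reach⇒ : ∀ {g u v z} → Reach p q g u v z → Hop*Rel l p q g u v z
    reach⇒ (inj₁ (refl , refl)) = M.[]
    reach⇒ (inj₂ p)             = path⇒ p
    ⇒path : ∀ {g z p u r w q v} → HopRel l p r g u w z → Hop*Rel l r q g w v z → Path nQ g z p u q v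
    ⇒path m M.[]        = one m
    ⇒path m (m' M.∷ ms) = cons m (toℕ<n _) (⇒path m' ms)
    ⇒reach : ∀ {g u v z} → Hop*Rel l p q g u v z → Reach p q g u v z
    ⇒reach M.[]       = inj₁ (refl , refl)
    ⇒reach (m M.∷ ms) = inj₂ (⇒path m ms)

  -- Halting is examined only at acceptance, where the stack is empty: there a `drop` always applies
  -- and a `retrieve` never does.
  def-enabled : ∀ {b} χ (xs : Vec ℕ k) → Bounded b xs → Def b (λ g ν → ∃₂ λ v α → Exec g χ (mapV ν xs) [] v α)
  def-enabled (inmove i σ) xs bx = def-map
    (λ { g ν (w , e) → _ , _ , Run.ex-in e }) (λ { g ν (_ , _ , Run.ex-in e) → _ , e })
    (def-holds [] (inedgeT i σ) xs [] bx λ ())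
  def-enabled (outmove i σ) xs bx = def-map
    (λ { g ν (w , e) → _ , _ , Run.ex-out e }) (λ { g ν (_ , _ , Run.ex-out e) → _ , e })
    (def-holds [] (outedgeT i σ) xs [] bx λ ())
  def-enabled (drop i x) xs bx   = def-true λ g ν → _ , _ , Run.ex-drop λ ()
  def-enabled (retrieve x) xs bx = def-false λ { g ν (_ , _ , ()) }
  def-enabled (test t) xs bx = def-map
    (λ g ν h → _ , _ , Run.ex-test h) (λ { g ν (_ , _ , Run.ex-test h) → h }) (def-holds [] t xs [] bx λ ())
  def-enabled (ntest t) xs bx = def-map
    (λ g ν h → _ , _ , Run.ex-ntst h) (λ { g ν (_ , _ , Run.ex-ntst h) → h }) (def-neg (def-holds [] t xs [] bx λ ()))

  def-halting : ∀ {b} q (xs : Vec ℕ k) → Bounded b xs → Def b (λ g ν → Halting g ⟦ q , mapV ν xs , [] ⟧)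
  def-halting q xs bx = def-map
    (λ { g ν f (_ , step m x) → f (lose m (refl , _ , _ , x)) })
    (λ g ν h a → case find a of λ { (_ , m , refl , _ , _ , x) → h (_ , step m x) })
    (def-neg (def-Any instrs λ { (p , χ , _) → def-guard (p ≟F q) λ _ → def-enabled χ xs bx }))

  Accepts : ∀ g → Vec (Node g) k → Vec (Node g) k → Fin nQ → Set
  Accepts g u v q = accept q ≡ true × Hop*Rel [] q₀ q g u v [] × Halting g ⟦ q , v , [] ⟧

  def-accepts : ∀ q {b} (xs ys : Vec ℕ k) → Bounded b xs → Bounded b ys → Def b (λ g ν → Accepts g (mapV ν xs) (mapV ν ys) q)
  def-accepts q xs ys bx by = def-guard (accept q ≟B true) λ _ →
    def-and (inst (rel-hop* nX [] [] (≤-reflexive (sym (+-identityʳ nX))) q₀ q) xs ys [] bx by λ ()) (def-halting q ys by)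

  accepts⇒acc : ∀ {g u} → (∃₂ λ v q → Accepts g (replicate k u) v q) → Acc g u
  accepts⇒acc {g} (v , q , acc , ms , h) = _ , M.hop*-sound g ms , h , acc , refl

  acc⇒accepts : ∀ {g u} → Acc g u → ∃₂ λ v q → Accepts g (replicate k u) v q
  acc⇒accepts {g} (⟦ q , v , .[] ⟧ , st , h , acc , refl) = v , q , acc , M.unwind g st , h

  -- Variable 0 is the starting node, repeated for all heads, and the block from 1 on holds the
  -- final tuple; the bound 0 is what makes the formula closed.
  sentence : Def 0 (λ g ν → ∀ u → Acc g u)
  sentence = def-map (λ g ν f u → accepts⇒acc (f u)) (λ g ν f u → acc⇒accepts (f u))
    (def-all (def-map
      (λ { g ν (v , q , a) → v , q , subst₂ (λ u v → Accepts g u v q) (start g ν v) (fresh-self g 1 k) a })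
      (λ { g ν (v , q , a) → v , q , subst₂ (λ u v → Accepts g u v q) (sym (start g ν v)) (sym (fresh-self g 1 k)) a })
      (def-exVec k (def-∃Fin λ q → def-accepts q xs (fresh 1 k) (λ m → <-≤-trans (bx m) (m≤n+m 1 k)) (fresh< k)))))
    where
    xs : Vec ℕ k
    xs = replicate k 0
    bx : Bounded 1 xs
    bx m = ≤-reflexive (cong suc (∈-replicate k m))
    start : ∀ g ν v → mapV (updVec g ν (fresh 1 k) v) xs ≡ replicate k (ν 0)
    start g ν v = trans (map-replicate _ 0 k) (cong (replicate k) (Valuations.updVec-other g (fresh 1 k) (below∉fresh k (s≤s z≤n))))

  fromAutomaton : Σ (Formula s k) (λ φ → IsDTC φ × Closed φ × (∀ (g : Graph s) → (g ∈L A ⇔ g ⊨ φ)))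
  fromAutomaton = φ sentence , dtc sentence , (λ x f → case below sentence x f of λ ())
    , λ g → mk⇔ (from sentence g _) (to sentence g _)

theorem7p3 : ∀ (s : ℕ) (F : Graph s → Set) → Searchable F → ∀ (k : ℕ) → 1 ≤ k →
    (∀ (A : Automaton k s) → Deterministic A → WellBehaved A →
    Σ (Formula s k) (λ φ → IsDTC φ × Closed φ × (∀ (g : Graph s) → F g → (g ∈L A ⇔ g ⊨ φ))))
    ×
    (∀ (φ : Formula s k) → IsDTC φ → Closed φ →
    Σ (Automaton k s) (λ A → Deterministic A × WellBehaved A × (∀ (g : Graph s) → F g → (g ∈L A ⇔ g ⊨ φ))))
theorem7p3 s F searchable k 1≤k =
  (λ A det _ → case FromAutomaton.fromAutomaton A det of λ
    { (φ , dtc , closed , same) → φ , dtc , closed , λ g _ → same g })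
  , λ φ → fromFormula (fromℕ< 1≤k) F searchable φ
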